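{- Let $f:\mathbb{N}\to\mathbb{R}\setminus\{0\}$ be a multiplicative function such that $$\sum_{p\ \text{prime}:\ |f(p)|\neq 1}\frac1p<\infty .$$ Then there is a $u\in\{ -1,+1\}$ such that $$\limsup_{x\to\infty}\frac{1}{\log x}\sum_{n\le x}\frac{1_{f(n)=uf(n+2)}}{n}>0 .$$
   Context: $\mathbb{N}$ denotes the positive integers. A function $f$ on $\mathbb{N}$ is multiplicative if $f(1)=1$ and $f(mn)=f(m)f(n)$ whenever $\gcd(m,n)=1$. $1_P$ equals $1$ if $P$ holds and $0$ otherwise. -}

module Defs where

open import Level using (0ℓ)
open import Axiom.ExcludedMiddle using (ExcludedMiddle)
open import Data.Bool.Base using (if_then_else_)
open import Data.Integer.Base using (+_)
open import Data.Nat.Base as ℕ using (ℕ; zero; suc; NonZero; _!)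
open import Data.Nat.GCD using (gcd)
import Data.Nat.Properties as ℕ
open import Data.Product.Base using (Σ; ∃; _×_; _,_)
open import Data.Rational.Base as ℚ using (ℚ; 0ℚ; 1ℚ; ½)
import Data.Rational.Properties as ℚ
open import Data.Rational.Solver using (module +-*-Solver)
open import Data.Sum.Base using (_⊎_; inj₁; inj₂)
open import Data.Unit.Base using (⊤; tt)
open import Relation.Binary.PropositionalEquality
  using (_≡_; refl; sym; trans; cong; subst)
open import Relation.Nullary.Decidable.Core using (yes; no; does)
open import Relation.Nullary.Negation.Core using (¬_)

-- ℝ is the Cauchy completion of ℚ.  Sequences carry no modulus of convergence,
-- and equality of reals is the setoid relation _≃_.

IsCauchy : (ℕ → ℚ) → Set
IsCauchy s = ∀ ε → 0ℚ ℚ.< ε → ∃ λ N → ∀ m n → N ℕ.≤ m → N ℕ.≤ n →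
             ℚ.∣ s m ℚ.- s n ∣ ℚ.< ε

record ℝ : Set where
  constructor mkℝ
  field
    seq    : ℕ → ℚ
    cauchy : IsCauchy seq

open ℝ public

infix 4 _≃_ _<_ _≤_

_≃_ : ℝ → ℝ → Set
x ≃ y = ∀ ε → 0ℚ ℚ.< ε → ∃ λ N → ∀ n → N ℕ.≤ n →
        ℚ.∣ seq x n ℚ.- seq y n ∣ ℚ.< ε

_<_ : ℝ → ℝ → Set
x < y = ∃ λ ε → 0ℚ ℚ.< ε × ∃ λ N → ∀ n → N ℕ.≤ n →
        seq x n ℚ.+ ε ℚ.≤ seq y n

_≤_ : ℝ → ℝ → Set
x ≤ y = ¬ (y < x)

private
  half+half : ∀ p → p ℚ.* ½ ℚ.+ p ℚ.* ½ ≡ p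
  half+half p = trans (sym (ℚ.*-distribˡ-+ p ½ ½)) (ℚ.*-identityʳ p)

  half-pos : ∀ {p} → 0ℚ ℚ.< p → 0ℚ ℚ.< p ℚ.* ½
  half-pos 0<p = ℚ.*-monoˡ-<-pos ½ 0<p

  ≤⊔ˡ : ∀ {k} m n → m ℕ.⊔ n ℕ.≤ k → m ℕ.≤ k
  ≤⊔ˡ m n = ℕ.m⊔n≤o⇒m≤o m n

  ≤⊔ʳ : ∀ {k} m n → m ℕ.⊔ n ℕ.≤ k → n ℕ.≤ k
  ≤⊔ʳ m n = ℕ.m⊔n≤o⇒n≤o m n

  shift-≤ : ∀ p q → ℚ.∣ p ∣ ℚ.≤ ℚ.∣ p ℚ.- q ∣ ℚ.+ ℚ.∣ q ∣
  shift-≤ p q = subst (λ r → ℚ.∣ r ∣ ℚ.≤ ℚ.∣ p ℚ.- q ∣ ℚ.+ ℚ.∣ q ∣)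
    (solve 2 (λ a b → (a :- b) :+ b := a) refl p q)
    (ℚ.∣p+q∣≤∣p∣+∣q∣ (p ℚ.- q) q)
    where open +-*-Solver

  ∣-∣-comm : ∀ p q → ℚ.∣ p ℚ.- q ∣ ≡ ℚ.∣ q ℚ.- p ∣
  ∣-∣-comm p q = trans
    (cong ℚ.∣_∣ (solve 2 (λ a b → a :- b := :- (b :- a)) refl p q))
    (ℚ.∣-p∣≡∣p∣ (q ℚ.- p))
    where open +-*-Solver

  minus-≤ : ∀ {p q r} → p ℚ.≤ r ℚ.+ q → p ℚ.- q ℚ.≤ r
  minus-≤ {p} {q} {r} h = subst (p ℚ.- q ℚ.≤_)
    (solve 2 (λ a b → (a :+ b) :- b := a) refl r q) (ℚ.+-monoˡ-≤ (ℚ.- q) h)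
    where open +-*-Solver

  reverse-triangle : ∀ p q → ℚ.∣ ℚ.∣ p ∣ ℚ.- ℚ.∣ q ∣ ∣ ℚ.≤ ℚ.∣ p ℚ.- q ∣
  reverse-triangle p q with ℚ.∣p∣≡p∨∣p∣≡-p (ℚ.∣ p ∣ ℚ.- ℚ.∣ q ∣)
  ... | inj₁ e = subst (ℚ._≤ ℚ.∣ p ℚ.- q ∣) (sym e) (minus-≤ (shift-≤ p q))
  ... | inj₂ e = subst (ℚ._≤ ℚ.∣ p ℚ.- q ∣)
    (trans (solve 2 (λ a b → b :- a := :- (a :- b)) refl ℚ.∣ p ∣ ℚ.∣ q ∣) (sym e))
    (minus-≤ (subst (λ r → ℚ.∣ q ∣ ℚ.≤ r ℚ.+ ℚ.∣ p ∣) (∣-∣-comm q p) (shift-≤ q p)))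
    where open +-*-Solver

  eventually-bounded : ∀ {s} → IsCauchy s → ∃ λ B → ℚ.Positive B × ∃ λ N →
                       ∀ n → N ℕ.≤ n → ℚ.∣ s n ∣ ℚ.≤ B
  eventually-bounded {s} c with c 1ℚ (ℚ.positive⁻¹ 1ℚ)
  ... | N , h = 1ℚ ℚ.+ ℚ.∣ s N ∣ ,
    ℚ.positive (ℚ.+-mono-<-≤ (ℚ.positive⁻¹ 1ℚ) (ℚ.0≤∣p∣ (s N))) , N ,
    λ n N≤n → ℚ.≤-trans (shift-≤ (s n) (s N))
      (ℚ.+-monoˡ-≤ ℚ.∣ s N ∣ (ℚ.<⇒≤ (h n N N≤n ℕ.≤-refl)))

  +-cauchy : ∀ {s t} → IsCauchy s → IsCauchy t → IsCauchy (λ n → s n ℚ.+ t n)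
  +-cauchy {s} {t} cs ct ε 0<ε
    with cs (ε ℚ.* ½) (half-pos 0<ε) | ct (ε ℚ.* ½) (half-pos 0<ε)
  ... | M , hs | N , ht = M ℕ.⊔ N , λ m n lm ln →
    subst (ℚ.∣ s m ℚ.+ t m ℚ.- (s n ℚ.+ t n) ∣ ℚ.<_) (half+half ε)
      (ℚ.≤-<-trans
        (subst (λ r → ℚ.∣ r ∣ ℚ.≤ ℚ.∣ s m ℚ.- s n ∣ ℚ.+ ℚ.∣ t m ℚ.- t n ∣)
          (solve 4 (λ a b c d → (a :- b) :+ (c :- d) := (a :+ c) :- (b :+ d))
            refl (s m) (s n) (t m) (t n))
          (ℚ.∣p+q∣≤∣p∣+∣q∣ (s m ℚ.- s n) (t m ℚ.- t n)))
        (ℚ.+-mono-< (hs m n (≤⊔ˡ M N lm) (≤⊔ˡ M N ln))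
                    (ht m n (≤⊔ʳ M N lm) (≤⊔ʳ M N ln))))
    where open +-*-Solver

  neg-cauchy : ∀ {s} → IsCauchy s → IsCauchy (λ n → ℚ.- s n)
  neg-cauchy {s} cs ε 0<ε with cs ε 0<ε
  ... | N , h = N , λ m n lm ln → subst (ℚ._< ε)
    (cong ℚ.∣_∣ (solve 2 (λ a b → b :- a := (:- a) :- (:- b)) refl (s m) (s n)))
    (h n m ln lm)
    where open +-*-Solver

  scale : ∀ D ε → ℚ.Positive D → 0ℚ ℚ.< ε → ∃ λ δ → 0ℚ ℚ.< δ × D ℚ.* δ ≡ ε
  scale D ε D>0 0<ε = ε ℚ.* 1/D ,
    subst (ℚ._< ε ℚ.* 1/D) (ℚ.*-zeroˡ 1/D)
      (ℚ.*-monoˡ-<-pos 1/D {{ℚ.1/pos⇒pos D {{D>0}}}} 0<ε) ,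
    trans (ℚ.*-comm D (ε ℚ.* 1/D)) (trans (ℚ.*-assoc ε 1/D D)
      (trans (cong (ε ℚ.*_) (ℚ.*-inverseˡ D {{D≢0}})) (ℚ.*-identityʳ ε)))
    where
    D≢0 : ℚ.NonZero D
    D≢0 = ℚ.pos⇒nonZero D {{D>0}}
    1/D : ℚ
    1/D = (ℚ.1/ D) {{D≢0}}

  half< : ∀ {ε} → 0ℚ ℚ.< ε → ε ℚ.* ½ ℚ.< ε
  half< {ε} 0<ε = subst (ε ℚ.* ½ ℚ.<_) (half+half ε)
    (subst (ℚ._< ε ℚ.* ½ ℚ.+ ε ℚ.* ½) (ℚ.+-identityʳ (ε ℚ.* ½))
      (ℚ.+-monoʳ-< (ε ℚ.* ½) (half-pos 0<ε)))

  ∣*∣-≤ : ∀ {a b D d} → ℚ.Positive D → ℚ.∣ a ∣ ℚ.≤ D → ℚ.∣ b ∣ ℚ.≤ d →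
          ℚ.∣ a ℚ.* b ∣ ℚ.≤ D ℚ.* d
  ∣*∣-≤ {a} {b} {D} {d} D>0 ha hb = subst (ℚ._≤ D ℚ.* d) (sym (ℚ.∣p*q∣≡∣p∣*∣q∣ a b))
    (ℚ.≤-trans (ℚ.*-monoʳ-≤-nonNeg ℚ.∣ b ∣ {{ℚ.nonNegative (ℚ.0≤∣p∣ b)}} ha)
               (ℚ.*-monoˡ-≤-nonNeg D {{ℚ.pos⇒nonNeg D {{D>0}}}} hb))

  product-difference : ∀ a b c d →
    a ℚ.* (c ℚ.- d) ℚ.+ d ℚ.* (a ℚ.- b) ≡ a ℚ.* c ℚ.- b ℚ.* d
  product-difference = solve 4 (λ a b c d →
    a :* (c :- d) :+ d :* (a :- b) := (a :* c) :- (b :* d)) refl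
    where open +-*-Solver

  product-≤ : ∀ {a b c d B C δ} → ℚ.Positive B → ℚ.Positive C →
    ℚ.∣ a ∣ ℚ.≤ B → ℚ.∣ d ∣ ℚ.≤ C → ℚ.∣ a ℚ.- b ∣ ℚ.< δ → ℚ.∣ c ℚ.- d ∣ ℚ.< δ →
    ℚ.∣ a ℚ.* c ℚ.- b ℚ.* d ∣ ℚ.≤ (B ℚ.+ C) ℚ.* δ
  product-≤ {a} {b} {c} {d} {B} {C} {δ} B>0 C>0 ha hd hab hcd = begin
    ℚ.∣ a ℚ.* c ℚ.- b ℚ.* d ∣
      ≡⟨ cong ℚ.∣_∣ (product-difference a b c d) ⟨
    ℚ.∣ a ℚ.* (c ℚ.- d) ℚ.+ d ℚ.* (a ℚ.- b) ∣
      ≤⟨ ℚ.∣p+q∣≤∣p∣+∣q∣ (a ℚ.* (c ℚ.- d)) (d ℚ.* (a ℚ.- b)) ⟩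
    ℚ.∣ a ℚ.* (c ℚ.- d) ∣ ℚ.+ ℚ.∣ d ℚ.* (a ℚ.- b) ∣
      ≤⟨ ℚ.+-mono-≤ (∣*∣-≤ {a} {c ℚ.- d} B>0 ha (ℚ.<⇒≤ hcd))
                    (∣*∣-≤ {d} {a ℚ.- b} C>0 hd (ℚ.<⇒≤ hab)) ⟩
    B ℚ.* δ ℚ.+ C ℚ.* δ
      ≡⟨ ℚ.*-distribʳ-+ δ B C ⟨
    (B ℚ.+ C) ℚ.* δ ∎
    where open ℚ.≤-Reasoning

  *-cauchy : ∀ {s t} → IsCauchy s → IsCauchy t → IsCauchy (λ n → s n ℚ.* t n)
  *-cauchy {s} {t} cs ct ε 0<ε =
    let
      (B , B>0 , K , bs) = eventually-bounded {s} cs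
      (C , C>0 , L , bt) = eventually-bounded {t} ct
      (δ , 0<δ , eq) = scale (B ℚ.+ C) (ε ℚ.* ½)
                         (ℚ.pos+pos⇒pos B {{B>0}} C {{C>0}}) (half-pos 0<ε)
      (M , hs) = cs δ 0<δ
      (N , ht) = ct δ 0<δ
    in (K ℕ.⊔ L) ℕ.⊔ (M ℕ.⊔ N) , λ m n lm ln →
      let
        lm₁ = ≤⊔ˡ (K ℕ.⊔ L) (M ℕ.⊔ N) lm
        ln₁ = ≤⊔ˡ (K ℕ.⊔ L) (M ℕ.⊔ N) ln
        lm₂ = ≤⊔ʳ (K ℕ.⊔ L) (M ℕ.⊔ N) lm
        ln₂ = ≤⊔ʳ (K ℕ.⊔ L) (M ℕ.⊔ N) ln
      in ℚ.≤-<-trans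
        (product-≤ {s m} {s n} {t m} {t n} B>0 C>0
          (bs m (≤⊔ˡ K L lm₁)) (bt n (≤⊔ʳ K L ln₁))
          (hs m n (≤⊔ˡ M N lm₂) (≤⊔ˡ M N ln₂)) (ht m n (≤⊔ʳ M N lm₂) (≤⊔ʳ M N ln₂)))
        (subst (ℚ._< ε) (sym eq) (half< 0<ε))

  ∣∣-cauchy : ∀ {s} → IsCauchy s → IsCauchy (λ n → ℚ.∣ s n ∣)
  ∣∣-cauchy {s} cs ε 0<ε with cs ε 0<ε
  ... | N , h = N , λ m n lm ln →
    ℚ.≤-<-trans (reverse-triangle (s m) (s n)) (h m n lm ln)

  const-cauchy : ∀ q → IsCauchy (λ _ → q)
  const-cauchy q ε 0<ε = 0 , λ _ _ _ _ →
    subst (λ r → ℚ.∣ r ∣ ℚ.< ε) (sym (ℚ.+-inverseʳ q)) 0<ε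

infix  8 -_
infixl 7 _*_
infixl 6 _+_ _-_
infixr 8 _^_

fromℚ : ℚ → ℝ
fromℚ q = mkℝ (λ _ → q) (const-cauchy q)

fromℕ : ℕ → ℝ
fromℕ n = fromℚ (+ n ℚ./ 1)

0ℝ 1ℝ : ℝ
0ℝ = fromℚ 0ℚ
1ℝ = fromℚ 1ℚ

_+_ _*_ : ℝ → ℝ → ℝ
x + y = mkℝ (λ n → seq x n ℚ.+ seq y n) (+-cauchy {seq x} {seq y} (cauchy x) (cauchy y))
x * y = mkℝ (λ n → seq x n ℚ.* seq y n) (*-cauchy {seq x} {seq y} (cauchy x) (cauchy y))

-_ ∣_∣ : ℝ → ℝ
- x   = mkℝ (λ n → ℚ.- seq x n) (neg-cauchy {seq x} (cauchy x))
∣ x ∣ = mkℝ (λ n → ℚ.∣ seq x n ∣) (∣∣-cauchy {seq x} (cauchy x))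

_-_ : ℝ → ℝ → ℝ
x - y = x + (- y)

_^_ : ℝ → ℕ → ℝ
x ^ zero  = 1ℝ
x ^ suc n = x * x ^ n

_⟶_ : (ℕ → ℝ) → ℝ → Set
s ⟶ ℓ = ∀ ε → 0ℝ < ε → ∃ λ N → ∀ n → N ℕ.≤ n → ∣ s n - ℓ ∣ < ε

-- The extended real line [-∞,∞], as rounded lower cuts of ℚ: the point a
-- corresponds to { q ∈ ℚ : q < a }, so -∞ is the empty cut and +∞ is all of ℚ.

record ℝ̄ : Set₁ where
  field
    below   : ℚ → Set
    lower   : ∀ {q r} → q ℚ.< r → below r → below q
    rounded : ∀ {q} → below q → ∃ λ r → q ℚ.< r × below r

open ℝ̄ public

infix 4 _<̄_

_<̄_ : ℝ̄ → ℝ̄ → Set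
a <̄ b = ∃ λ q → ¬ below a q × below b q

+∞ : ℝ̄
+∞ = record
  { below   = λ _ → ⊤
  ; lower   = λ _ _ → tt
  ; rounded = λ {q} _ → q ℚ.+ 1ℚ ,
      subst (ℚ._< q ℚ.+ 1ℚ) (ℚ.+-identityʳ q) (ℚ.+-monoʳ-< q (ℚ.positive⁻¹ 1ℚ)) , tt
  }

ι : ℝ → ℝ̄
ι x = record
  { below   = λ q → fromℚ q < x
  ; lower   = λ { q<r (ε , 0<ε , N , h) → ε , 0<ε , N , λ n N≤n →
      ℚ.≤-trans (ℚ.+-monoˡ-≤ ε (ℚ.<⇒≤ q<r)) (h n N≤n) }
  ; rounded = λ { {q} (ε , 0<ε , N , h) → q ℚ.+ ε ℚ.* ½ ,
      subst (ℚ._< q ℚ.+ ε ℚ.* ½) (ℚ.+-identityʳ q) (ℚ.+-monoʳ-< q (half-pos 0<ε)) ,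
      ε ℚ.* ½ , half-pos 0<ε , N , λ n N≤n →
        subst (ℚ._≤ seq x n)
          (trans (cong (q ℚ.+_) (sym (half+half ε))) (sym (ℚ.+-assoc q (ε ℚ.* ½) (ε ℚ.* ½))))
          (h n N≤n) }
  }

⨆ : {I : Set} → (I → ℝ̄) → ℝ̄
⨆ a = record
  { below   = λ q → ∃ λ i → below (a i) q
  ; lower   = λ { q<r (i , h) → i , lower (a i) q<r h }
  ; rounded = λ { (i , h) → let (r , q<r , k) = rounded (a i) h in r , q<r , i , k }
  }

-- The intersection of cuts need not be rounded, whence the rational r > q.

⨅ : {I : Set} → (I → ℝ̄) → ℝ̄
⨅ a = record
  { below   = λ q → ∃ λ r → q ℚ.< r × (∀ i → below (a i) r)
  ; lower   = λ { q<q′ (r , q′<r , h) → r , ℚ.<-trans q<q′ q′<r , h }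
  ; rounded = λ { (r , q<r , h) →
      let (m , q<m , m<r) = ℚ.<-dense q<r in m , q<m , r , m<r , h }
  }

limsup : (ℝ → ℝ) → ℝ̄
limsup F = ⨅ λ X → ⨆ λ ((x , _) : Σ ℝ (X ≤_)) → ι (F x)

-- Functions and sequences on the positive integers.

Arith : Set
Arith = (n : ℕ) → .{{NonZero n}} → ℝ

∑₁ : ℕ → Arith → ℝ
∑₁ zero    a = 0ℝ
∑₁ (suc N) a = ∑₁ N a + a (suc N)

-- The sum of a series of nonnegative terms, in [0,∞].

∑∞ : Arith → ℝ̄
∑∞ a = ⨆ λ N → ι (∑₁ N a)

1/ℕ : Arith
1/ℕ n = fromℚ (+ 1 ℚ./ n)

Multiplicative : Arith → Set
Multiplicative f =
  f 1 ≃ 1ℝ ×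
  (∀ m n .{{_ : NonZero m}} .{{_ : NonZero n}} → gcd m n ≡ 1 →
    f (m ℕ.* n) {{ℕ.m*n≢0 m n}} ≃ f m * f n)

-- Excluded middle is needed to make 1_P a real number for an arbitrary
-- proposition P, and to turn unique existence into a function.

module Classical (em : ExcludedMiddle 0ℓ) where

  -- "the a such that P a", with a default that is only returned if no such a exists.

  the : {A : Set} → A → (A → Set) → A
  the {A} default P with em {Σ A P}
  ... | yes (a , _) = a
  ... | no  _       = default

  𝟏 : Set → ℝ
  𝟏 P = if does (em {P}) then 1ℝ else 0ℝ

  lim : (ℕ → ℝ) → ℝ
  lim s = the 0ℝ λ ℓ → s ⟶ ℓ

  infix 9 _⁻¹

  _⁻¹ : ℝ → ℝ
  x ⁻¹ = the 0ℝ λ y → x * y ≃ 1ℝ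

  expPartial : ℝ → ℕ → ℝ
  expPartial x zero    = 0ℝ
  expPartial x (suc k) = expPartial x k + x ^ k * fromℚ ((+ 1 ℚ./ k !) {{k ℕ.!≢0}})

  exp : ℝ → ℝ
  exp x = lim (expPartial x)

  -- The natural logarithm; the default is taken exactly when x is not positive.

  log : ℝ → ℝ
  log x = the 0ℝ λ y → exp y ≃ x

  -- For x < 0 the value is 0 rather than the usual floor.

  ⌊_⌋ : ℝ → ℕ
  ⌊ x ⌋ = the 0 λ n → fromℕ n ≤ x × x < fromℕ (suc n)

  ∑≤ : ℝ → Arith → ℝ
  ∑≤ x a = ∑₁ ⌊ x ⌋ a

module Submission where

-- Let Q = P! and consider n = kQ - 1, n + 2 = kQ + 1; both are prime to Q.  If
-- neither is divisible by a prime p > P with |f(p)| ≠ 1 or by the square of a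
-- prime p > P, then |f(n)| = |f(n + 2)| = 1, so that f(n) = ± f(n + 2).  For d
-- prime to Q, the k ≤ K with d ∣ kQ ± 1 have gaps at least d, hence their
-- reciprocals sum to at most (Q + 1 + H_K) / d.  Since ∑ 1/p over p > P with
-- |f(p)| ≠ 1 and ∑ 1/p² over p > P are small for large P, at least about half of
-- H_K remains, uniformly in K, and one of the two signs occurs for a positive
-- proportion.  The limsup is tested along x = e^(2j), where log x = 2j and
-- x ≥ 2^j; as log is specified only by exp (log x) = x, this needs that exp is
-- injective, which for negative arguments rests on e^t e^(-t) = 1.

-- Primes up to P divide too many integers to be sieved out, so coprimality to Q keeps them away
-- instead. Squares must go as well because a multiplicative function is unconstrained at p²: what
-- survives is squarefree, and its value is a product over distinct primes with |f(p)| = 1. The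
-- obstacle is analytic rather than arithmetic. A real is a Cauchy sequence without modulus, and
-- `exp`, `log`, the reciprocal and the floor are values picked by excluded middle, known only
-- through their defining property. All estimates are therefore made in ℚ, on the terms of the
-- sequences: indicator sums are constant sequences, and of the factor 1/log x only a lower bound up
-- to a constant is needed. The points e^(2j) are used because their logarithm is an integer; the 2
-- makes the single term (2j)^j/j! of the series already at least 2^j.

module Rationals where

  open import Data.Bool.Base using (if_then_else_)
  open import Data.Integer.Base as ℤ using ()
  import Data.Integer.Properties as ℤ
  open import Data.Nat.Base as ℕ using (ℕ; zero; suc; NonZero; _!)
  open import Data.Nat.Induction using (<-rec)
  import Data.Nat.Properties as ℕ
  open import Data.Product.Base using (∃; _×_; _,_; proj₁; proj₂)
  open import Data.Rational.Base hiding (NonZero)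
  open import Data.Rational.Properties
  open import Data.Rational.Solver using (module +-*-Solver)
  import Data.Rational.Unnormalised.Base as ℚᵘ
  import Data.Rational.Unnormalised.Properties as ℚᵘ
  open import Data.Sum.Base using (_⊎_; inj₁; inj₂)
  open import Function.Base using (_∘_)
  open import Relation.Binary.PropositionalEquality
  open import Relation.Nullary.Decidable.Core using (Dec; yes; no; does)
  open import Relation.Nullary.Negation.Core using (¬_; contradiction)
  open +-*-Solver using (solve; _:=_; _:+_; _:*_; _:-_; :-_; con)

  -- Order and arithmetic in ℚ

  ≤-by-difference : ∀ {p q} d → 0ℚ ≤ d → q ≡ p + d → p ≤ q
  ≤-by-difference {p} d 0≤d refl = subst (_≤ p + d) (+-identityʳ p) (+-monoʳ-≤ p 0≤d)

  p≤q⇒0≤q-p : ∀ {p q} → p ≤ q → 0ℚ ≤ q - p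
  p≤q⇒0≤q-p {p} {q} p≤q = subst (_≤ q - p) (+-inverseʳ p) (+-monoˡ-≤ (- p) p≤q)

  +-nonneg : ∀ {p q} → 0ℚ ≤ p → 0ℚ ≤ q → 0ℚ ≤ p + q
  +-nonneg = +-mono-≤

  *-nonneg : ∀ {p q} → 0ℚ ≤ p → 0ℚ ≤ q → 0ℚ ≤ p * q
  *-nonneg {p} {q} 0≤p 0≤q = subst (_≤ p * q) (*-zeroˡ q)
    (*-monoʳ-≤-nonNeg q {{nonNegative 0≤q}} 0≤p)

  *-pos : ∀ {p q} → 0ℚ < p → 0ℚ < q → 0ℚ < p * q
  *-pos {p} {q} 0<p 0<q = subst (_< p * q) (*-zeroˡ q)
    (*-monoˡ-<-pos q {{positive 0<q}} 0<p)

  *-monoˡ : ∀ {p q} r → 0ℚ ≤ r → p ≤ q → p * r ≤ q * r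
  *-monoˡ r 0≤r = *-monoʳ-≤-nonNeg r {{nonNegative 0≤r}}

  *-monoʳ : ∀ {p q} r → 0ℚ ≤ r → p ≤ q → r * p ≤ r * q
  *-monoʳ r 0≤r = *-monoˡ-≤-nonNeg r {{nonNegative 0≤r}}

  *-mono : ∀ {p q r s} → 0ℚ ≤ p → 0ℚ ≤ s → p ≤ q → r ≤ s → p * r ≤ q * s
  *-mono {p} {q} {r} {s} 0≤p 0≤s p≤q r≤s = ≤-trans (*-monoʳ p 0≤p r≤s) (*-monoˡ s 0≤s p≤q)

  *-cancel-≤ : ∀ {p q} r → 0ℚ < r → p * r ≤ q * r → p ≤ q
  *-cancel-≤ r 0<r = *-cancelʳ-≤-pos r {{positive 0<r}}

  *-cancel-≡ : ∀ {p q} r → 0ℚ < r → p * r ≡ q * r → p ≡ q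
  *-cancel-≡ r 0<r e = ≤-antisym (*-cancel-≤ r 0<r (≤-reflexive e))
                                 (*-cancel-≤ r 0<r (≤-reflexive (sym e)))

  -- Natural numbers and their reciprocals in ℚ

  ⌜_⌝ : ℕ → ℚ
  ⌜ n ⌝ = ℤ.+ n / 1

  private
    toℚᵘ-⌜⌝ : ∀ n → toℚᵘ ⌜ n ⌝ ℚᵘ.≃ ℚᵘ.mkℚᵘ (ℤ.+ n) 0
    toℚᵘ-⌜⌝ n = toℚᵘ-fromℚᵘ (ℚᵘ.mkℚᵘ (ℤ.+ n) 0)

  ⌜+⌝ : ∀ m n → ⌜ m ℕ.+ n ⌝ ≡ ⌜ m ⌝ + ⌜ n ⌝
  ⌜+⌝ m n = toℚᵘ-injective (ℚᵘ.≃-trans (toℚᵘ-⌜⌝ (m ℕ.+ n)) (ℚᵘ.≃-trans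
    (ℚᵘ.*≡* (cong (ℤ._* ℤ.+ 1) (trans (ℤ.pos-+ m n)
      (sym (cong₂ ℤ._+_ (ℤ.*-identityʳ (ℤ.+ m)) (ℤ.*-identityʳ (ℤ.+ n)))))))
    (ℚᵘ.≃-sym (ℚᵘ.≃-trans (toℚᵘ-homo-+ ⌜ m ⌝ ⌜ n ⌝) (ℚᵘ.+-cong (toℚᵘ-⌜⌝ m) (toℚᵘ-⌜⌝ n))))))

  ⌜*⌝ : ∀ m n → ⌜ m ℕ.* n ⌝ ≡ ⌜ m ⌝ * ⌜ n ⌝
  ⌜*⌝ m n = toℚᵘ-injective (ℚᵘ.≃-trans (toℚᵘ-⌜⌝ (m ℕ.* n)) (ℚᵘ.≃-trans
    (ℚᵘ.*≡* (cong (ℤ._* ℤ.+ 1) (ℤ.pos-* m n)))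
    (ℚᵘ.≃-sym (ℚᵘ.≃-trans (toℚᵘ-homo-* ⌜ m ⌝ ⌜ n ⌝) (ℚᵘ.*-cong (toℚᵘ-⌜⌝ m) (toℚᵘ-⌜⌝ n))))))

  0≤⌜⌝ : ∀ n → 0ℚ ≤ ⌜ n ⌝
  0≤⌜⌝ n = nonNegative⁻¹ ⌜ n ⌝ {{normalize-nonNeg n 1}}

  0<⌜⌝ : ∀ n .{{_ : NonZero n}} → 0ℚ < ⌜ n ⌝
  0<⌜⌝ n = positive⁻¹ ⌜ n ⌝ {{normalize-pos n 1}}

  ⌜⌝-mono : ∀ {m n} → m ℕ.≤ n → ⌜ m ⌝ ≤ ⌜ n ⌝
  ⌜⌝-mono {m} {n} m≤n = ≤-by-difference ⌜ n ℕ.∸ m ⌝ (0≤⌜⌝ (n ℕ.∸ m))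
    (trans (cong ⌜_⌝ (sym (ℕ.m+[n∸m]≡n m≤n))) (⌜+⌝ m (n ℕ.∸ m)))

  ⌜⌝-mono-< : ∀ {m n} → m ℕ.< n → ⌜ m ⌝ < ⌜ n ⌝
  ⌜⌝-mono-< {m} {n} m<n = <-≤-trans
    (subst₂ _<_ (+-identityˡ ⌜ m ⌝) (sym (⌜+⌝ 1 m)) (+-monoˡ-< ⌜ m ⌝ (positive⁻¹ 1ℚ)))
    (⌜⌝-mono m<n)

  ⌜⌝-cancel-< : ∀ {m n} → ⌜ m ⌝ < ⌜ n ⌝ → m ℕ.< n
  ⌜⌝-cancel-< {m} {n} h with ℕ.<-≤-connex m n
  ... | inj₁ m<n = m<n
  ... | inj₂ n≤m = contradiction h (λ h → <-irrefl refl (<-≤-trans h (⌜⌝-mono n≤m)))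

  archimedean : ∀ q → ∃ λ n → q < ⌜ n ⌝
  archimedean q@(mkℚ (ℤ.+ n) d _) = suc n , ≤-<-trans q≤n (⌜⌝-mono-< (ℕ.n<1+n n))
    where
    q≤n : q ≤ ⌜ n ⌝
    q≤n = toℚᵘ-cancel-≤ (ℚᵘ.≤-trans (ℚᵘ.*≤* (ℤ.*-monoˡ-≤-nonNeg (ℤ.+ n) (ℤ.+≤+ (ℕ.s≤s ℕ.z≤n))))
      (ℚᵘ.≤-reflexive (ℚᵘ.≃-sym (toℚᵘ-⌜⌝ n))))
  archimedean q@(mkℚ (ℤ.-[1+ n ]) d _) = 0 , negative⁻¹ q

  -- The value at 0 is 0.
  inv : ℕ → ℚ
  inv zero    = 0ℚ
  inv (suc n) = ℤ.+ 1 / suc n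

  inv-* : ∀ n .{{_ : NonZero n}} → inv n * ⌜ n ⌝ ≡ 1ℚ
  inv-* (suc n) = toℚᵘ-injective (ℚᵘ.≃-trans (toℚᵘ-homo-* (inv (suc n)) ⌜ suc n ⌝)
    (ℚᵘ.≃-trans (ℚᵘ.*-cong (toℚᵘ-fromℚᵘ (ℚᵘ.mkℚᵘ (ℤ.+ 1) n)) (toℚᵘ-⌜⌝ (suc n)))
     (ℚᵘ.*≡* (trans (ℤ.*-identityʳ _) (trans (ℤ.*-comm (ℤ.+ 1) (ℤ.+ suc n)) (trans
       (cong (λ t → ℤ.+ suc t ℤ.* ℤ.+ 1) (sym (ℕ.*-identityʳ n))) (ℤ.*-comm (ℤ.+ suc (n ℕ.* 1)) (ℤ.+ 1))))))))

  0≤inv : ∀ n → 0ℚ ≤ inv n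
  0≤inv zero    = ≤-refl
  0≤inv (suc n) = nonNegative⁻¹ (inv (suc n)) {{normalize-nonNeg 1 (suc n)}}

  0<inv : ∀ n .{{_ : NonZero n}} → 0ℚ < inv n
  0<inv (suc n) = positive⁻¹ (inv (suc n)) {{normalize-pos 1 (suc n)}}

  inv-unique : ∀ n .{{_ : NonZero n}} {q} → q * ⌜ n ⌝ ≡ 1ℚ → q ≡ inv n
  inv-unique n e = *-cancel-≡ ⌜ n ⌝ (0<⌜⌝ n) (trans e (sym (inv-* n)))

  inv-*-homo : ∀ m n .{{_ : NonZero m}} .{{_ : NonZero n}} → inv (m ℕ.* n) ≡ inv m * inv n
  inv-*-homo m n = sym (inv-unique (m ℕ.* n) {{ℕ.m*n≢0 m n}} (begin
    inv m * inv n * ⌜ m ℕ.* n ⌝        ≡⟨ cong (inv m * inv n *_) (⌜*⌝ m n) ⟩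
    inv m * inv n * (⌜ m ⌝ * ⌜ n ⌝)    ≡⟨ solve 4 (λ a b c d → a :* b :* (c :* d) := (a :* c) :* (b :* d)) refl
                                           (inv m) (inv n) ⌜ m ⌝ ⌜ n ⌝ ⟩
    (inv m * ⌜ m ⌝) * (inv n * ⌜ n ⌝)  ≡⟨ cong₂ _*_ (inv-* m) (inv-* n) ⟩
    1ℚ * 1ℚ                            ≡⟨ *-identityˡ 1ℚ ⟩
    1ℚ                                 ∎))
    where open ≡-Reasoning

  inv-≤ : ∀ m n c .{{_ : NonZero m}} → n ℕ.≤ c ℕ.* m → ⌜ n ⌝ * inv m ≤ ⌜ c ⌝
  inv-≤ m n c n≤cm = *-cancel-≤ ⌜ m ⌝ (0<⌜⌝ m) (subst₂ _≤_
    (sym (trans (*-assoc ⌜ n ⌝ (inv m) ⌜ m ⌝) (trans (cong (⌜ n ⌝ *_) (inv-* m)) (*-identityʳ ⌜ n ⌝))))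
    (⌜*⌝ c m) (⌜⌝-mono n≤cm))

  inv-antimono : ∀ {m n} .{{_ : NonZero m}} → m ℕ.≤ n → inv n ≤ inv m
  inv-antimono {m} {n} m≤n = *-cancel-≤ ⌜ m ⌝ (0<⌜⌝ m) (subst₂ _≤_ (*-comm ⌜ m ⌝ (inv n)) (sym (inv-* m))
    (inv-≤ n m 1 {{n≢0}} (subst (m ℕ.≤_) (sym (ℕ.*-identityˡ n)) m≤n)))
    where n≢0 = ℕ.>-nonZero (ℕ.<-≤-trans (ℕ.>-nonZero⁻¹ m) m≤n)

  eventually-inv : ∀ C {ε} → 0ℚ < ε → ∃ λ N → ∀ n → N ℕ.≤ n → C * inv n < ε
  eventually-inv C {ε} 0<ε = N , bound
    where
    instance _ = pos⇒nonZero ε {{positive 0<ε}}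
    N′ N : ℕ
    N′ = proj₁ (archimedean (C * 1/ ε))
    -- The successor excludes n = 0, at which `inv` is not a reciprocal.
    N = suc N′
    C<Nε : ∀ n → N ℕ.≤ n → C < ⌜ n ⌝ * ε
    C<Nε n N≤n = subst (_< ⌜ n ⌝ * ε)
      (trans (*-assoc C (1/ ε) ε) (trans (cong (C *_) (*-inverseˡ ε)) (*-identityʳ C)))
      (*-monoˡ-<-pos ε {{positive 0<ε}} (<-≤-trans (proj₂ (archimedean (C * 1/ ε)))
        (⌜⌝-mono (ℕ.≤-trans (ℕ.n≤1+n N′) N≤n))))
    bound : ∀ n → N ℕ.≤ n → C * inv n < ε
    bound (suc n) N≤n = subst (C * inv (suc n) <_)
      (trans (solve 3 (λ a b c → a :* b :* c := (c :* a) :* b) refl ⌜ suc n ⌝ ε (inv (suc n)))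
        (trans (cong (_* ε) (inv-* (suc n))) (*-identityˡ ε)))
      (*-monoˡ-<-pos (inv (suc n)) {{positive (0<inv (suc n))}} (C<Nε (suc n) N≤n))

  +-nonZeroʳ : ∀ m n .{{_ : NonZero n}} → NonZero (m ℕ.+ n)
  +-nonZeroʳ m n = ℕ.>-nonZero (ℕ.<-≤-trans (ℕ.>-nonZero⁻¹ n) (ℕ.m≤n+m n m))

  -- Finite sums indexed from 1, and indicators

  ∑ : ℕ → (ℕ → ℚ) → ℚ
  ∑ zero    a = 0ℚ
  ∑ (suc N) a = ∑ N a + a (suc N)

  ∑-mono : ∀ N {a b} → (∀ n .{{_ : NonZero n}} → n ℕ.≤ N → a n ≤ b n) → ∑ N a ≤ ∑ N b
  ∑-mono zero    h = ≤-refl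
  ∑-mono (suc N) h = +-mono-≤ (∑-mono N (λ n n≤N → h n (ℕ.m≤n⇒m≤1+n n≤N))) (h (suc N) ℕ.≤-refl)

  ∑-cong : ∀ N {a b} → (∀ n .{{_ : NonZero n}} → n ℕ.≤ N → a n ≡ b n) → ∑ N a ≡ ∑ N b
  ∑-cong N h = ≤-antisym (∑-mono N (λ n n≤N → ≤-reflexive (h n n≤N)))
                         (∑-mono N (λ n n≤N → ≤-reflexive (sym (h n n≤N))))

  ∑-+ : ∀ N a b → ∑ N (λ n → a n + b n) ≡ ∑ N a + ∑ N b
  ∑-+ zero    a b = refl
  ∑-+ (suc N) a b = trans (cong (_+ (a (suc N) + b (suc N))) (∑-+ N a b))
    (solve 4 (λ p q r s → (p :+ q) :+ (r :+ s) := (p :+ r) :+ (q :+ s)) refl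
      (∑ N a) (∑ N b) (a (suc N)) (b (suc N)))

  ∑-*ʳ : ∀ N a c → ∑ N (λ n → a n * c) ≡ ∑ N a * c
  ∑-*ʳ zero    a c = sym (*-zeroˡ c)
  ∑-*ʳ (suc N) a c = trans (cong (_+ a (suc N) * c) (∑-*ʳ N a c)) (sym (*-distribʳ-+ c (∑ N a) (a (suc N))))

  ∑-*ˡ : ∀ N c a → ∑ N (λ n → c * a n) ≡ c * ∑ N a
  ∑-*ˡ zero    c a = sym (*-zeroʳ c)
  ∑-*ˡ (suc N) c a = trans (cong (_+ c * a (suc N)) (∑-*ˡ N c a)) (sym (*-distribˡ-+ c (∑ N a) (a (suc N))))

  ∑-zero : ∀ N → ∑ N (λ _ → 0ℚ) ≡ 0ℚ
  ∑-zero zero    = refl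
  ∑-zero (suc N) = cong (_+ 0ℚ) (∑-zero N)

  ∑-nonneg : ∀ N {a} → (∀ n .{{_ : NonZero n}} → 0ℚ ≤ a n) → 0ℚ ≤ ∑ N a
  ∑-nonneg zero    h = ≤-refl
  ∑-nonneg (suc N) h = +-nonneg (∑-nonneg N h) (h (suc N))

  ∑-swap : ∀ M N (a : ℕ → ℕ → ℚ) → ∑ M (λ m → ∑ N (a m)) ≡ ∑ N (λ n → ∑ M (λ m → a m n))
  ∑-swap zero    N a = sym (∑-zero N)
  ∑-swap (suc M) N a = trans (cong (_+ ∑ N (a (suc M))) (∑-swap M N a))
    (sym (∑-+ N (λ n → ∑ M (λ m → a m n)) (a (suc M))))

  ∑-split : ∀ M N a → ∑ (M ℕ.+ N) a ≡ ∑ M a + ∑ N (a ∘ (M ℕ.+_))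
  ∑-split M zero    a = trans (cong (λ t → ∑ t a) (ℕ.+-identityʳ M)) (sym (+-identityʳ (∑ M a)))
  ∑-split M (suc N) a = begin
    ∑ (M ℕ.+ suc N) a                                    ≡⟨ cong (λ t → ∑ t a) (ℕ.+-suc M N) ⟩
    ∑ (M ℕ.+ N) a + a (suc (M ℕ.+ N))                    ≡⟨ cong₂ _+_ (∑-split M N a) (cong a (sym (ℕ.+-suc M N))) ⟩
    ∑ M a + ∑ N (a ∘ (M ℕ.+_)) + a (M ℕ.+ suc N)         ≡⟨ +-assoc (∑ M a) _ _ ⟩
    ∑ M a + (∑ N (a ∘ (M ℕ.+_)) + a (M ℕ.+ suc N))       ∎
    where open ≡-Reasoning

  ∑-extend : ∀ {M N} a → (∀ n .{{_ : NonZero n}} → 0ℚ ≤ a n) → M ℕ.≤ N → ∑ M a ≤ ∑ N a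
  ∑-extend {M} {N} a 0≤a M≤N = ≤-by-difference (∑ (N ℕ.∸ M) (a ∘ (M ℕ.+_)))
    (nonneg (N ℕ.∸ M)) (trans (cong (λ t → ∑ t a) (sym (ℕ.m+[n∸m]≡n M≤N))) (∑-split M (N ℕ.∸ M) a))
    where
    nonneg : ∀ K → 0ℚ ≤ ∑ K (a ∘ (M ℕ.+_))
    nonneg zero    = ≤-refl
    nonneg (suc K) = +-nonneg (nonneg K) (0≤a (M ℕ.+ suc K) {{+-nonZeroʳ M (suc K)}})

  term≤∑ : ∀ {N} a → (∀ n .{{_ : NonZero n}} → 0ℚ ≤ a n) → ∀ n .{{_ : NonZero n}} → n ℕ.≤ N → a n ≤ ∑ N a
  term≤∑ a 0≤a (suc n) n<N = ≤-trans (≤-by-difference (∑ n a) (∑-nonneg n 0≤a) (+-comm (∑ n a) (a (suc n))))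
    (∑-extend a 0≤a n<N)

  𝟙 : {P : Set} → Dec P → ℚ
  𝟙 d = if does d then 1ℚ else 0ℚ

  0≤𝟙 : ∀ {P} (d : Dec P) → 0ℚ ≤ 𝟙 d
  0≤𝟙 (yes _) = nonNegative⁻¹ 1ℚ
  0≤𝟙 (no _)  = ≤-refl

  𝟙-yes : ∀ {P} (d : Dec P) → P → 𝟙 d ≡ 1ℚ
  𝟙-yes (yes _) _ = refl
  𝟙-yes (no ¬p) p = contradiction p ¬p

  𝟙-no : ∀ {P} (d : Dec P) → ¬ P → 𝟙 d ≡ 0ℚ
  𝟙-no (yes p) ¬p = contradiction p ¬p
  𝟙-no (no _)  _  = refl

  ∑-const : ∀ N c → ∑ N (λ _ → c) ≡ ⌜ N ⌝ * c
  ∑-const zero    c = sym (*-zeroˡ c)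
  ∑-const (suc N) c = begin
    ∑ N (λ _ → c) + c   ≡⟨ cong (_+ c) (∑-const N c) ⟩
    ⌜ N ⌝ * c + c       ≡⟨ solve 2 (λ n c → n :* c :+ c := (con 1ℚ :+ n) :* c) refl ⌜ N ⌝ c ⟩
    (1ℚ + ⌜ N ⌝) * c    ≡⟨ cong (_* c) (⌜+⌝ 1 N) ⟨
    ⌜ suc N ⌝ * c       ∎
    where open ≡-Reasoning

  -- Harmonic sums, in full and along sparse sets

  harmonic : ℕ → ℚ
  harmonic N = ∑ N inv

  0≤harmonic : ∀ N → 0ℚ ≤ harmonic N
  0≤harmonic N = ∑-nonneg N (λ n → 0≤inv n)

  -- Each of the d terms after the m-th is at least 1/(m + d). With d = m this drives the doubling
  -- in `harmonic-2^`; with d the gap of a sparse set it is the harmonic mass of one window.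
  harmonic-growth : ∀ m d → harmonic m + ⌜ d ⌝ * inv (m ℕ.+ d) ≤ harmonic (m ℕ.+ d)
  harmonic-growth m d = subst (harmonic m + ⌜ d ⌝ * inv (m ℕ.+ d) ≤_) (sym (∑-split m d inv))
    (+-monoʳ-≤ (harmonic m) (subst (_≤ ∑ d (inv ∘ (m ℕ.+_))) (∑-const d (inv (m ℕ.+ d)))
      (∑-mono d (λ i i≤d → inv-antimono {{+-nonZeroʳ m i}} (ℕ.+-monoʳ-≤ m i≤d)))))

  -- Oresme's argument: the block from N + 1 to 2N has N terms, each at least 1/(2N).
  harmonic-2^ : ∀ j → ⌜ j ⌝ * ½ ≤ harmonic (2 ℕ.^ j)
  harmonic-2^ zero    = ≤-trans (≤-reflexive (*-zeroˡ ½)) (0≤harmonic 1)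
  harmonic-2^ (suc j) = ≤-trans (≤-reflexive lhs) (≤-trans (+-monoˡ-≤ ½ (harmonic-2^ j))
    (subst₂ _≤_ (cong (λ t → harmonic N + t) rhs) (cong harmonic N+N) (harmonic-growth N N)))
    where
    N = 2 ℕ.^ j
    instance _ = ℕ.m^n≢0 2 j
    N+N : N ℕ.+ N ≡ 2 ℕ.^ suc j
    N+N = cong (N ℕ.+_) (sym (ℕ.+-identityʳ N))
    lhs : ⌜ suc j ⌝ * ½ ≡ ⌜ j ⌝ * ½ + ½
    lhs = trans (cong (_* ½) (⌜+⌝ 1 j)) (solve 2 (λ n h → (con 1ℚ :+ n) :* h := n :* h :+ h) refl ⌜ j ⌝ ½)
    rhs : ⌜ N ⌝ * inv (N ℕ.+ N) ≡ ½
    rhs = begin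
      ⌜ N ⌝ * inv (N ℕ.+ N)      ≡⟨ cong (λ t → ⌜ N ⌝ * inv t) N+N ⟩
      ⌜ N ⌝ * inv (2 ℕ.* N)      ≡⟨ cong (⌜ N ⌝ *_) (inv-*-homo 2 N) ⟩
      ⌜ N ⌝ * (½ * inv N)        ≡⟨ solve 3 (λ a b c → a :* (b :* c) := b :* (c :* a)) refl ⌜ N ⌝ ½ (inv N) ⟩
      ½ * (inv N * ⌜ N ⌝)        ≡⟨ cong (½ *_) (inv-* N) ⟩
      ½ * 1ℚ                     ≡⟨ *-identityʳ ½ ⟩
      ½                          ∎
      where open ≡-Reasoning

  module _ {h : ℕ → Set} (h? : ∀ k → Dec (h k)) (d C : ℕ) .{{d≢0 : NonZero d}}
    (gap : ∀ k e .{{_ : NonZero k}} .{{_ : NonZero e}} → h k → h (k ℕ.+ e) → d ℕ.≤ e)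
    (first : ∀ k .{{_ : NonZero k}} → h k → d ℕ.≤ C ℕ.* k) where

    private
      T : ℕ → ℚ
      T K = ∑ K (λ k → 𝟙 (h? k) * inv k)

      no-hits : ∀ m e → (∀ i .{{_ : NonZero i}} → i ℕ.≤ e → ¬ h (m ℕ.+ i)) → T (m ℕ.+ e) ≡ T m
      no-hits m e ¬h = begin
        T (m ℕ.+ e)            ≡⟨ ∑-split m e _ ⟩
        T m + ∑ e (λ i → 𝟙 (h? (m ℕ.+ i)) * inv (m ℕ.+ i)) ≡⟨ cong (T m +_) (∑-cong e (λ i i≤e →
                                    trans (cong (_* inv (m ℕ.+ i)) (𝟙-no (h? (m ℕ.+ i)) (¬h i i≤e))) (*-zeroˡ (inv (m ℕ.+ i))))) ⟩
        T m + ∑ e (λ _ → 0ℚ)   ≡⟨ cong (T m +_) (∑-zero e) ⟩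
        T m + 0ℚ               ≡⟨ +-identityʳ (T m) ⟩
        T m                    ∎
        where open ≡-Reasoning

      -- A hit at m + i with 1 ≤ i ≤ e would lie at distance suc e - i ≤ e < d from the hit at m +
      -- suc e, against `gap`.
      no-hits-before : ∀ m e → e ℕ.< d → h (m ℕ.+ suc e) → T (m ℕ.+ e) ≡ T m
      no-hits-before m e e<d hit = no-hits m e λ i i≤e hi →
        let e+1≡i+r = sym (ℕ.m+[n∸m]≡n (ℕ.m≤n⇒m≤1+n i≤e)) in
        ℕ.<⇒≱ e<d (ℕ.≤-trans
          (gap (m ℕ.+ i) (suc e ℕ.∸ i) {{+-nonZeroʳ m i}} {{ℕ.>-nonZero (ℕ.m<n⇒0<n∸m (ℕ.s≤s i≤e))}} hi
            (subst h (trans (cong (m ℕ.+_) e+1≡i+r) (sym (ℕ.+-assoc m i _))) hit))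
          (ℕ.≤-pred (ℕ.≤-trans (ℕ.∸-monoʳ-< {suc e} {i} {0} (ℕ.>-nonZero⁻¹ i) (ℕ.m≤n⇒m≤1+n i≤e)) ℕ.≤-refl)))

      Bound : ℕ → Set
      Bound K = ⌜ d ⌝ * T K ≤ ⌜ C ⌝ + harmonic K

      step-hit : ∀ m e → e ℕ.< d → h (m ℕ.+ suc e) →
        ⌜ d ⌝ * T m + ⌜ d ⌝ * inv (m ℕ.+ suc e) ≤ ⌜ C ⌝ + harmonic (m ℕ.+ suc e) → Bound (m ℕ.+ suc e)
      step-hit m e e<d hit le = subst (_≤ ⌜ C ⌝ + harmonic (m ℕ.+ suc e)) (sym eq) le
        where
        eq : ⌜ d ⌝ * T (m ℕ.+ suc e) ≡ ⌜ d ⌝ * T m + ⌜ d ⌝ * inv (m ℕ.+ suc e)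
        eq = begin
          ⌜ d ⌝ * T (m ℕ.+ suc e)  ≡⟨ cong (λ t → ⌜ d ⌝ * T t) (ℕ.+-suc m e) ⟩
          ⌜ d ⌝ * T (suc (m ℕ.+ e)) ≡⟨ cong (⌜ d ⌝ *_) (cong₂ _+_ (no-hits-before m e e<d hit)
            (trans (cong (_* inv (suc (m ℕ.+ e))) (𝟙-yes (h? (suc (m ℕ.+ e))) (subst h (ℕ.+-suc m e) hit))) (*-identityˡ _))) ⟩
          ⌜ d ⌝ * (T m + inv (suc (m ℕ.+ e))) ≡⟨ *-distribˡ-+ ⌜ d ⌝ (T m) _ ⟩
          ⌜ d ⌝ * T m + ⌜ d ⌝ * inv (suc (m ℕ.+ e)) ≡⟨ cong (λ t → ⌜ d ⌝ * T m + ⌜ d ⌝ * inv t) (ℕ.+-suc m e) ⟨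
          ⌜ d ⌝ * T m + ⌜ d ⌝ * inv (m ℕ.+ suc e) ∎
          where open ≡-Reasoning

      step : ∀ K → (∀ {k} → k ℕ.< K → Bound k) → Bound K
      step zero    IH = ≤-trans (≤-reflexive (*-zeroʳ ⌜ d ⌝)) (+-nonneg (0≤⌜⌝ C) ≤-refl)
      step (suc k) IH = cases (h? (suc k)) (ℕ.<-≤-connex k d)
        where
        m = suc k ℕ.∸ d
        cases : Dec (h (suc k)) → k ℕ.< d ⊎ d ℕ.≤ k → Bound (suc k)
        cases (no ¬hit) _ = subst (_≤ ⌜ C ⌝ + harmonic (suc k))
          (cong (⌜ d ⌝ *_) (sym (trans (cong (λ x → T k + x * inv (suc k)) (𝟙-no (h? (suc k)) ¬hit))
            (trans (cong (λ x → T k + x) (*-zeroˡ (inv (suc k)))) (+-identityʳ (T k))))))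
          (≤-trans (IH ℕ.≤-refl) (+-monoʳ-≤ ⌜ C ⌝ (∑-extend inv (λ n → 0≤inv n) (ℕ.n≤1+n k))))
        -- A hit at most d has no full window below it, but it is the first one: nothing has been
        -- summed before, and d/(k + 1) is at most C by `first`.
        cases (yes hit) (inj₁ k<d) = step-hit 0 k k<d hit (≤-trans (≤-reflexive
          (trans (cong (_+ ⌜ d ⌝ * inv (suc k)) (*-zeroʳ ⌜ d ⌝)) (+-identityˡ _)))
          (≤-trans (inv-≤ (suc k) d C (first (suc k) hit))
            (≤-by-difference (harmonic (suc k)) (0≤harmonic (suc k)) refl)))
        -- The induction jumps back by d to m, and the harmonic sum over (m, m + d] pays for the new
        -- term d/(m + d). The length d is written `suc (pred d)` to match `step-hit`.
        cases (yes hit) (inj₂ d≤k) = subst Bound m+d≡K (step-hit m (ℕ.pred d)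
          (ℕ.≤-reflexive (ℕ.suc-pred d)) (subst h (sym m+d≡K) hit)
          (≤-trans (+-monoˡ-≤ _ (IH (ℕ.∸-monoʳ-< {suc k} {d} {0} (ℕ.>-nonZero⁻¹ d) (ℕ.m≤n⇒m≤1+n d≤k))))
            (≤-trans (≤-reflexive (+-assoc ⌜ C ⌝ (harmonic m) _)) (+-monoʳ-≤ ⌜ C ⌝
              (≤-trans (≤-reflexive (cong (λ t → harmonic m + ⌜ t ⌝ * inv (m ℕ.+ suc (ℕ.pred d))) (sym (ℕ.suc-pred d))))
                (harmonic-growth m (suc (ℕ.pred d))))))))
          where
          m+d≡K : m ℕ.+ suc (ℕ.pred d) ≡ suc k
          m+d≡K = trans (cong (m ℕ.+_) (ℕ.suc-pred d)) (ℕ.m∸n+n≡m (ℕ.m≤n⇒m≤1+n d≤k))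

    -- A hit k > d is charged to the window (k - d, k], over which 1/j sums to at
    -- least d/k; windows of distinct hits are disjoint, and at most one hit is ≤ d.
    sparse-harmonic : ∀ K → ⌜ d ⌝ * ∑ K (λ k → 𝟙 (h? k) * inv k) ≤ ⌜ C ⌝ + harmonic K
    sparse-harmonic = <-rec Bound step

  -- Absolute values in ℚ

  p≤∣p∣ : ∀ p → p ≤ ∣ p ∣
  p≤∣p∣ p with ∣p∣≡p∨∣p∣≡-p p | ≤-total 0ℚ p
  ... | inj₁ e | _        = ≤-reflexive (sym e)
  ... | inj₂ e | inj₁ 0≤p = ≤-reflexive (sym (0≤p⇒∣p∣≡p 0≤p))
  ... | inj₂ e | inj₂ p≤0 = ≤-trans p≤0 (0≤∣p∣ p)

  -p≤∣p∣ : ∀ p → - p ≤ ∣ p ∣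
  -p≤∣p∣ p = subst (- p ≤_) (∣-p∣≡∣p∣ p) (p≤∣p∣ (- p))

  ∣p∣≤ : ∀ {p r} → p ≤ r → - p ≤ r → ∣ p ∣ ≤ r
  ∣p∣≤ {p} {r} h₁ h₂ with ∣p∣≡p∨∣p∣≡-p p
  ... | inj₁ e = subst (_≤ r) (sym e) h₁
  ... | inj₂ e = subst (_≤ r) (sym e) h₂

  ∣p∣< : ∀ {p r} → p < r → - p < r → ∣ p ∣ < r
  ∣p∣< {p} {r} h₁ h₂ with ∣p∣≡p∨∣p∣≡-p p
  ... | inj₁ e = subst (_< r) (sym e) h₁
  ... | inj₂ e = subst (_< r) (sym e) h₂

  ∣-∣-sym : ∀ p q → ∣ p - q ∣ ≡ ∣ q - p ∣
  ∣-∣-sym p q = trans (sym (∣-p∣≡∣p∣ (p - q))) (cong ∣_∣ (solve 2 (λ p q → :- (p :- q) := q :- p) refl p q))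

  ∣-∣-triangle : ∀ p q r → ∣ p - r ∣ ≤ ∣ p - q ∣ + ∣ q - r ∣
  ∣-∣-triangle p q r = subst (λ t → ∣ t ∣ ≤ ∣ p - q ∣ + ∣ q - r ∣)
    (solve 3 (λ p q r → (p :- q) :+ (q :- r) := p :- r) refl p q r) (∣p+q∣≤∣p∣+∣q∣ (p - q) (q - r))

  p<q+r⇒p-q<r : ∀ {p} q {r} → p < q + r → p - q < r
  p<q+r⇒p-q<r {p} q {r} h = subst (p - q <_) (solve 2 (λ q r → q :+ r :- q := r) refl q r) (+-monoˡ-< (- q) h)

  ∣-∣< : ∀ {p q r} → p < q + r → q < p + r → ∣ p - q ∣ < r
  ∣-∣< {p} {q} {r} h₁ h₂ = ∣p∣< (p<q+r⇒p-q<r q h₁)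
    (subst (_< r) (solve 2 (λ p q → q :- p := :- (p :- q)) refl p q) (p<q+r⇒p-q<r p h₂))

  -- Power series over ℚ: partial sums, Cauchy products, formal derivatives

  Σ< : (ℕ → ℚ) → ℕ → ℚ
  Σ< a zero    = 0ℚ
  Σ< a (suc n) = Σ< a n + a n

  Σ<-shift : ∀ a n → Σ< a (suc n) ≡ a 0 + Σ< (a ∘ suc) n
  Σ<-shift a zero    = +-comm 0ℚ (a 0)
  Σ<-shift a (suc n) = trans (cong (_+ a (suc n)) (Σ<-shift a n)) (+-assoc (a 0) (Σ< (a ∘ suc) n) (a (suc n)))

  Σ<-+-mono : ∀ {a} → (∀ k → 0ℚ ≤ a k) → ∀ m n → Σ< a m ≤ Σ< a (m ℕ.+ n)
  Σ<-+-mono {a} 0≤a m zero    = ≤-reflexive (cong (Σ< a) (sym (ℕ.+-identityʳ m)))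
  Σ<-+-mono {a} 0≤a m (suc n) = ≤-trans (Σ<-+-mono 0≤a m n) (≤-trans
    (≤-by-difference (a (m ℕ.+ n)) (0≤a (m ℕ.+ n)) refl) (≤-reflexive (cong (Σ< a) (sym (ℕ.+-suc m n)))))

  Σ<-mono-length : ∀ {a} → (∀ k → 0ℚ ≤ a k) → ∀ {m n} → m ℕ.≤ n → Σ< a m ≤ Σ< a n
  Σ<-mono-length {a} 0≤a {m} {n} m≤n = subst (λ t → Σ< a m ≤ Σ< a t) (ℕ.m+[n∸m]≡n m≤n) (Σ<-+-mono 0≤a m (n ℕ.∸ m))

  0≤Σ< : ∀ {a} → (∀ k → 0ℚ ≤ a k) → ∀ n → 0ℚ ≤ Σ< a n
  0≤Σ< 0≤a n = Σ<-mono-length 0≤a {0} {n} ℕ.z≤n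

  ∣Σ<-Σ<∣≤ : ∀ {a A} → (∀ k → ∣ a k ∣ ≤ A k) → ∀ m n → ∣ Σ< a (m ℕ.+ n) - Σ< a m ∣ ≤ Σ< A (m ℕ.+ n) - Σ< A m
  ∣Σ<-Σ<∣≤ {a} {A} h m zero    = ≤-reflexive (trans
    (cong ∣_∣ (trans (cong (λ t → Σ< a t - Σ< a m) (ℕ.+-identityʳ m)) (+-inverseʳ (Σ< a m))))
    (sym (trans (cong (λ t → Σ< A t - Σ< A m) (ℕ.+-identityʳ m)) (+-inverseʳ (Σ< A m)))))
  ∣Σ<-Σ<∣≤ {a} {A} h m (suc n) = subst₂ _≤_
    (cong ∣_∣ (trans (rearrange (Σ< a (m ℕ.+ n)) (Σ< a m) (a (m ℕ.+ n))) (cong (λ t → Σ< a t - Σ< a m) (sym (ℕ.+-suc m n)))))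
    (trans (rearrange (Σ< A (m ℕ.+ n)) (Σ< A m) (A (m ℕ.+ n))) (cong (λ t → Σ< A t - Σ< A m) (sym (ℕ.+-suc m n))))
    (≤-trans (∣p+q∣≤∣p∣+∣q∣ (Σ< a (m ℕ.+ n) - Σ< a m) (a (m ℕ.+ n))) (+-mono-≤ (∣Σ<-Σ<∣≤ h m n) (h (m ℕ.+ n))))
    where
    rearrange : ∀ x y z → (x - y) + z ≡ (x + z) - y
    rearrange = solve 3 (λ x y z → (x :- y) :+ z := (x :+ z) :- y) refl

  -- The coefficient of xⁿ in the Cauchy product. Recursion on the head of the first series avoids
  -- the index n - i and lets identities on products go by induction along shifts of `a`.
  conv : (ℕ → ℚ) → (ℕ → ℚ) → ℕ → ℚ
  conv a b zero    = a 0 * b 0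
  conv a b (suc n) = a 0 * b (suc n) + conv (a ∘ suc) b n

  conv-cong : ∀ {a a′ b b′} → (∀ k → a k ≡ a′ k) → (∀ k → b k ≡ b′ k) → ∀ n → conv a b n ≡ conv a′ b′ n
  conv-cong ea eb zero    = cong₂ _*_ (ea 0) (eb 0)
  conv-cong ea eb (suc n) = cong₂ _+_ (cong₂ _*_ (ea 0) (eb (suc n))) (conv-cong (ea ∘ suc) eb n)

  conv-+ : ∀ a a′ b n → conv (λ k → a k + a′ k) b n ≡ conv a b n + conv a′ b n
  conv-+ a a′ b zero    = *-distribʳ-+ (b 0) (a 0) (a′ 0)
  conv-+ a a′ b (suc n) = trans (cong ((a 0 + a′ 0) * b (suc n) +_) (conv-+ (a ∘ suc) (a′ ∘ suc) b n))
    (solve 5 (λ x x′ y z z′ → (x :+ x′) :* y :+ (z :+ z′) := (x :* y :+ z) :+ (x′ :* y :+ z′)) refl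
      (a 0) (a′ 0) (b (suc n)) (conv (a ∘ suc) b n) (conv (a′ ∘ suc) b n))

  conv-*ˡ : ∀ c a b n → conv (λ k → c * a k) b n ≡ c * conv a b n
  conv-*ˡ c a b zero    = *-assoc c (a 0) (b 0)
  conv-*ˡ c a b (suc n) = trans (cong (c * a 0 * b (suc n) +_) (conv-*ˡ c (a ∘ suc) b n))
    (solve 4 (λ c x y z → c :* x :* y :+ c :* z := c :* (x :* y :+ z)) refl c (a 0) (b (suc n)) (conv (a ∘ suc) b n))

  conv-*ʳ : ∀ c a b n → conv a (λ k → c * b k) n ≡ c * conv a b n
  conv-*ʳ c a b zero    = solve 3 (λ c x y → x :* (c :* y) := c :* (x :* y)) refl c (a 0) (b 0)
  conv-*ʳ c a b (suc n) = trans (cong (a 0 * (c * b (suc n)) +_) (conv-*ʳ c (a ∘ suc) b n))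
    (solve 4 (λ c x y z → x :* (c :* y) :+ c :* z := c :* (x :* y :+ z)) refl c (a 0) (b (suc n)) (conv (a ∘ suc) b n))

  -- The derivative of the formal power series ∑ aₖ xᵏ.
  ∂ : (ℕ → ℚ) → ℕ → ℚ
  ∂ a k = ⌜ suc k ⌝ * a (suc k)

  -- The Leibniz rule (ab)′ = a′b + ab′, coefficient by coefficient. In the induction the factor n +
  -- 2 of the shifted product splits as 1 + (n + 1); the 1 supplies what the derivative of the
  -- shifted series lacks, by `∂-shift`.
  ∂-conv : ∀ a b n → ⌜ suc n ⌝ * conv a b (suc n) ≡ conv (∂ a) b n + conv a (∂ b) n
  ∂-conv a b zero    = solve 5 (λ o x y z w → o :* (x :* w :+ z :* y) := o :* z :* y :+ x :* (o :* w)) refl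
    ⌜ 1 ⌝ (a 0) (b 0) (a 1) (b 1)
  ∂-conv a b (suc n) = begin
    c * (a 0 * b₂ + conv a′ b (suc n))
      ≡⟨ *-distribˡ-+ c (a 0 * b₂) (conv a′ b (suc n)) ⟩
    c * (a 0 * b₂) + c * conv a′ b (suc n)
      ≡⟨ cong (λ t → c * (a 0 * b₂) + t * conv a′ b (suc n)) (⌜+⌝ 1 (suc n)) ⟩
    c * (a 0 * b₂) + (1ℚ + ⌜ suc n ⌝) * conv a′ b (suc n)
      ≡⟨ cong (c * (a 0 * b₂) +_) (trans (*-distribʳ-+ (conv a′ b (suc n)) 1ℚ ⌜ suc n ⌝)
           (cong (1ℚ * conv a′ b (suc n) +_) (∂-conv a′ b n))) ⟩
    c * (a 0 * b₂) + (1ℚ * (a 1 * b (suc n) + conv a″ b n) + (conv (∂ a′) b n + conv a′ (∂ b) n))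
      ≡⟨ regroup c (a 0) b₂ (a 1) (b (suc n)) (conv a″ b n) (conv (∂ a′) b n) (conv a′ (∂ b) n) ⟩
    (1ℚ * a 1 * b (suc n) + (conv a″ b n + conv (∂ a′) b n)) + (a 0 * (c * b₂) + conv a′ (∂ b) n)
      ≡⟨ cong (λ t → (1ℚ * a 1 * b (suc n) + t) + (a 0 * (c * b₂) + conv a′ (∂ b) n))
           (trans (sym (conv-+ a″ (∂ a′) b n)) (conv-cong ∂-shift (λ _ → refl) n)) ⟩
    conv (∂ a) b (suc n) + conv a (∂ b) (suc n) ∎
    where
    open ≡-Reasoning
    c = ⌜ suc (suc n) ⌝
    b₂ = b (suc (suc n))
    a′ = a ∘ suc
    a″ = a′ ∘ suc
    regroup : ∀ c x y z w u v t → c * (x * y) + (1ℚ * (z * w + u) + (v + t)) ≡ (1ℚ * z * w + (u + v)) + (x * (c * y) + t)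
    regroup = solve 8 (λ c x y z w u v t → c :* (x :* y) :+ (con 1ℚ :* (z :* w :+ u) :+ (v :+ t))
      := (con 1ℚ :* z :* w :+ (u :+ v)) :+ (x :* (c :* y) :+ t)) refl
    ∂-shift : ∀ k → a″ k + ∂ a′ k ≡ ∂ a (suc k)
    ∂-shift k = trans (solve 2 (λ x n → x :+ n :* x := (con 1ℚ :+ n) :* x) refl (a″ k) ⌜ suc k ⌝)
      (cong (_* a″ k) (sym (⌜+⌝ 1 (suc k))))

  triangle : (ℕ → ℚ) → (ℕ → ℚ) → ℕ → ℚ
  triangle a b = Σ< (conv a b)

  -- Rows instead of diagonals: of the aᵢ bⱼ with i + j ≤ n, the row i = 0 is split off, and the
  -- rows i ≥ 1 form a triangle one smaller.
  triangle-shift : ∀ a b n → triangle a b (suc n) ≡ a 0 * Σ< b (suc n) + triangle (a ∘ suc) b n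
  triangle-shift a b zero    = solve 2 (λ x y → con 0ℚ :+ x :* y := x :* (con 0ℚ :+ y) :+ con 0ℚ) refl (a 0) (b 0)
  triangle-shift a b (suc n) = trans (cong (_+ conv a b (suc n)) (triangle-shift a b n))
    (solve 5 (λ x f t y v → (x :* f :+ t) :+ (x :* y :+ v) := x :* (f :+ y) :+ (t :+ v)) refl
      (a 0) (Σ< b (suc n)) (triangle (a ∘ suc) b n) (b (suc n)) (conv (a ∘ suc) b n))

  -- The sum of aᵢ bⱼ over the part of the box i < n, j < N outside the triangle i + j < n.
  corner : (ℕ → ℚ) → (ℕ → ℚ) → ℕ → ℕ → ℚ
  corner a b n N = Σ< a n * Σ< b N - triangle a b n

  corner-shift : ∀ a b n N → corner a b (suc n) N ≡ a 0 * (Σ< b N - Σ< b (suc n)) + corner (a ∘ suc) b n N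
  corner-shift a b n N = trans (cong₂ (λ s t → s * Σ< b N - t) (Σ<-shift a n) (triangle-shift a b n))
    (solve 5 (λ x f g h t → (x :+ f) :* g :- (x :* h :+ t) := x :* (g :- h) :+ (f :* g :- t)) refl
      (a 0) (Σ< (a ∘ suc) n) (Σ< b N) (Σ< b (suc n)) (triangle (a ∘ suc) b n))

  -- A corner is itself a sum of products aᵢ bⱼ, so majorants of the factors majorise it. The
  -- induction goes by rows; `n ≤ N` makes the part of each row outside the triangle a block of
  -- consecutive terms of b.
  ∣corner∣≤ : ∀ {a A b B} → (∀ k → ∣ a k ∣ ≤ A k) → (∀ k → ∣ b k ∣ ≤ B k) →
             ∀ n {N} → n ℕ.≤ N → ∣ corner a b n N ∣ ≤ corner A B n N
  ∣corner∣≤ {a} {A} {b} {B} ha hb zero    {N} n≤N = ≤-reflexive (trans (cong ∣_∣ (zero-corner (Σ< b N))) (sym (zero-corner (Σ< B N))))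
    where
    zero-corner : ∀ x → 0ℚ * x - 0ℚ ≡ 0ℚ
    zero-corner = solve 1 (λ x → con 0ℚ :* x :- con 0ℚ := con 0ℚ) refl
  ∣corner∣≤ {a} {A} {b} {B} ha hb (suc n) {N} n<N = begin
    ∣ corner a b (suc n) N ∣
      ≡⟨ cong ∣_∣ (corner-shift a b n N) ⟩
    ∣ a 0 * (Σ< b N - Σ< b (suc n)) + corner (a ∘ suc) b n N ∣
      ≤⟨ ∣p+q∣≤∣p∣+∣q∣ (a 0 * (Σ< b N - Σ< b (suc n))) (corner (a ∘ suc) b n N) ⟩
    ∣ a 0 * (Σ< b N - Σ< b (suc n)) ∣ + ∣ corner (a ∘ suc) b n N ∣
      ≤⟨ +-mono-≤ (≤-trans (≤-reflexive (∣p*q∣≡∣p∣*∣q∣ (a 0) (Σ< b N - Σ< b (suc n))))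
           (*-mono (0≤∣p∣ (a 0)) (≤-trans (0≤∣p∣ (Σ< b N - Σ< b (suc n))) tail) (ha 0) tail))
           (∣corner∣≤ (ha ∘ suc) hb n (ℕ.<⇒≤ n<N)) ⟩
    A 0 * (Σ< B N - Σ< B (suc n)) + corner (A ∘ suc) B n N
      ≡⟨ corner-shift A B n N ⟨
    corner A B (suc n) N ∎
    where
    open ≤-Reasoning
    tail : ∣ Σ< b N - Σ< b (suc n) ∣ ≤ Σ< B N - Σ< B (suc n)
    tail = subst (λ t → ∣ Σ< b t - Σ< b (suc n) ∣ ≤ Σ< B t - Σ< B (suc n)) (ℕ.m+[n∸m]≡n n<N) (∣Σ<-Σ<∣≤ hb (suc n) (N ℕ.∸ suc n))

  -- i < m and j < n force i + j < m + n, so the box lies inside the triangle, and the remaining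
  -- terms are nonnegative.
  box≤triangle : ∀ {A B} → (∀ k → 0ℚ ≤ A k) → (∀ k → 0ℚ ≤ B k) → ∀ m n → Σ< A m * Σ< B n ≤ triangle A B (m ℕ.+ n)
  box≤triangle {A} {B} 0≤A 0≤B zero    n = ≤-trans (≤-reflexive (*-zeroˡ (Σ< B n))) (0≤Σ< (0≤conv A 0≤A) n)
    where
    0≤conv : ∀ A → (∀ k → 0ℚ ≤ A k) → ∀ k → 0ℚ ≤ conv A B k
    0≤conv A 0≤A zero    = *-nonneg (0≤A 0) (0≤B 0)
    0≤conv A 0≤A (suc k) = +-nonneg (*-nonneg (0≤A 0) (0≤B (suc k))) (0≤conv (A ∘ suc) (0≤A ∘ suc) k)
  box≤triangle {A} {B} 0≤A 0≤B (suc m) n = begin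
    Σ< A (suc m) * Σ< B n
      ≡⟨ trans (cong (_* Σ< B n) (Σ<-shift A m)) (*-distribʳ-+ (Σ< B n) (A 0) (Σ< (A ∘ suc) m)) ⟩
    A 0 * Σ< B n + Σ< (A ∘ suc) m * Σ< B n
      ≤⟨ +-mono-≤ (*-monoʳ (A 0) (0≤A 0) (Σ<-mono-length 0≤B (ℕ.m≤n+m n (suc m)))) (box≤triangle (0≤A ∘ suc) 0≤B m n) ⟩
    A 0 * Σ< B (suc m ℕ.+ n) + triangle (A ∘ suc) B (m ℕ.+ n)
      ≡⟨ triangle-shift A B (m ℕ.+ n) ⟨
    triangle A B (suc m ℕ.+ n) ∎
    where open ≤-Reasoning

  -- Truncated exponential series

  pow : ℚ → ℕ → ℚ
  pow q zero    = 1ℚ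
  pow q (suc k) = q * pow q k

  term : ℚ → ℕ → ℚ
  term q k = pow q k * inv (k !)

  expΣ : ℕ → ℚ → ℚ
  expΣ n q = Σ< (term q) n

  -- The left side is `∂ (term q) k`, so this is the differential equation of e^(qx) for
  -- coefficients; it also gives the ratio q/(k + 1) of consecutive terms.
  term-suc : ∀ q k → ⌜ suc k ⌝ * term q (suc k) ≡ q * term q k
  term-suc q k = begin
    ⌜ suc k ⌝ * (q * pow q k * inv (suc k ℕ.* k !))
      ≡⟨ cong (λ t → ⌜ suc k ⌝ * (q * pow q k * t)) (inv-*-homo (suc k) (k !) {{_}} {{k ℕ.!≢0}}) ⟩
    ⌜ suc k ⌝ * (q * pow q k * (inv (suc k) * inv (k !)))
      ≡⟨ solve 5 (λ n q p i j → n :* (q :* p :* (i :* j)) := (i :* n) :* (q :* (p :* j))) refl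
           ⌜ suc k ⌝ q (pow q k) (inv (suc k)) (inv (k !)) ⟩
    inv (suc k) * ⌜ suc k ⌝ * (q * term q k)
      ≡⟨ trans (cong (_* (q * term q k)) (inv-* (suc k))) (*-identityˡ (q * term q k)) ⟩
    q * term q k ∎
    where open ≡-Reasoning

  0≤pow : ∀ {q} → 0ℚ ≤ q → ∀ k → 0ℚ ≤ pow q k
  0≤pow 0≤q zero    = 0≤⌜⌝ 1
  0≤pow 0≤q (suc k) = *-nonneg 0≤q (0≤pow 0≤q k)

  0≤term : ∀ {q} → 0ℚ ≤ q → ∀ k → 0ℚ ≤ term q k
  0≤term 0≤q k = *-nonneg (0≤pow 0≤q k) (0≤inv (k !))

  ∣pow∣≤ : ∀ {q B} → ∣ q ∣ ≤ B → ∀ k → ∣ pow q k ∣ ≤ pow B k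
  ∣pow∣≤ h zero    = ≤-refl
  ∣pow∣≤ {q} {B} h (suc k) = ≤-trans (≤-reflexive (∣p*q∣≡∣p∣*∣q∣ q (pow q k)))
    (*-mono (0≤∣p∣ q) (0≤pow (≤-trans (0≤∣p∣ q) h) k) h (∣pow∣≤ h k))

  ∣term∣≤ : ∀ {q B} → ∣ q ∣ ≤ B → ∀ k → ∣ term q k ∣ ≤ term B k
  ∣term∣≤ {q} {B} h k = ≤-trans (≤-reflexive (trans (∣p*q∣≡∣p∣*∣q∣ (pow q k) (inv (k !)))
      (cong (∣ pow q k ∣ *_) (0≤p⇒∣p∣≡p (0≤inv (k !))))))
    (*-monoˡ (inv (k !)) (0≤inv (k !)) (∣pow∣≤ h k))

  term-mono : ∀ {q r} → 0ℚ ≤ q → q ≤ r → ∀ k → term q k ≤ term r k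
  term-mono 0≤q q≤r k = ≤-trans (p≤∣p∣ _) (∣term∣≤ (≤-trans (≤-reflexive (0≤p⇒∣p∣≡p 0≤q)) q≤r) k)

  -- The linear terms alone differ by r - q, hence the length of at least 2; the higher terms are
  -- monotone on nonnegative arguments.
  expΣ-growth : ∀ {q r} → 0ℚ ≤ q → q ≤ r → ∀ n → expΣ (2 ℕ.+ n) q + (r - q) ≤ expΣ (2 ℕ.+ n) r
  expΣ-growth {q} {r} 0≤q q≤r zero    = ≤-reflexive (solve 2 (λ q r →
    (con 0ℚ :+ con 1ℚ :* con 1ℚ :+ q :* con 1ℚ :* con 1ℚ) :+ (r :- q) :=
    con 0ℚ :+ con 1ℚ :* con 1ℚ :+ r :* con 1ℚ :* con 1ℚ) refl q r)
  expΣ-growth {q} {r} 0≤q q≤r (suc n) = ≤-trans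
    (≤-reflexive (solve 3 (λ x t d → (x :+ t) :+ d := (x :+ d) :+ t) refl (expΣ (2 ℕ.+ n) q) (term q (2 ℕ.+ n)) (r - q)))
    (+-mono-≤ (expΣ-growth 0≤q q≤r n) (term-mono 0≤q q≤r (2 ℕ.+ n)))

  1≤expΣ : ∀ {q} → 0ℚ ≤ q → ∀ n → 1ℚ ≤ expΣ (suc n) q
  1≤expΣ 0≤q n = Σ<-mono-length (0≤term 0≤q) {1} {suc n} (ℕ.s≤s ℕ.z≤n)

  1+q≤expΣ : ∀ {q} → 0ℚ ≤ q → ∀ n → 1ℚ + q ≤ expΣ (2 ℕ.+ n) q
  1+q≤expΣ {q} 0≤q n = ≤-trans (+-mono-≤ (1≤expΣ {0ℚ} ≤-refl (suc n)) (≤-reflexive (sym (+-identityʳ q)))) (expΣ-growth ≤-refl 0≤q n)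

  module Bounded (B : ℕ) where

    private
      b : ℚ
      b = ⌜ B ⌝

      0≤b : 0ℚ ≤ b
      0≤b = 0≤⌜⌝ B

      0≤t : ∀ k → 0ℚ ≤ term b k
      0≤t = 0≤term 0≤b

    -- Twice the first omitted term: once n ≥ 2B the terms at b at least halve at each step, so this
    -- dominates everything omitted.
    τ : ℕ → ℚ
    τ n = term b n + term b n

    term-halves : ∀ n → B ℕ.+ B ℕ.≤ suc n → τ (suc n) ≤ term b n
    term-halves n 2B≤n+1 = *-cancel-≤ ⌜ suc n ⌝ (0<⌜⌝ (suc n)) (begin
      τ (suc n) * ⌜ suc n ⌝
        ≡⟨ solve 2 (λ t c → (t :+ t) :* c := c :* t :+ c :* t) refl (term b (suc n)) ⌜ suc n ⌝ ⟩
      ⌜ suc n ⌝ * term b (suc n) + ⌜ suc n ⌝ * term b (suc n)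
        ≡⟨ cong₂ _+_ (term-suc b n) (term-suc b n) ⟩
      b * term b n + b * term b n
        ≡⟨ *-distribʳ-+ (term b n) b b ⟨
      (b + b) * term b n
        ≡⟨ cong (_* term b n) (⌜+⌝ B B) ⟨
      ⌜ B ℕ.+ B ⌝ * term b n
        ≤⟨ *-monoˡ (term b n) (0≤t n) (⌜⌝-mono 2B≤n+1) ⟩
      ⌜ suc n ⌝ * term b n
        ≡⟨ *-comm ⌜ suc n ⌝ (term b n) ⟩
      term b n * ⌜ suc n ⌝ ∎)
      where open ≤-Reasoning

    -- By `term-halves` a partial sum plus its error bound never increases, which replaces the
    -- summation of a geometric series.
    expΣ-tail : ∀ n m → B ℕ.+ B ℕ.≤ n → expΣ (n ℕ.+ m) b + τ (n ℕ.+ m) ≤ expΣ n b + τ n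
    expΣ-tail n zero    2B≤n = ≤-reflexive (cong (λ t → expΣ t b + τ t) (ℕ.+-identityʳ n))
    expΣ-tail n (suc m) 2B≤n = ≤-trans (≤-reflexive (cong (λ t → expΣ t b + τ t) (ℕ.+-suc n m)))
      (≤-trans (≤-trans (+-monoʳ-≤ (expΣ (suc k) b) (term-halves k (ℕ.≤-trans 2B≤n (ℕ.≤-trans (ℕ.m≤m+n n m) (ℕ.n≤1+n k)))))
        (≤-reflexive (+-assoc (expΣ k b) (term b k) (term b k)))) (expΣ-tail n m 2B≤n))
      where k = n ℕ.+ m

    0≤τ : ∀ n → 0ℚ ≤ τ n
    0≤τ n = +-nonneg (0≤t n) (0≤t n)

    expΣ-Cauchy-b : ∀ n m → B ℕ.+ B ℕ.≤ n → expΣ (n ℕ.+ m) b ≤ expΣ n b + τ n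
    expΣ-Cauchy-b n m 2B≤n = ≤-trans (≤-by-difference (τ (n ℕ.+ m)) (0≤τ (n ℕ.+ m)) refl) (expΣ-tail n m 2B≤n)

    expΣ-Cauchy : ∀ {q} → ∣ q ∣ ≤ b → ∀ {n m} → B ℕ.+ B ℕ.≤ n → n ℕ.≤ m → ∣ expΣ m q - expΣ n q ∣ ≤ τ n
    expΣ-Cauchy {q} h {n} {m} 2B≤n n≤m = subst (λ t → ∣ expΣ t q - expΣ n q ∣ ≤ τ n) (ℕ.m+[n∸m]≡n n≤m)
      (≤-trans (∣Σ<-Σ<∣≤ (∣term∣≤ h) n (m ℕ.∸ n)) (≤-trans
        (+-monoˡ-≤ (- expΣ n b) (expΣ-Cauchy-b n (m ℕ.∸ n) 2B≤n))
        (≤-reflexive (solve 2 (λ x t → x :+ t :- x := t) refl (expΣ n b) (τ n)))))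

    private
      n₀ : ℕ
      n₀ = B ℕ.+ B

    L : ℚ
    L = expΣ n₀ b + τ n₀

    0≤L : 0ℚ ≤ L
    0≤L = +-nonneg (0≤Σ< 0≤t n₀) (0≤τ n₀)

    expΣ≤L : ∀ n → expΣ n b ≤ L
    expΣ≤L n = ≤-trans (Σ<-mono-length 0≤t (ℕ.m≤n+m n n₀)) (expΣ-Cauchy-b n₀ n ℕ.≤-refl)

    ∣expΣ∣≤L : ∀ {q} → ∣ q ∣ ≤ b → ∀ n → ∣ expΣ n q ∣ ≤ L
    ∣expΣ∣≤L {q} h n = ≤-trans (≤-trans (≤-reflexive (cong ∣_∣ (sym (+-identityʳ (expΣ n q)))))
      (≤-trans (∣Σ<-Σ<∣≤ (∣term∣≤ h) 0 n) (≤-reflexive (+-identityʳ (expΣ n b))))) (expΣ≤L n)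

    private
      term≤term : ∀ m → term b (n₀ ℕ.+ m) ≤ term b n₀
      term≤term zero    = ≤-reflexive (cong (term b) (ℕ.+-identityʳ n₀))
      term≤term (suc m) = ≤-trans (≤-trans (≤-reflexive (cong (term b) (ℕ.+-suc n₀ m)))
        (≤-trans (≤-by-difference _ (0≤t (suc (n₀ ℕ.+ m))) refl)
          (term-halves (n₀ ℕ.+ m) (ℕ.≤-trans (ℕ.m≤m+n n₀ m) (ℕ.n≤1+n _))))) (term≤term m)

      -- From n₀ on the terms are at most the one at n₀, and one more application of the ratio b/(n
      -- + 1) turns this into decay of order 1/n.
      τ≤ : ∀ n → n₀ ℕ.≤ n → τ (suc n) ≤ (b * term b n₀ + b * term b n₀) * inv (suc n)
      τ≤ n n₀≤n = begin
        τ (suc n)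
          ≡⟨ cong₂ _+_ divided divided ⟩
        b * term b n * inv (suc n) + b * term b n * inv (suc n)
          ≡⟨ *-distribʳ-+ (inv (suc n)) (b * term b n) (b * term b n) ⟨
        (b * term b n + b * term b n) * inv (suc n)
          ≤⟨ *-monoˡ (inv (suc n)) (0≤inv (suc n)) (+-mono-≤ bound bound) ⟩
        (b * term b n₀ + b * term b n₀) * inv (suc n) ∎
        where
        open ≤-Reasoning
        bound : b * term b n ≤ b * term b n₀
        bound = *-monoʳ b 0≤b (subst (λ t → term b t ≤ term b n₀) (ℕ.m+[n∸m]≡n n₀≤n) (term≤term (n ℕ.∸ n₀)))
        divided : term b (suc n) ≡ b * term b n * inv (suc n)
        divided = trans (trans (sym (*-identityˡ _)) (cong (_* term b (suc n)) (sym (inv-* (suc n)))))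
          (trans (solve 3 (λ i c t → i :* c :* t := c :* t :* i) refl (inv (suc n)) ⌜ suc n ⌝ (term b (suc n)))
            (cong (_* inv (suc n)) (term-suc b n)))

    τ→0 : ∀ {ε} → 0ℚ < ε → ∃ λ N → n₀ ℕ.≤ N × ∀ n → N ℕ.≤ n → τ n < ε
    τ→0 {ε} 0<ε with eventually-inv (b * term b n₀ + b * term b n₀) 0<ε
    ... | N , small = suc (n₀ ℕ.+ N) , ℕ.≤-trans (ℕ.m≤m+n n₀ N) (ℕ.n≤1+n _) , bound
      where
      bound : ∀ n → suc (n₀ ℕ.+ N) ℕ.≤ n → τ n < ε
      bound (suc n) (ℕ.s≤s le) = ≤-<-trans (τ≤ n (ℕ.≤-trans (ℕ.m≤m+n n₀ N) le))
        (small (suc n) (ℕ.≤-trans (ℕ.≤-trans (ℕ.m≤n+m N n₀) le) (ℕ.n≤1+n n)))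

    module _ {q r : ℚ} (∣q∣≤b : ∣ q ∣ ≤ b) (∣r∣≤b : ∣ r ∣ ≤ b) where

      private
        δ : ℚ
        δ = ∣ q - r ∣

        ∣*∣≤ : ∀ {x y X Y} → ∣ x ∣ ≤ X → ∣ y ∣ ≤ Y → ∣ x * y ∣ ≤ X * Y
        ∣*∣≤ {x} {y} hx hy = ≤-trans (≤-reflexive (∣p*q∣≡∣p∣*∣q∣ x y)) (*-mono (0≤∣p∣ x) (≤-trans (0≤∣p∣ y) hy) hx hy)

      pow-Lipschitz : ∀ k → ∣ pow q (suc k) - pow r (suc k) ∣ ≤ ⌜ suc k ⌝ * pow b k * δ
      pow-Lipschitz zero    = ≤-reflexive (trans
        (cong ∣_∣ (cong₂ (λ s t → s - t) (*-identityʳ q) (*-identityʳ r))) (sym (*-identityˡ δ)))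
      pow-Lipschitz (suc k) = begin
        ∣ pow q (2 ℕ.+ k) - pow r (2 ℕ.+ k) ∣
          ≡⟨ cong ∣_∣ (solve 4 (λ q r s t → q :* s :- r :* t := q :* (s :- t) :+ (q :- r) :* t) refl q r (pow q (suc k)) (pow r (suc k))) ⟩
        ∣ q * (pow q (suc k) - pow r (suc k)) + (q - r) * pow r (suc k) ∣
          ≤⟨ ∣p+q∣≤∣p∣+∣q∣ (q * (pow q (suc k) - pow r (suc k))) ((q - r) * pow r (suc k)) ⟩
        ∣ q * (pow q (suc k) - pow r (suc k)) ∣ + ∣ (q - r) * pow r (suc k) ∣
          ≤⟨ +-mono-≤ (∣*∣≤ ∣q∣≤b (pow-Lipschitz k)) (∣*∣≤ {q - r} ≤-refl (∣pow∣≤ ∣r∣≤b (suc k))) ⟩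
        b * (⌜ suc k ⌝ * pow b k * δ) + δ * pow b (suc k)
          ≡⟨ solve 4 (λ b n p d → b :* (n :* p :* d) :+ d :* (b :* p) := (con 1ℚ :+ n) :* (b :* p) :* d) refl b ⌜ suc k ⌝ (pow b k) δ ⟩
        (1ℚ + ⌜ suc k ⌝) * pow b (suc k) * δ
          ≡⟨ cong (λ t → t * pow b (suc k) * δ) (⌜+⌝ 1 (suc k)) ⟨
        ⌜ 2 ℕ.+ k ⌝ * pow b (suc k) * δ ∎
        where open ≤-Reasoning

      -- Division by (k + 1)! turns the derivative bound (k + 1) b^k into the k-th term at b, so the
      -- Lipschitz constants add up to a partial sum of e^b, at most `L`.
      term-Lipschitz : ∀ k → ∣ term q (suc k) - term r (suc k) ∣ ≤ term b k * δ
      term-Lipschitz k = begin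
        ∣ pow q (suc k) * i! - pow r (suc k) * i! ∣
          ≡⟨ cong ∣_∣ (solve 3 (λ x y i → x :* i :- y :* i := (x :- y) :* i) refl (pow q (suc k)) (pow r (suc k)) i!) ⟩
        ∣ (pow q (suc k) - pow r (suc k)) * i! ∣
          ≤⟨ ∣*∣≤ (pow-Lipschitz k) (≤-reflexive (0≤p⇒∣p∣≡p (0≤inv (suc k !)))) ⟩
        ⌜ suc k ⌝ * pow b k * δ * i!
          ≡⟨ cong (⌜ suc k ⌝ * pow b k * δ *_) (inv-*-homo (suc k) (k !) {{_}} {{k ℕ.!≢0}}) ⟩
        ⌜ suc k ⌝ * pow b k * δ * (inv (suc k) * inv (k !))
          ≡⟨ solve 5 (λ n p d i j → n :* p :* d :* (i :* j) := (i :* n) :* (p :* j :* d)) refl ⌜ suc k ⌝ (pow b k) δ (inv (suc k)) (inv (k !)) ⟩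
        inv (suc k) * ⌜ suc k ⌝ * (term b k * δ)
          ≡⟨ trans (cong (_* (term b k * δ)) (inv-* (suc k))) (*-identityˡ (term b k * δ)) ⟩
        term b k * δ ∎
        where
        open ≤-Reasoning
        i! = inv (suc k !)

      expΣ-Lipschitz-suc : ∀ n → ∣ expΣ (suc n) q - expΣ (suc n) r ∣ ≤ expΣ n b * δ
      expΣ-Lipschitz-suc zero    = ≤-reflexive (sym (*-zeroˡ δ))
      expΣ-Lipschitz-suc (suc n) = begin
        ∣ expΣ (suc n) q + term q (suc n) - (expΣ (suc n) r + term r (suc n)) ∣
          ≡⟨ cong ∣_∣ (solve 4 (λ x s y t → x :+ s :- (y :+ t) := (x :- y) :+ (s :- t)) refl (expΣ (suc n) q) (term q (suc n)) (expΣ (suc n) r) (term r (suc n))) ⟩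
        ∣ (expΣ (suc n) q - expΣ (suc n) r) + (term q (suc n) - term r (suc n)) ∣
          ≤⟨ ∣p+q∣≤∣p∣+∣q∣ (expΣ (suc n) q - expΣ (suc n) r) (term q (suc n) - term r (suc n)) ⟩
        ∣ expΣ (suc n) q - expΣ (suc n) r ∣ + ∣ term q (suc n) - term r (suc n) ∣
          ≤⟨ +-mono-≤ (expΣ-Lipschitz-suc n) (term-Lipschitz n) ⟩
        expΣ n b * δ + term b n * δ
          ≡⟨ *-distribʳ-+ δ (expΣ n b) (term b n) ⟨
        expΣ (suc n) b * δ ∎
        where open ≤-Reasoning

      expΣ-Lipschitz : ∀ n → ∣ expΣ n q - expΣ n r ∣ ≤ L * δ
      expΣ-Lipschitz zero    = *-nonneg 0≤L (0≤∣p∣ (q - r))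
      expΣ-Lipschitz (suc n) = ≤-trans (expΣ-Lipschitz-suc n) (*-monoˡ δ (0≤∣p∣ (q - r)) (expΣ≤L n))

  -- The derivative of eᵗ e⁻ᵗ vanishes, so all its coefficients but the first do.
  conv-opposite : ∀ q n → conv (term q) (term (- q)) (suc n) ≡ 0ℚ
  conv-opposite q n = *-cancel-≡ ⌜ suc n ⌝ (0<⌜⌝ (suc n)) (begin
    conv a b (suc n) * ⌜ suc n ⌝                  ≡⟨ *-comm (conv a b (suc n)) ⌜ suc n ⌝ ⟩
    ⌜ suc n ⌝ * conv a b (suc n)                  ≡⟨ ∂-conv a b n ⟩
    conv (∂ a) b n + conv a (∂ b) n               ≡⟨ cong₂ _+_ (conv-cong {b = b} (term-suc q) (λ _ → refl) n) (conv-cong {a} (λ _ → refl) (term-suc (- q)) n) ⟩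
    conv (λ k → q * a k) b n + conv a (λ k → - q * b k) n
                                                  ≡⟨ cong₂ _+_ (conv-*ˡ q a b n) (conv-*ʳ (- q) a b n) ⟩
    q * conv a b n + - q * conv a b n             ≡⟨ solve 3 (λ q c n → q :* c :+ (:- q) :* c := con 0ℚ :* n) refl q (conv a b n) ⌜ suc n ⌝ ⟩
    0ℚ * ⌜ suc n ⌝                                ∎)
    where
    open ≡-Reasoning
    a = term q
    b = term (- q)

  triangle-opposite : ∀ q n → triangle (term q) (term (- q)) (suc n) ≡ 1ℚ
  triangle-opposite q zero    = refl
  triangle-opposite q (suc n) = cong₂ _+_ (triangle-opposite q n) (conv-opposite q n)

  module _ (B : ℕ) where
    open Bounded B

    -- In the limit e^q e^(-q) = 1 and e^(-q) ≥ 1 give e^q ≤ 1; truncation leaves an error. The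
    -- product of the truncations minus 1 is a corner, majorised by the corner of e^t e^t with t =
    -- -q. The length n = 2h lets the box of side h fit into the triangle, so this corner is at most
    -- y² - x², small because x and y are close.
    expΣ-neg : ∀ {q} → q ≤ 0ℚ → ∣ q ∣ ≤ ⌜ B ⌝ → ∀ h .{{_ : NonZero h}} → B ℕ.+ B ℕ.≤ h →
            expΣ (h ℕ.+ h) q ≤ 1ℚ + τ h * (L + L)
    expΣ-neg {q} q≤0 ∣q∣≤b h@(suc h-1) 2B≤h = by-sign (≤-total 0ℚ (expΣ n q))
        (subst (_≤ 1ℚ + τ h * (L + L)) (solve 1 (λ x → con 1ℚ :+ (x :- con 1ℚ) := x) refl (expΣ n q * expΣ n t)) (+-monoʳ-≤ 1ℚ product))
      where
      n = h ℕ.+ h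
      t = - q
      0≤t : 0ℚ ≤ t
      0≤t = neg-antimono-≤ q≤0
      ∣t∣≤b : ∣ t ∣ ≤ ⌜ B ⌝
      ∣t∣≤b = ≤-trans (≤-reflexive (∣-p∣≡∣p∣ q)) ∣q∣≤b
      ∣q∣≤t : ∣ q ∣ ≤ t
      ∣q∣≤t = ≤-reflexive (trans (sym (∣-p∣≡∣p∣ q)) (0≤p⇒∣p∣≡p 0≤t))
      x = expΣ h t
      y = expΣ n t
      y≤L : ∀ n → expΣ n t ≤ L
      y≤L n = ≤-trans (p≤∣p∣ _) (∣expΣ∣≤L ∣t∣≤b n)
      product : expΣ n q * expΣ n t - 1ℚ ≤ τ h * (L + L)
      product = begin
        expΣ n q * expΣ n t - 1ℚ
          ≡⟨ cong (λ s → expΣ n q * expΣ n t - s) (triangle-opposite q (h-1 ℕ.+ h)) ⟨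
        corner (term q) (term t) n n
          ≤⟨ p≤∣p∣ _ ⟩
        ∣ corner (term q) (term t) n n ∣
          ≤⟨ ∣corner∣≤ (∣term∣≤ ∣q∣≤t) (∣term∣≤ (≤-reflexive (0≤p⇒∣p∣≡p 0≤t))) n ℕ.≤-refl ⟩
        y * y - triangle (term t) (term t) n
          ≤⟨ +-monoʳ-≤ (y * y) (neg-antimono-≤ (box≤triangle (0≤term 0≤t) (0≤term 0≤t) h h)) ⟩
        y * y - x * x
          ≡⟨ solve 2 (λ x y → y :* y :- x :* x := (y :- x) :* (y :+ x)) refl x y ⟩
        (y - x) * (y + x)
          ≤⟨ *-mono (p≤q⇒0≤q-p (Σ<-+-mono (0≤term 0≤t) h h)) (+-nonneg 0≤L 0≤L)
               (≤-trans (p≤∣p∣ (y - x)) (expΣ-Cauchy ∣t∣≤b 2B≤h (ℕ.m≤m+n h h))) (+-mono-≤ (y≤L n) (y≤L h)) ⟩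
        τ h * (L + L) ∎
        where open ≤-Reasoning
      1≤y : 1ℚ ≤ y
      1≤y = 1≤expΣ 0≤t (h-1 ℕ.+ h)
      by-sign : 0ℚ ≤ expΣ n q ⊎ expΣ n q ≤ 0ℚ → expΣ n q * expΣ n t ≤ 1ℚ + τ h * (L + L) → expΣ n q ≤ 1ℚ + τ h * (L + L)
      by-sign (inj₁ 0≤e) = ≤-trans (≤-trans (≤-reflexive (sym (*-identityʳ (expΣ n q)))) (*-monoʳ (expΣ n q) 0≤e 1≤y))
      by-sign (inj₂ e≤0) _ = ≤-trans e≤0 (+-nonneg (0≤⌜⌝ 1) (*-nonneg (0≤τ h) (+-nonneg 0≤L 0≤L)))

  -- Continuity, injectivity and growth of the truncations

  shrink : ∀ D {ε} → 0ℚ ≤ D → 0ℚ < ε → ∃ λ η → 0ℚ < η × η * D ≤ ε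
  shrink D {ε} 0≤D 0<ε with archimedean D
  -- ε is divided by an integer n > D rather than by D, as D may be 0.
  ... | n , D<n = ε * inv n , *-pos 0<ε (0<inv n) , ≤-trans
        (*-monoʳ (ε * inv n) (*-nonneg (<⇒≤ 0<ε) (0≤inv n)) (<⇒≤ D<n))
        (≤-reflexive (trans (*-assoc ε (inv n) ⌜ n ⌝) (trans (cong (ε *_) (inv-* n)) (*-identityʳ ε))))
    where
    instance _ = ℕ.>-nonZero (⌜⌝-cancel-< {0} (≤-<-trans 0≤D D<n))

  half+half : ∀ p → p * ½ + p * ½ ≡ p
  half+half p = trans (sym (*-distribˡ-+ p ½ ½)) (*-identityʳ p)

  half-pos : ∀ {p} → 0ℚ < p → 0ℚ < p * ½
  half-pos 0<p = *-pos 0<p (positive⁻¹ ½)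

  half-≤ : ∀ {p} → 0ℚ < p → p * ½ ≤ p
  half-≤ {p} 0<p = ≤-by-difference (p * ½) (<⇒≤ (half-pos 0<p)) (sym (half+half p))

  -- Truncation error plus Lipschitz bound. Length and argument both vary because the terms of `Exp`
  -- are truncations of growing length at changing approximations.
  expΣ-continuous : ∀ B {ε} → 0ℚ < ε → ∃ λ N → ∃ λ η → 0ℚ < η × (∀ {m n q r} → N ℕ.≤ m → N ℕ.≤ n →
                 ∣ q ∣ ≤ ⌜ B ⌝ → ∣ r ∣ ≤ ⌜ B ⌝ → ∣ q - r ∣ < η → ∣ expΣ m q - expΣ n r ∣ < ε)
  expΣ-continuous B {ε} 0<ε = N , η , proj₁ (proj₂ scaled) , close
    where
    open Bounded B
    scaled = shrink L 0≤L (half-pos 0<ε)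
    η = proj₁ scaled
    tail = τ→0 (half-pos 0<ε)
    N = proj₁ tail
    2B≤ : ∀ {n} → N ℕ.≤ n → B ℕ.+ B ℕ.≤ n
    2B≤ = ℕ.≤-trans (proj₁ (proj₂ tail))
    truncation : ∀ {m n q} → N ℕ.≤ m → N ℕ.≤ n → ∣ q ∣ ≤ ⌜ B ⌝ → ∣ expΣ m q - expΣ n q ∣ < ε * ½
    truncation {m} {n} {q} N≤m N≤n h with ℕ.≤-total n m
    ... | inj₁ n≤m = ≤-<-trans (expΣ-Cauchy h (2B≤ N≤n) n≤m) (proj₂ (proj₂ tail) n N≤n)
    ... | inj₂ m≤n = ≤-<-trans (≤-trans (≤-reflexive (∣-∣-sym (expΣ m q) (expΣ n q))) (expΣ-Cauchy h (2B≤ N≤m) m≤n))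
                       (proj₂ (proj₂ tail) m N≤m)
    close : ∀ {m n q r} → N ℕ.≤ m → N ℕ.≤ n →
            ∣ q ∣ ≤ ⌜ B ⌝ → ∣ r ∣ ≤ ⌜ B ⌝ → ∣ q - r ∣ < η → ∣ expΣ m q - expΣ n r ∣ < ε
    close {m} {n} {q} {r} N≤m N≤n hq hr h = ≤-<-trans (∣-∣-triangle (expΣ m q) (expΣ n q) (expΣ n r))
      (subst (∣ expΣ m q - expΣ n q ∣ + ∣ expΣ n q - expΣ n r ∣ <_) (half+half ε)
        (+-mono-<-≤ (truncation N≤m N≤n hq) (≤-trans (expΣ-Lipschitz hq hr n)
          (≤-trans (*-monoʳ L 0≤L (<⇒≤ h)) (≤-trans (≤-reflexive (*-comm L η)) (proj₂ (proj₂ scaled)))))))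

  expΣ-gap : ∀ {q r} → 0ℚ ≤ q → q ≤ r → ∀ {n} → 2 ℕ.≤ n → r - q ≤ ∣ expΣ n q - expΣ n r ∣
  expΣ-gap {q} {r} 0≤q q≤r {suc (suc n)} (ℕ.s≤s (ℕ.s≤s ℕ.z≤n)) = ≤-trans
    (subst₂ _≤_ (solve 2 (λ x d → x :+ d :- x := d) refl (expΣ (2 ℕ.+ n) q) (r - q))
      (solve 2 (λ x y → y :- x := :- (x :- y)) refl (expΣ (2 ℕ.+ n) q) (expΣ (2 ℕ.+ n) r))
      (+-monoˡ-≤ (- expΣ (2 ℕ.+ n) q) (expΣ-growth 0≤q q≤r n)))
    (-p≤∣p∣ (expΣ (2 ℕ.+ n) q - expΣ (2 ℕ.+ n) r))

  -- On nonnegative arguments the truncations grow at least as fast as the argument. For q ≤ 0 they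
  -- stay below 1 + δ/2 by `expΣ-neg`, while at m they reach 1 + m ≥ 1 + δ: hence the condition δ ≤
  -- m and the threshold δ/2. The even lengths are inherited from `expΣ-neg`.
  expΣ-injective : ∀ B m {δ} → 0ℚ < δ → δ ≤ m → ∃ λ N → ∀ h → N ℕ.≤ h → ∀ q → ∣ q ∣ ≤ ⌜ B ⌝ →
                ∣ expΣ (h ℕ.+ h) q - expΣ (h ℕ.+ h) m ∣ < δ * ½ → ∣ q - m ∣ < δ
  -- The successor keeps h positive, as `expΣ-neg` asks.
  expΣ-injective B m {δ} 0<δ δ≤m = suc N , separated
    where
    open Bounded B
    0≤m = ≤-trans (<⇒≤ 0<δ) δ≤m
    shrunk = shrink (L + L) (+-nonneg 0≤L 0≤L) (half-pos 0<δ)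
    η = proj₁ shrunk
    tail = τ→0 (proj₁ (proj₂ shrunk))
    N = proj₁ tail
    separated : ∀ h → suc N ℕ.≤ h → ∀ q → ∣ q ∣ ≤ ⌜ B ⌝ →
                ∣ expΣ (h ℕ.+ h) q - expΣ (h ℕ.+ h) m ∣ < δ * ½ → ∣ q - m ∣ < δ
    separated h@(suc h-1) N<h q ∣q∣≤b close = ∣-∣< (≰⇒> λ above → absurd (too-large above)) (≰⇒> λ below → absurd (too-small below (≤-total 0ℚ q)))
      where
      n = h ℕ.+ h
      2≤n : 2 ℕ.≤ n
      2≤n = ℕ.s≤s (subst (1 ℕ.≤_) (sym (ℕ.+-suc h-1 h-1)) (ℕ.s≤s ℕ.z≤n))
      absurd : ∀ {A : Set} → δ * ½ ≤ ∣ expΣ n q - expΣ n m ∣ → A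
      absurd le = contradiction (<-≤-trans close le) (<-irrefl refl)
      too-large : m + δ ≤ q → δ * ½ ≤ ∣ expΣ n q - expΣ n m ∣
      too-large m+δ≤q = ≤-trans (half-≤ 0<δ) (≤-trans
        (subst (_≤ q - m) (solve 2 (λ m d → m :+ d :- m := d) refl m δ) (+-monoˡ-≤ (- m) m+δ≤q))
        (≤-trans (expΣ-gap 0≤m (≤-trans (≤-by-difference δ (<⇒≤ 0<δ) refl) m+δ≤q) 2≤n)
          (≤-reflexive (∣-∣-sym (expΣ n m) (expΣ n q)))))
      too-small : q + δ ≤ m → 0ℚ ≤ q ⊎ q ≤ 0ℚ → δ * ½ ≤ ∣ expΣ n q - expΣ n m ∣
      too-small q+δ≤m (inj₁ 0≤q) = ≤-trans (half-≤ 0<δ) (≤-trans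
        (subst (_≤ m - q) (solve 2 (λ m d → m :+ d :- m := d) refl q δ) (+-monoˡ-≤ (- q) q+δ≤m))
        (expΣ-gap 0≤q (≤-trans (≤-by-difference δ (<⇒≤ 0<δ) refl) q+δ≤m) 2≤n))
      too-small _ (inj₂ q≤0) = begin
        δ * ½
          ≡⟨ solve 1 (λ d → d :* con ½ := (con 1ℚ :+ d) :- (con 1ℚ :+ d :* con ½)) refl δ ⟩
        (1ℚ + δ) - (1ℚ + δ * ½)
          ≤⟨ +-mono-≤ (≤-trans (+-monoʳ-≤ 1ℚ δ≤m) (1+q≤expΣ′ 2≤n)) (neg-antimono-≤ (≤-trans
               (expΣ-neg B q≤0 ∣q∣≤b h (ℕ.≤-trans (proj₁ (proj₂ tail)) N≤h))
               (+-monoʳ-≤ 1ℚ (≤-trans (*-monoˡ (L + L) (+-nonneg 0≤L 0≤L) (<⇒≤ (proj₂ (proj₂ tail) h N≤h))) (proj₂ (proj₂ shrunk)))))) ⟩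
        expΣ n m - expΣ n q
          ≡⟨ solve 2 (λ x y → y :- x := :- (x :- y)) refl (expΣ n q) (expΣ n m) ⟩
        - (expΣ n q - expΣ n m)
          ≤⟨ -p≤∣p∣ (expΣ n q - expΣ n m) ⟩
        ∣ expΣ n q - expΣ n m ∣ ∎
        where
        open ≤-Reasoning
        N≤h = ℕ.<⇒≤ N<h
        1+q≤expΣ′ : ∀ {n} → 2 ℕ.≤ n → 1ℚ + m ≤ expΣ n m
        1+q≤expΣ′ (ℕ.s≤s (ℕ.s≤s {n = n} ℕ.z≤n)) = 1+q≤expΣ 0≤m n

  -- (2j)^i / i! is the product of 2j/1, ..., 2j/i, and each factor is at least 2 while i ≤ j.
  2^≤term : ∀ j i → i ℕ.≤ j → ⌜ 2 ℕ.^ i ⌝ ≤ term ⌜ j ℕ.+ j ⌝ i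
  2^≤term j zero    _   = ≤-refl
  2^≤term j (suc i) i<j = *-cancel-≤ ⌜ suc i ⌝ (0<⌜⌝ (suc i)) (begin
    ⌜ 2 ℕ.* 2 ℕ.^ i ⌝ * ⌜ suc i ⌝   ≡⟨ ⌜*⌝ (2 ℕ.* 2 ℕ.^ i) (suc i) ⟨
    ⌜ 2 ℕ.* 2 ℕ.^ i ℕ.* suc i ⌝     ≤⟨ ⌜⌝-mono le ⟩
    ⌜ (j ℕ.+ j) ℕ.* 2 ℕ.^ i ⌝       ≡⟨ ⌜*⌝ (j ℕ.+ j) (2 ℕ.^ i) ⟩
    q * ⌜ 2 ℕ.^ i ⌝                 ≤⟨ *-monoʳ q (0≤⌜⌝ (j ℕ.+ j)) (2^≤term j i (ℕ.<⇒≤ i<j)) ⟩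
    q * term q i                    ≡⟨ term-suc q i ⟨
    ⌜ suc i ⌝ * term q (suc i)      ≡⟨ *-comm ⌜ suc i ⌝ (term q (suc i)) ⟩
    term q (suc i) * ⌜ suc i ⌝      ∎)
    where
    open ≤-Reasoning
    q = ⌜ j ℕ.+ j ⌝
    le : 2 ℕ.* 2 ℕ.^ i ℕ.* suc i ℕ.≤ (j ℕ.+ j) ℕ.* 2 ℕ.^ i
    le = subst (ℕ._≤ (j ℕ.+ j) ℕ.* 2 ℕ.^ i)
      (trans (cong (ℕ._* 2 ℕ.^ i) (cong (suc i ℕ.+_) (sym (ℕ.+-identityʳ (suc i)))))
        (trans (ℕ.*-assoc 2 (suc i) (2 ℕ.^ i)) (trans (cong (2 ℕ.*_) (ℕ.*-comm (suc i) (2 ℕ.^ i))) (sym (ℕ.*-assoc 2 (2 ℕ.^ i) (suc i))))))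
      (ℕ.*-monoˡ-≤ (2 ℕ.^ i) (ℕ.+-mono-≤ i<j i<j))

  2^≤expΣ : ∀ j {n} → j ℕ.< n → ⌜ 2 ℕ.^ j ⌝ ≤ expΣ n ⌜ j ℕ.+ j ⌝
  2^≤expΣ j {n} j<n = ≤-trans (2^≤term j j ℕ.≤-refl) (≤-trans
    (≤-by-difference (expΣ j ⌜ j ℕ.+ j ⌝) (0≤Σ< 0≤t j) (+-comm (expΣ j ⌜ j ℕ.+ j ⌝) _)) (Σ<-mono-length 0≤t j<n))
    where 0≤t = 0≤term (0≤⌜⌝ (j ℕ.+ j))

module Sieving where

  open import Axiom.ExcludedMiddle using (ExcludedMiddle)
  open import Data.Nat.Base as ℕ using (ℕ; zero; suc; NonZero; _!)
  open import Data.Nat.Coprimality using (Coprime; coprime-divisor)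
  open import Data.Nat.Divisibility
  open import Data.Nat.Primality
  import Data.Nat.Properties as ℕ
  open import Data.Product.Base using (∃; _×_; _,_; proj₁; proj₂)
  open import Data.Rational.Base hiding (NonZero; ∣_∣)
  open import Data.Rational.Properties
  open import Data.Rational.Solver using (module +-*-Solver)
  open import Data.Sum.Base using (_⊎_; inj₁; inj₂)
  open import Function.Base using (_∘_)
  open import Level using (0ℓ)
  open import Relation.Binary.PropositionalEquality
  open import Relation.Nullary.Decidable.Core using (Dec; yes; no)
  open import Relation.Nullary.Negation.Core using (¬_; contradiction)
  open +-*-Solver using (solve; _:=_; _:+_; _:*_; _:-_; :-_; con)
  open Rationals

  -- Coprimality to P!, and sums of inverse squares

  ∤⇒coprime : ∀ {p n} → Prime p → p ∤ n → Coprime p n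
  ∤⇒coprime pp p∤n (d∣p , d∣n) with prime⇒irreducible pp d∣p
  ... | inj₁ d≡1  = d≡1
  ... | inj₂ refl = contradiction d∣n p∤n

  ∤⇒coprime-square : ∀ {p n} → Prime p → p ∤ n → Coprime (p ℕ.* p) n
  ∤⇒coprime-square {p} pp p∤n (d∣pp , d∣n) = coprime (d∣p , d∣n)
    where
    coprime = ∤⇒coprime pp p∤n
    d∣p = coprime-divisor (λ (e∣d , e∣p) → coprime (e∣p , ∣-trans e∣d d∣n)) d∣pp

  prime>⇒∤! : ∀ {p} n → Prime p → n ℕ.< p → p ∤ n !
  prime>⇒∤! zero    pp n<p p∣1 = ℕ.<⇒≱ (nonTrivial⇒n>1 _) (∣⇒≤ p∣1)
    where
    open import Data.Nat.Base using (nonTrivial⇒n>1)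
    instance _ = prime⇒nonTrivial pp
  prime>⇒∤! (suc n) pp n<p p∣ with euclidsLemma (suc n) (n !) pp p∣
  ... | inj₁ p∣1+n = ℕ.<⇒≱ n<p (∣⇒≤ p∣1+n)
  ... | inj₂ p∣n!  = prime>⇒∤! n pp (ℕ.<-trans (ℕ.n<1+n n) n<p) p∣n!

  ≤⇒∣! : ∀ {p n} .{{_ : NonZero p}} → p ℕ.≤ n → p ∣ n !
  ≤⇒∣! {suc p} p≤n = ∣-trans (m∣m*n (p !)) (m≤n⇒m!∣n! p≤n)

  prime∤1 : ∀ {p} → Prime p → p ∤ 1
  prime∤1 pp p∣1 with refl ← ∣1⇒≡1 p∣1 = ¬prime[1] pp

  inv-telescope : ∀ n .{{_ : NonZero n}} → inv n ≡ inv (suc n) + inv n * inv (suc n)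
  inv-telescope n = sym (inv-unique n (begin
    (x + y * x) * ⌜ n ⌝        ≡⟨ solve 3 (λ x y n → (x :+ y :* x) :* n := x :* (y :* n :+ n)) refl x y ⌜ n ⌝ ⟩
    x * (y * ⌜ n ⌝ + ⌜ n ⌝)    ≡⟨ cong (λ t → x * (t + ⌜ n ⌝)) (inv-* n) ⟩
    x * (1ℚ + ⌜ n ⌝)           ≡⟨ cong (x *_) (⌜+⌝ 1 n) ⟨
    x * ⌜ suc n ⌝              ≡⟨ inv-* (suc n) ⟩
    1ℚ                         ∎))
    where
    open ≡-Reasoning
    x = inv (suc n)
    y = inv n

  -- Telescoping with 1/n² ≤ 1/(n - 1) - 1/n; the summand 1/(P + R) on the left is what the
  -- induction carries.
  ∑-inverse-squares : ∀ P .{{_ : NonZero P}} R → ∑ R (λ i → inv (P ℕ.+ i) * inv (P ℕ.+ i)) + inv (P ℕ.+ R) ≤ inv P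
  ∑-inverse-squares P zero    = ≤-reflexive (trans (+-identityˡ _) (cong inv (ℕ.+-identityʳ P)))
  ∑-inverse-squares P (suc R) = ≤-trans
    (≤-reflexive (+-assoc S (inv (P ℕ.+ suc R) * inv (P ℕ.+ suc R)) (inv (P ℕ.+ suc R))))
    (≤-trans (+-monoʳ-≤ S step) (∑-inverse-squares P R))
    where
    S = ∑ R (λ i → inv (P ℕ.+ i) * inv (P ℕ.+ i))
    n = P ℕ.+ R
    instance _ = subst NonZero (ℕ.+-comm R P) (+-nonZeroʳ R P)
    step : inv (P ℕ.+ suc R) * inv (P ℕ.+ suc R) + inv (P ℕ.+ suc R) ≤ inv n
    step = subst₂ _≤_ (cong (λ t → inv t * inv t + inv t) (sym (ℕ.+-suc P R)))
      (trans (+-comm (inv n * inv (suc n)) (inv (suc n))) (sym (inv-telescope n)))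
      (+-monoˡ-≤ (inv (suc n)) (*-monoˡ (inv (suc n)) (0≤inv (suc n)) (inv-antimono (ℕ.n≤1+n n))))

  -- A sieve on the pairs k Q - 1, k Q + 1

  module Sieve (em : ExcludedMiddle 0ℓ) (Bad : ℕ → Set) (bad⇒prime : ∀ {p} → Bad p → Prime p) where

    -- At such n a multiplicative function is a product of its values at distinct primes that are
    -- not bad.
    Good : ℕ → Set
    Good n = ∀ p → Prime p → p ∣ n → ¬ Bad p × p ℕ.* p ∤ n

    module _ (P : ℕ) (2≤P : 2 ℕ.≤ P) where

      Q : ℕ
      Q = P !

      private instance
        Q≢0 : NonZero Q
        Q≢0 = P ℕ.!≢0

      2≤Q : 2 ℕ.≤ Q
      2≤Q = ∣⇒≤ (≤⇒∣! {2} 2≤P)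

      lo hi : ℕ → ℕ
      lo k = ℕ.pred (k ℕ.* Q)
      hi k = suc (k ℕ.* Q)

      module _ (k : ℕ) .{{_ : NonZero k}} where
        1+lo : suc (lo k) ≡ k ℕ.* Q
        1+lo = ℕ.suc-pred (k ℕ.* Q) {{ℕ.m*n≢0 k Q}}

        lo≢0 : NonZero (lo k)
        lo≢0 = ℕ.>-nonZero (ℕ.≤-pred (subst (2 ℕ.≤_) (sym 1+lo) (ℕ.≤-trans 2≤Q (ℕ.m≤n*m Q k))))

      private
        module _ (k : ℕ) .{{_ : NonZero k}} where
          -- Source of the constant Q + 1: through this a divisor d of k Q ± 1 is at most (Q + 1) k.
          kQ<Λk : k ℕ.* Q ℕ.< suc Q ℕ.* k
          kQ<Λk = subst₂ ℕ._<_ (ℕ.*-comm Q k) refl (ℕ.m<n+m (Q ℕ.* k) (ℕ.>-nonZero⁻¹ k))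

        lo-+ : ∀ k e .{{_ : NonZero k}} → lo (k ℕ.+ e) ≡ lo k ℕ.+ e ℕ.* Q
        lo-+ k e = cong ℕ.pred (trans (ℕ.*-distribʳ-+ Q k e) (cong (ℕ._+ e ℕ.* Q) (sym (1+lo k))))

        module _ {d} .{{_ : NonZero d}} (cop : Coprime d Q) where
          -- d divides the difference e Q and is prime to Q, hence divides e.
          gap : ∀ m e .{{_ : NonZero e}} → d ∣ m → d ∣ m ℕ.+ e ℕ.* Q → d ℕ.≤ e
          gap m e d∣m d∣m+eQ = ∣⇒≤ (coprime-divisor cop
            (subst (d ∣_) (ℕ.*-comm e Q) (∣m+n∣m⇒∣n d∣m+eQ d∣m)))

          lo-gap : ∀ k e .{{_ : NonZero k}} .{{_ : NonZero e}} → d ∣ lo k → d ∣ lo (k ℕ.+ e) → d ℕ.≤ e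
          lo-gap k e hk hke = gap (lo k) e hk (subst (d ∣_) (lo-+ k e) hke)

          hi-gap : ∀ k e .{{_ : NonZero k}} .{{_ : NonZero e}} → d ∣ hi k → d ∣ hi (k ℕ.+ e) → d ℕ.≤ e
          hi-gap k e hk hke = gap (hi k) e hk (subst (λ t → d ∣ suc t) (ℕ.*-distribʳ-+ Q k e) hke)

          lo-first : ∀ k .{{_ : NonZero k}} → d ∣ lo k → d ℕ.≤ suc Q ℕ.* k
          lo-first k d∣ = ℕ.≤-trans (∣⇒≤ {{lo≢0 k}} d∣) (ℕ.≤-trans ℕ.pred[n]≤n (ℕ.<⇒≤ (kQ<Λk k)))

          hi-first : ∀ k .{{_ : NonZero k}} → d ∣ hi k → d ℕ.≤ suc Q ℕ.* k
          hi-first k d∣ = ℕ.≤-trans (∣⇒≤ d∣) (kQ<Λk k)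

      module _ (K : ℕ) where

        Λ : ℚ
        Λ = ⌜ suc Q ⌝ + harmonic K

        0≤Λ : 0ℚ ≤ Λ
        0≤Λ = +-nonneg (0≤⌜⌝ (suc Q)) (0≤harmonic K)

        X Y : ℕ → ℕ → ℚ
        X d k = 𝟙 (em {d ∣ lo k}) * inv k
        Y d k = 𝟙 (em {d ∣ hi k}) * inv k

        private
          divide : ∀ d .{{_ : NonZero d}} {S} → ⌜ d ⌝ * S ≤ Λ → S ≤ inv d * Λ
          divide d {S} h = subst (_≤ inv d * Λ)
            (trans (sym (*-assoc (inv d) ⌜ d ⌝ S)) (trans (cong (_* S) (inv-* d)) (*-identityˡ S)))
            (*-monoʳ (inv d) (0≤inv d) h)

        ∑X≤ : ∀ d .{{_ : NonZero d}} → Coprime d Q → ∑ K (X d) ≤ inv d * Λ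
        ∑X≤ d cop = divide d (sparse-harmonic (λ k → em {d ∣ lo k}) d (suc Q) (lo-gap cop) (lo-first cop) K)

        ∑Y≤ : ∀ d .{{_ : NonZero d}} → Coprime d Q → ∑ K (Y d) ≤ inv d * Λ
        ∑Y≤ d cop = divide d (sparse-harmonic (λ k → em {d ∣ hi k}) d (suc Q) (hi-gap cop) (hi-first cop) K)

        b π : ℕ → ℚ
        b p = 𝟙 (em {Bad p})
        π p = 𝟙 (em {Prime p})

        -- The summand of a union bound: if p obstructs k, it is at least 1/k by `obstruction-w`.
        w : ℕ → ℕ → ℚ
        w p k = b p * (X p k + Y p k) + π p * (X (p ℕ.* p) k + Y (p ℕ.* p) k)

        ∑w : ∀ p → ∑ K (w p) ≡ b p * (∑ K (X p) + ∑ K (Y p)) + π p * (∑ K (X (p ℕ.* p)) + ∑ K (Y (p ℕ.* p)))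
        ∑w p = trans (∑-+ K _ _) (cong₂ _+_
          (trans (∑-*ˡ K (b p) _) (cong (b p *_) (∑-+ K (X p) (Y p))))
          (trans (∑-*ˡ K (π p) _) (cong (π p *_) (∑-+ K (X (p ℕ.* p)) (Y (p ℕ.* p))))))

        0≤X : ∀ d k → 0ℚ ≤ X d k
        0≤X d k = *-nonneg (0≤𝟙 em) (0≤inv k)

        0≤Y : ∀ d k → 0ℚ ≤ Y d k
        0≤Y d k = *-nonneg (0≤𝟙 em) (0≤inv k)

        0≤X+Y : ∀ d k → 0ℚ ≤ X d k + Y d k
        0≤X+Y d k = +-nonneg (0≤X d k) (0≤Y d k)

        0≤w : ∀ p k → 0ℚ ≤ w p k
        0≤w p k = +-nonneg (*-nonneg (0≤𝟙 em) (0≤X+Y p k)) (*-nonneg (0≤𝟙 em) (0≤X+Y (p ℕ.* p) k))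

        -- The share of Λ that p may remove at each of the two neighbours. The square term is kept
        -- for composite p too, so that `∑-inverse-squares` applies to the sum over all p > P.
        mass : ℕ → ℚ
        mass p = b p * inv p + inv p * inv p

        ∑w≤ : ∀ p → P ℕ.< p → ∑ K (w p) ≤ mass p * (Λ + Λ)
        ∑w≤ p P<p = subst (_≤ mass p * (Λ + Λ)) (sym (∑w p)) (by-primality em)
          where
          by-primality : Dec (Prime p) → b p * (∑ K (X p) + ∑ K (Y p)) +
            π p * (∑ K (X (p ℕ.* p)) + ∑ K (Y (p ℕ.* p))) ≤ mass p * (Λ + Λ)
          by-primality (no ¬pp) = subst (_≤ mass p * (Λ + Λ)) (sym (cong₂ _+_
              (trans (cong (_* (∑ K (X p) + ∑ K (Y p))) (𝟙-no em (¬pp ∘ bad⇒prime))) (*-zeroˡ (∑ K (X p) + ∑ K (Y p))))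
              (trans (cong (_* (∑ K (X (p ℕ.* p)) + ∑ K (Y (p ℕ.* p)))) (𝟙-no em ¬pp)) (*-zeroˡ (∑ K (X (p ℕ.* p)) + ∑ K (Y (p ℕ.* p)))))))
            (*-nonneg (+-nonneg (*-nonneg (0≤𝟙 em) (0≤inv p)) (*-nonneg (0≤inv p) (0≤inv p))) (+-nonneg 0≤Λ 0≤Λ))
          by-primality (yes pp) = ≤-trans (+-mono-≤
              (*-monoʳ (b p) (0≤𝟙 em) (+-mono-≤ (∑X≤ p cop) (∑Y≤ p cop)))
              (≤-trans (≤-reflexive (trans (cong (_* (∑ K (X pp²) + ∑ K (Y pp²))) (𝟙-yes em pp)) (*-identityˡ _)))
                (+-mono-≤ (∑X≤ pp² cop²) (∑Y≤ pp² cop²))))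
            (≤-reflexive (trans (cong (λ t → b p * (inv p * Λ + inv p * Λ) + (t * Λ + t * Λ)) (inv-*-homo p p))
              (solve 3 (λ b i l → b :* (i :* l :+ i :* l) :+ (i :* i :* l :+ i :* i :* l)
                 := (b :* i :+ i :* i) :* (l :+ l)) refl (b p) (inv p) Λ)))
            where
            pp² = p ℕ.* p
            instance
              _ = prime⇒nonZero pp
              _ = ℕ.m*n≢0 p p
            p∤Q = prime>⇒∤! P pp P<p
            cop = ∤⇒coprime pp p∤Q
            cop² = ∤⇒coprime-square pp p∤Q

        good : ℕ → ℚ
        good k = 𝟙 (em {Good (lo k) × Good (hi k)})

        Obstruction : ℕ → Set
        Obstruction k = ∃ λ p → Prime p ×
          ((p ∣ lo k × Bad p ⊎ p ∣ hi k × Bad p) ⊎ (p ℕ.* p ∣ lo k ⊎ p ℕ.* p ∣ hi k))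

        no-obstruction⇒good : ∀ k → ¬ Obstruction k → Good (lo k) × Good (hi k)
        no-obstruction⇒good k ¬o =
          (λ p pp p∣ → (λ bad → ¬o (p , pp , inj₁ (inj₁ (p∣ , bad)))) , λ p²∣ → ¬o (p , pp , inj₂ (inj₁ p²∣))) ,
          (λ p pp p∣ → (λ bad → ¬o (p , pp , inj₁ (inj₂ (p∣ , bad)))) , λ p²∣ → ¬o (p , pp , inj₂ (inj₂ p²∣)))

        module _ (k : ℕ) .{{_ : NonZero k}} where

          obstruction-∣ : ((p , _) : Obstruction k) → p ∣ lo k ⊎ p ∣ hi k
          obstruction-∣ (p , _ , inj₁ (inj₁ (p∣ , _))) = inj₁ p∣
          obstruction-∣ (p , _ , inj₁ (inj₂ (p∣ , _))) = inj₂ p∣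
          obstruction-∣ (p , _ , inj₂ (inj₁ p²∣)) = inj₁ (∣-trans (m∣m*n p) p²∣)
          obstruction-∣ (p , _ , inj₂ (inj₂ p²∣)) = inj₂ (∣-trans (m∣m*n p) p²∣)

          -- A prime p ≤ P divides Q, so if it divided k Q - 1 or k Q + 1 it would divide 1.
          obstruction-> : ((p , _) : Obstruction k) → P ℕ.< p
          obstruction-> o@(p , pp , _) with ℕ.<-≤-connex P p
          ... | inj₁ P<p = P<p
          ... | inj₂ p≤P = contradiction (obstruction-∣ o) λ
              { (inj₁ p∣lo) → prime∤1 pp (∣m+n∣m⇒∣n (subst (p ∣_) (trans (sym (1+lo k)) (ℕ.+-comm 1 (lo k))) p∣kQ) p∣lo)
              ; (inj₂ p∣hi) → prime∤1 pp (∣m+n∣m⇒∣n (subst (p ∣_) (ℕ.+-comm 1 (k ℕ.* Q)) p∣hi) p∣kQ) }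
            where
            p∣kQ : p ∣ k ℕ.* Q
            p∣kQ = ∣n⇒∣m*n k (≤⇒∣! {{prime⇒nonZero pp}} p≤P)

          obstruction-≤ : ((p , _) : Obstruction k) → p ℕ.≤ hi k
          obstruction-≤ o with obstruction-∣ o
          ... | inj₁ p∣lo = ℕ.≤-trans (∣⇒≤ {{lo≢0 k}} p∣lo) (ℕ.≤-trans ℕ.pred[n]≤n (ℕ.n≤1+n _))
          ... | inj₂ p∣hi = ∣⇒≤ p∣hi

          obstruction-w : ((p , _) : Obstruction k) → inv k ≤ w p k
          obstruction-w (p , pp , inj₁ c) = ≤-trans (bad c)
              (≤-by-difference _ (*-nonneg (0≤𝟙 em) (0≤X+Y (p ℕ.* p) k)) refl)
            where
            bad : p ∣ lo k × Bad p ⊎ p ∣ hi k × Bad p → inv k ≤ b p * (X p k + Y p k)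
            bad (inj₁ (p∣ , bp)) = ≤-by-difference (Y p k) (0≤Y p k)
              (trans (cong₂ (λ s t → s * (t * inv k + Y p k)) (𝟙-yes em bp) (𝟙-yes em p∣))
                (solve 2 (λ i y → con 1ℚ :* (con 1ℚ :* i :+ y) := i :+ y) refl (inv k) (Y p k)))
            bad (inj₂ (p∣ , bp)) = ≤-by-difference (X p k) (0≤X p k)
              (trans (cong₂ (λ s t → s * (X p k + t * inv k)) (𝟙-yes em bp) (𝟙-yes em p∣))
                (solve 2 (λ i y → con 1ℚ :* (y :+ con 1ℚ :* i) := i :+ y) refl (inv k) (X p k)))
          obstruction-w (p , pp , inj₂ c) = ≤-trans (square c)
              (≤-by-difference (b p * (X p k + Y p k)) (*-nonneg (0≤𝟙 em) (0≤X+Y p k))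
                (+-comm (b p * (X p k + Y p k)) _))
            where
            p² = p ℕ.* p
            square : p² ∣ lo k ⊎ p² ∣ hi k → inv k ≤ π p * (X p² k + Y p² k)
            square (inj₁ p∣) = ≤-by-difference (Y p² k) (0≤Y p² k)
              (trans (cong₂ (λ s t → s * (t * inv k + Y p² k)) (𝟙-yes em pp) (𝟙-yes em p∣))
                (solve 2 (λ i y → con 1ℚ :* (con 1ℚ :* i :+ y) := i :+ y) refl (inv k) (Y p² k)))
            square (inj₂ p∣) = ≤-by-difference (X p² k) (0≤X p² k)
              (trans (cong₂ (λ s t → s * (X p² k + t * inv k)) (𝟙-yes em pp) (𝟙-yes em p∣))
                (solve 2 (λ i y → con 1ℚ :* (y :+ con 1ℚ :* i) := i :+ y) refl (inv k) (X p² k)))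

        -- An obstruction at some k ≤ K divides a positive number that is at most K Q + 1, so the p
        -- = P + i with i ≤ R include all of them.
        R : ℕ
        R = hi K

        cover : ∀ k .{{_ : NonZero k}} → k ℕ.≤ K → inv k ≤ good k * inv k + ∑ R (λ i → w (P ℕ.+ i) k)
        cover k k≤K with em {Obstruction k}
        ... | no ¬o = ≤-by-difference (∑ R (λ i → w (P ℕ.+ i) k)) (∑-nonneg R (λ i → 0≤w (P ℕ.+ i) k))
                (cong (_+ ∑ R (λ i → w (P ℕ.+ i) k))
                  (trans (cong (_* inv k) (𝟙-yes em (no-obstruction⇒good k ¬o))) (*-identityˡ (inv k))))
        ... | yes o@(p , _) = ≤-trans (≤-trans (obstruction-w k o) w≤∑)
                (≤-by-difference (good k * inv k) (*-nonneg (0≤𝟙 em) (0≤inv k)) (+-comm (good k * inv k) _))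
          where
          P<p = obstruction-> k o
          w≤∑ : w p k ≤ ∑ R (λ i → w (P ℕ.+ i) k)
          w≤∑ = subst (λ t → w t k ≤ ∑ R (λ i → w (P ℕ.+ i) k)) (ℕ.m+[n∸m]≡n (ℕ.<⇒≤ P<p))
            (term≤∑ (λ i → w (P ℕ.+ i) k) (λ i → 0≤w (P ℕ.+ i) k) (p ℕ.∸ P) {{ℕ.>-nonZero (ℕ.m<n⇒0<n∸m P<p)}}
              (ℕ.≤-trans (ℕ.m∸n≤m p P) (ℕ.≤-trans (obstruction-≤ k o) (ℕ.s≤s (ℕ.*-monoˡ-≤ Q k≤K)))))

        -- After exchanging the sums, the two neighbours together cost 2Λ times the total mass; a
        -- mass of 1/4 thus costs Λ/2, which is half of H_K up to a constant.
        sieve : ∑ R (λ i → mass (P ℕ.+ i)) ≤ ½ * ½ →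
                harmonic K ≤ ∑ K (λ k → good k * inv k) + Λ * ½
        sieve small = begin
          harmonic K
            ≤⟨ ∑-mono K cover ⟩
          ∑ K (λ k → good k * inv k + ∑ R (λ i → w (P ℕ.+ i) k))
            ≡⟨ ∑-+ K _ _ ⟩
          G + ∑ K (λ k → ∑ R (λ i → w (P ℕ.+ i) k))
            ≡⟨ cong (λ t → G + t) (∑-swap K R (λ k i → w (P ℕ.+ i) k)) ⟩
          G + ∑ R (λ i → ∑ K (w (P ℕ.+ i)))
            ≤⟨ +-monoʳ-≤ G (∑-mono R (λ i _ → ∑w≤ (P ℕ.+ i) (ℕ.m<m+n P (ℕ.>-nonZero⁻¹ i)))) ⟩
          G + ∑ R (λ i → mass (P ℕ.+ i) * (Λ + Λ))
            ≡⟨ cong (λ t → G + t) (∑-*ʳ R (λ i → mass (P ℕ.+ i)) (Λ + Λ)) ⟩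
          G + ∑ R (λ i → mass (P ℕ.+ i)) * (Λ + Λ)
            ≤⟨ +-monoʳ-≤ G (*-monoˡ (Λ + Λ) (+-nonneg 0≤Λ 0≤Λ) small) ⟩
          G + ½ * ½ * (Λ + Λ)
            ≡⟨ cong (λ t → G + t) (solve 1 (λ l → con ½ :* con ½ :* (l :+ l) := l :* con ½) refl Λ) ⟩
          G + Λ * ½ ∎
          where
          open ≤-Reasoning
          G = ∑ K (λ k → good k * inv k)

  -- If every P were followed by a block of sum above ε, chaining k such blocks would give a partial
  -- sum of at least k ε, beyond q for large k.
  ∑-tail : ExcludedMiddle 0ℓ → ∀ a {q} → (∀ N → ∑ N a ≤ q) → ∀ {ε} → 0ℚ < ε →
           ∃ λ P → ∀ R → ∑ R (a ∘ (P ℕ.+_)) ≤ ε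
  ∑-tail em a {q} bounded {ε} 0<ε with em {∃ λ P → ∀ R → ∑ R (a ∘ (P ℕ.+_)) ≤ ε}
  ... | yes tail = tail
  ... | no ¬tail = contradiction (bounded (proj₁ (reach k))) (<⇒≱′ (<-≤-trans q<kε (proj₂ (reach k))))
    where
    <⇒≱′ : ∀ {x y} → x < y → ¬ (y ≤ x)
    <⇒≱′ x<y y≤x = <-irrefl refl (<-≤-trans x<y y≤x)

    heavy : ∀ P → ∃ λ R → ε < ∑ R (a ∘ (P ℕ.+_))
    heavy P with em {∃ λ R → ε < ∑ R (a ∘ (P ℕ.+_))}
    ... | yes h = h
    ... | no ¬h = contradiction (P , λ R → ≮⇒≥ λ lt → ¬h (R , lt)) ¬tail

    reach : ∀ k → ∃ λ N → ⌜ k ⌝ * ε ≤ ∑ N a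
    reach zero    = 0 , ≤-reflexive (*-zeroˡ ε)
    reach (suc k) with reach k
    ... | N , kε≤ with heavy N
    ...   | R , ε< = N ℕ.+ R , (begin
            ⌜ suc k ⌝ * ε                   ≡⟨ cong (_* ε) (⌜+⌝ 1 k) ⟩
            (1ℚ + ⌜ k ⌝) * ε                ≡⟨ solve 2 (λ k e → (con 1ℚ :+ k) :* e := k :* e :+ e) refl ⌜ k ⌝ ε ⟩
            ⌜ k ⌝ * ε + ε                   ≤⟨ +-mono-≤ kε≤ (<⇒≤ ε<) ⟩
            ∑ N a + ∑ R (a ∘ (N ℕ.+_))      ≡⟨ ∑-split N R a ⟨
            ∑ (N ℕ.+ R) a                   ∎)
      where open ≤-Reasoning

    small = eventually-inv q 0<ε
    k = suc (proj₁ small)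
    q<kε : q < ⌜ k ⌝ * ε
    q<kε = subst₂ _<_
      (trans (*-assoc q (inv k) ⌜ k ⌝) (trans (cong (q *_) (inv-* k)) (*-identityʳ q))) (*-comm ε ⌜ k ⌝)
      (*-monoˡ-<-pos ⌜ k ⌝ {{positive (0<⌜⌝ k)}} (proj₂ small k (ℕ.n≤1+n _)))

  -- Logarithmic density along powers of 2

  n≤2^n : ∀ n → n ℕ.≤ 2 ℕ.^ n
  n≤2^n zero    = ℕ.z≤n
  n≤2^n (suc n) = ℕ.≤-trans (ℕ.+-mono-≤ (ℕ.m^n>0 2 n) (n≤2^n n)) (ℕ.+-monoʳ-≤ (2 ℕ.^ n) (ℕ.m≤m+n (2 ℕ.^ n) 0))

  module Density (em : ExcludedMiddle 0ℓ) (Bad : ℕ → Set) (bad⇒prime : ∀ {p} → Bad p → Prime p)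
    (P : ℕ) (8≤P : 8 ℕ.≤ P)
    (tail : ∀ R → ∑ R (λ i → 𝟙 (em {Bad (P ℕ.+ i)}) * inv (P ℕ.+ i)) ≤ ½ * ½ * ½) where

    open Sieve em Bad bad⇒prime using (Good)

    private
      open Sieve em Bad bad⇒prime using (Q; 2≤Q; lo; hi; lo≢0; 1+lo; mass; sieve; R)

      2≤P : 2 ℕ.≤ P
      2≤P = ℕ.≤-trans (ℕ.s≤s (ℕ.s≤s ℕ.z≤n)) 8≤P

      Q′ : ℕ
      Q′ = Q P 2≤P

      instance
        Q≢0 : NonZero Q′
        Q≢0 = P ℕ.!≢0

      -- The mass 1/4 that `sieve` allows is split evenly: 1/8 for the bad primes by `tail`, and 1/P
      -- ≤ 1/8 for the squares, which is why P ≥ 8.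
      small-mass : ∀ K R → ∑ R (λ i → mass P 2≤P K (P ℕ.+ i)) ≤ ½ * ½
      small-mass K R = begin
        ∑ R (λ i → 𝟙 (em {Bad (P ℕ.+ i)}) * inv (P ℕ.+ i) + inv (P ℕ.+ i) * inv (P ℕ.+ i))
          ≡⟨ ∑-+ R _ _ ⟩
        ∑ R (λ i → 𝟙 (em {Bad (P ℕ.+ i)}) * inv (P ℕ.+ i)) + ∑ R (λ i → inv (P ℕ.+ i) * inv (P ℕ.+ i))
          ≤⟨ +-mono-≤ (tail R) (≤-trans (≤-by-difference (inv (P ℕ.+ R)) (0≤inv (P ℕ.+ R)) refl)
               (≤-trans (∑-inverse-squares P {{ℕ.>-nonZero (ℕ.<-≤-trans ℕ.z<s 8≤P)}} R) (inv-antimono {8} {P} 8≤P))) ⟩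
        ½ * ½ * ½ + inv 8
          ≡⟨⟩
        ½ * ½ ∎
        where open ≤-Reasoning

    module _ (χ : ℕ → ℚ) (0≤χ : ∀ n → 0ℚ ≤ χ n) (1≤χ : ∀ n .{{_ : NonZero n}} → Good n → Good (2 ℕ.+ n) → 1ℚ ≤ χ n) where

      private
        a : ℕ → ℚ
        a n = χ n * inv n

        0≤a : ∀ n → 0ℚ ≤ a n
        0≤a n = *-nonneg (0≤χ n) (0≤inv n)

        low : ℕ → ℕ
        low = lo P 2≤P

        good′ : ℕ → ℚ
        good′ k = 𝟙 (em {Good (low k) × Good (hi P 2≤P k)})

        -- k Q - 1 ≤ k Q, so its reciprocal is at least (1/k)(1/Q): passing from k to n costs the
        -- factor 1/Q.
        good≤ : ∀ k .{{_ : NonZero k}} → good′ k * inv k * inv Q′ ≤ a (low k)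
        good≤ k with em {Good (low k) × Good (hi P 2≤P k)}
        ... | no _ = ≤-trans (≤-reflexive (trans (*-assoc 0ℚ (inv k) (inv Q′)) (*-zeroˡ (inv k * inv Q′)))) (0≤a (low k))
        ... | yes (g , g′) = ≤-trans (≤-reflexive (trans (*-assoc 1ℚ (inv k) (inv Q′)) (cong (1ℚ *_) (sym (inv-*-homo k Q′)))))
                (*-mono (0≤⌜⌝ 1) (0≤inv (low k)) (1≤χ (low k) {{lo≢0 P 2≤P k}} g (subst Good (cong suc (sym (1+lo P 2≤P k))) g′))
                  (inv-antimono {{lo≢0 P 2≤P k}} (ℕ.pred[n]≤n {k ℕ.* Q′})))

        -- Each block ((k - 1) Q, k Q] contains its own k Q - 1; Q ≥ 2 keeps that number off the
        -- excluded left endpoint.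
        reindex : ∀ K → ∑ K (a ∘ low) ≤ ∑ (K ℕ.* Q′) a
        reindex zero    = ≤-refl
        reindex (suc K) = ≤-trans (+-mono-≤ (reindex K) (≤-trans (≤-reflexive (cong a low≡))
            (term≤∑ (a ∘ (K ℕ.* Q′ ℕ.+_)) (λ n → 0≤a (K ℕ.* Q′ ℕ.+ n)) (ℕ.pred Q′) {{ℕ.>-nonZero (ℕ.≤-pred 2≤sQ)}} (ℕ.pred[n]≤n {Q′}))))
          (≤-reflexive (trans (sym (∑-split (K ℕ.* Q′) Q′ a)) (cong (λ t → ∑ t a) (ℕ.+-comm (K ℕ.* Q′) Q′))))
          where
          2≤sQ : 2 ℕ.≤ suc (ℕ.pred Q′)
          2≤sQ = subst (2 ℕ.≤_) (sym (ℕ.suc-pred Q′)) (2≤Q P 2≤P)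
          low≡ : low (suc K) ≡ K ℕ.* Q′ ℕ.+ ℕ.pred Q′
          low≡ = cong ℕ.pred (trans (ℕ.+-comm Q′ (K ℕ.* Q′))
            (trans (cong (K ℕ.* Q′ ℕ.+_) (sym (ℕ.suc-pred Q′))) (ℕ.+-suc (K ℕ.* Q′) (ℕ.pred Q′))))

        W : ℕ → ℚ
        W K = ∑ K (λ k → good′ k * inv k)

        W≤ : ∀ K → W K * inv Q′ ≤ ∑ (K ℕ.* Q′) a
        W≤ K = ≤-trans (≤-reflexive (sym (∑-*ʳ K _ (inv Q′)))) (≤-trans (∑-mono K (λ k _ → good≤ k)) (reindex K))

        -- With w for `W` at 2^i and i = j - Q, `W-lower` gives w ≥ (j - Q)/4 - (Q + 1)/2, and the
        -- right side is at least j/8 exactly when j ≥ 2s.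
        s : ℕ
        s = Q′ ℕ.+ 2 ℕ.* suc Q′

        j₀ : ℕ
        j₀ = s ℕ.+ s

        -- The conclusion h ≤ w + (c + h)/2 of `sieve`, solved for h, is h ≤ 2w + c; `harmonic-2^`
        -- bounds h from below.
        W-lower : ∀ i → ⌜ i ⌝ * ½ ≤ W (2 ℕ.^ i) + W (2 ℕ.^ i) + ⌜ suc Q′ ⌝
        W-lower i = ≤-trans (harmonic-2^ i) (≤-by-difference (w + S + w + S - (h + h))
          (p≤q⇒0≤q-p {h + h} (subst (h + h ≤_) (solve 3 (λ w l s → w :+ l :* s :+ (w :+ l :* s) := w :+ l :* s :+ w :+ l :* s) refl w (c + h) ½) (+-mono-≤ sv sv)))
          (solve 3 (λ w c h → w :+ w :+ c := h :+ (w :+ (c :+ h) :* con ½ :+ w :+ (c :+ h) :* con ½ :- (h :+ h))) refl w c h))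
          where
          K = 2 ℕ.^ i
          w = W K
          c = ⌜ suc Q′ ⌝
          h = harmonic K
          S = (c + h) * ½
          sv : h ≤ w + S
          sv = sieve P 2≤P K (small-mass K (R P 2≤P K))

      -- The multiples of Q used are those up to K Q with K = 2^(j ∸ Q), so that K Q ≤ 2^j.
      density-beyond : ∃ λ c → 0ℚ < c × ∃ λ j₀ → ∀ j → j₀ ℕ.≤ j → ⌜ j ⌝ * c ≤ ∑ (2 ℕ.^ j) (λ n → χ n * inv n)
      -- Of the three halves, one comes from `harmonic-2^`, one from the sieve, and one absorbs the
      -- constants and the shift from j to i; 1/Q is the cost of `good≤`.
      density-beyond = ½ * ½ * ½ * inv Q′ , *-pos (positive⁻¹ (½ * ½ * ½)) (0<inv Q′) , j₀ , bound
        where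
        bound : ∀ j → j₀ ℕ.≤ j → ⌜ j ⌝ * (½ * ½ * ½ * inv Q′) ≤ ∑ (2 ℕ.^ j) a
        bound j j₀≤j = begin
          ⌜ j ⌝ * (½ * ½ * ½ * inv Q′)
            ≡⟨ solve 2 (λ j q → j :* (con ½ :* con ½ :* con ½ :* q) := j :* con ½ :* con ½ :* con ½ :* q) refl ⌜ j ⌝ (inv Q′) ⟩
          ⌜ j ⌝ * ½ * ½ * ½ * inv Q′
            ≤⟨ *-monoˡ (inv Q′) (0≤inv Q′) j≤W ⟩
          W K * inv Q′
            ≤⟨ W≤ K ⟩
          ∑ (K ℕ.* Q′) a
            ≤⟨ ∑-extend a (λ n → 0≤a n) KQ≤ ⟩
          ∑ (2 ℕ.^ j) a ∎
          where
          open ≤-Reasoning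
          i = j ℕ.∸ Q′
          K = 2 ℕ.^ i
          w = W K
          s≤j : s ℕ.≤ j
          s≤j = ℕ.≤-trans (ℕ.m≤m+n s s) j₀≤j
          i+Q≡j : i ℕ.+ Q′ ≡ j
          i+Q≡j = ℕ.m∸n+n≡m (ℕ.≤-trans (ℕ.m≤m+n Q′ (2 ℕ.* suc Q′)) s≤j)
          KQ≤ : K ℕ.* Q′ ℕ.≤ 2 ℕ.^ j
          KQ≤ = ℕ.≤-trans (ℕ.*-monoʳ-≤ K (n≤2^n Q′))
            (ℕ.≤-reflexive (trans (sym (ℕ.^-distribˡ-+-* 2 i Q′)) (cong (2 ℕ.^_) i+Q≡j)))
          x = ⌜ Q′ ⌝
          y = ⌜ suc Q′ ⌝
          ⌜s⌝ : ⌜ s ⌝ ≡ x + (y + y)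
          ⌜s⌝ = trans (⌜+⌝ Q′ (2 ℕ.* suc Q′)) (cong (x +_) (trans (cong ⌜_⌝ (cong (suc Q′ ℕ.+_) (ℕ.+-identityʳ (suc Q′)))) (⌜+⌝ (suc Q′) (suc Q′))))
          ⌜j⌝ : ⌜ j ⌝ ≡ ⌜ i ⌝ + x
          ⌜j⌝ = trans (cong ⌜_⌝ (sym i+Q≡j)) (⌜+⌝ i Q′)
          2s≤j : (x + (y + y)) + (x + (y + y)) ≤ ⌜ i ⌝ + x
          2s≤j = subst₂ _≤_ (trans (⌜+⌝ s s) (cong₂ _+_ ⌜s⌝ ⌜s⌝)) ⌜j⌝ (⌜⌝-mono j₀≤j)
          -- 2 w ≥ i/2 - y with i = j - x, and j ≥ 2 (x + 2 y).
          j≤W : ⌜ j ⌝ * ½ * ½ * ½ ≤ w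
          j≤W = subst (λ t → t * ½ * ½ * ½ ≤ w) (sym ⌜j⌝) (≤-by-difference
            (((w + w + y) - ⌜ i ⌝ * ½) * ½ + ((⌜ i ⌝ + x) - ((x + (y + y)) + (x + (y + y)))) * ½ * ½ * ½)
            (+-nonneg (*-nonneg (p≤q⇒0≤q-p (W-lower i)) (0≤½)) (*-nonneg (*-nonneg (*-nonneg (p≤q⇒0≤q-p 2s≤j) 0≤½) 0≤½) 0≤½))
            (solve 4 (λ w i x y → w := (i :+ x) :* con ½ :* con ½ :* con ½ :+
              (((w :+ w :+ y) :- i :* con ½) :* con ½ :+ ((i :+ x) :- ((x :+ (y :+ y)) :+ (x :+ (y :+ y)))) :* con ½ :* con ½ :* con ½)) refl w ⌜ i ⌝ x y))
            where
            0≤½ : 0ℚ ≤ ½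
            0≤½ = nonNegative⁻¹ ½

  density : (em : ExcludedMiddle 0ℓ) (Bad : ℕ → Set) (bad⇒prime : ∀ {p} → Bad p → Prime p) →
    (let open Sieve em Bad bad⇒prime using (Good)) →
    ∀ {q} → (∀ N → ∑ N (λ p → 𝟙 (em {Bad p}) * inv p) ≤ q) →
    (χ : ℕ → ℚ) → (∀ n → 0ℚ ≤ χ n) → (∀ n .{{_ : NonZero n}} → Good n → Good (2 ℕ.+ n) → 1ℚ ≤ χ n) →
    ∃ λ c → 0ℚ < c × ∃ λ j₀ → ∀ j → j₀ ℕ.≤ j → ⌜ j ⌝ * c ≤ ∑ (2 ℕ.^ j) (λ n → χ n * inv n)
  density em Bad bad⇒prime bounded = Density.density-beyond em Bad bad⇒prime (8 ℕ.+ proj₁ tail) (ℕ.m≤m+n 8 (proj₁ tail)) (proj₂ tail)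
    where
    β : ℕ → ℚ
    β p = 𝟙 (em {Bad p}) * inv p

    -- The first 8 terms are cut off beforehand, so that the starting point 8 + P of the tail meets
    -- the requirement 8 ≤ P of `Density`.
    tail : ∃ λ P → ∀ R → ∑ R (λ i → β (8 ℕ.+ (P ℕ.+ i))) ≤ ½ * ½ * ½
    tail = ∑-tail em (β ∘ (8 ℕ.+_)) (λ N → ≤-trans (≤-by-difference (∑ 8 β)
        (∑-nonneg 8 {β} (λ p → *-nonneg (0≤𝟙 (em {Bad p})) (0≤inv p)))
        (trans (∑-split 8 N β) (+-comm (∑ 8 β) _))) (bounded (8 ℕ.+ N)))
      (positive⁻¹ (½ * ½ * ½))

open import Defs
open import Level using (0ℓ)
open import Axiom.ExcludedMiddle using (ExcludedMiddle)
open import Data.Nat.Base using (ℕ; NonZero) renaming (_+_ to _+ℕ_)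
open import Data.Nat.Primality using (Prime)
open import Data.Product.Base using (∃; _×_)
open import Data.Sum.Base using (_⊎_)
open import Relation.Nullary.Negation.Core using (¬_)

open Rationals
open Sieving
open import Data.Integer.Base as ℤ using ()
open import Data.List.Base using ([]; _∷_)
open import Data.List.Relation.Unary.All using (_∷_)
open import Data.Nat.Base as ℕ using (zero; suc; _!; 2+)
open import Data.Nat.Coprimality as Coprimality using (coprime⇒gcd≡1)
open import Data.Nat.Divisibility using (_∣_; divides; ∣-trans; m∣m*n; n∣m*n; *-monoˡ-∣)
open import Data.Nat.Induction using (<-rec)
open import Data.Nat.Primality using (prime⇒nonZero; prime⇒nonTrivial)
open import Data.Nat.Primality.Factorisation using (factorise)
import Data.Nat.Properties as ℕ
open import Data.Product.Base using (_,_; proj₁; proj₂; Σ)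
open import Data.Rational.Base as ℚ using (ℚ; 0ℚ; 1ℚ; ½)
import Data.Rational.Properties as ℚ
open import Data.Rational.Solver using (module +-*-Solver)
open import Data.Sum.Base using (inj₁; inj₂)
open import Relation.Binary.PropositionalEquality
open import Relation.Nullary.Decidable.Core using (Dec; yes; no)
open import Relation.Nullary.Negation.Core using (contradiction)
open +-*-Solver using (solve; _:=_; _:+_; _:*_; _:-_; :-_; con)

-- Real numbers of absolute value 1

≤⊔ˡ : ∀ {k} m n → m ℕ.⊔ n ℕ.≤ k → m ℕ.≤ k
≤⊔ˡ m n = ℕ.m⊔n≤o⇒m≤o m n

≤⊔ʳ : ∀ {k} m n → m ℕ.⊔ n ℕ.≤ k → n ℕ.≤ k
≤⊔ʳ m n = ℕ.m⊔n≤o⇒n≤o m n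

half-bounds : ∀ {p q ε} → p ℚ.< ε ℚ.* ½ → q ℚ.< ε ℚ.* ½ → p ℚ.+ q ℚ.< ε
half-bounds {p} {q} {ε} h₁ h₂ = subst (p ℚ.+ q ℚ.<_) (half+half ε) (ℚ.+-mono-< h₁ h₂)

≃-sym : ∀ {x y} → x ≃ y → y ≃ x
≃-sym {x} {y} h ε 0<ε with h ε 0<ε
... | N , close = N , λ n N≤n → subst (ℚ._< ε) (∣-∣-sym (seq x n) (seq y n)) (close n N≤n)

≃-trans : ∀ {x y z} → x ≃ y → y ≃ z → x ≃ z
≃-trans {x} {y} {z} h₁ h₂ ε 0<ε with h₁ (ε ℚ.* ½) (half-pos 0<ε) | h₂ (ε ℚ.* ½) (half-pos 0<ε)
... | M , close₁ | N , close₂ = M ℕ.⊔ N , λ n le →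
      ℚ.≤-<-trans (∣-∣-triangle (seq x n) (seq y n) (seq z n))
        (half-bounds (close₁ n (≤⊔ˡ M N le)) (close₂ n (≤⊔ʳ M N le)))

∣p∣-∣q∣≤∣p-q∣ : ∀ p q → ℚ.∣ p ∣ ℚ.- ℚ.∣ q ∣ ℚ.≤ ℚ.∣ p ℚ.- q ∣
∣p∣-∣q∣≤∣p-q∣ p q = subst₂ ℚ._≤_
  (cong (λ t → ℚ.∣ t ∣ ℚ.- ℚ.∣ q ∣) (solve 2 (λ p q → (p :- q) :+ q := p) refl p q))
  (solve 2 (λ x y → x :+ y :- y := x) refl ℚ.∣ p ℚ.- q ∣ ℚ.∣ q ∣)
  (ℚ.+-monoˡ-≤ (ℚ.- ℚ.∣ q ∣) (ℚ.∣p+q∣≤∣p∣+∣q∣ (p ℚ.- q) q))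

∣∣p∣-∣q∣∣≤∣p-q∣ : ∀ p q → ℚ.∣ ℚ.∣ p ∣ ℚ.- ℚ.∣ q ∣ ∣ ℚ.≤ ℚ.∣ p ℚ.- q ∣
∣∣p∣-∣q∣∣≤∣p-q∣ p q = ∣p∣≤ (∣p∣-∣q∣≤∣p-q∣ p q) (subst₂ ℚ._≤_
  (solve 2 (λ x y → y :- x := :- (x :- y)) refl ℚ.∣ p ∣ ℚ.∣ q ∣) (∣-∣-sym q p) (∣p∣-∣q∣≤∣p-q∣ q p))

Unit : ℝ → Set
Unit x = ∣ x ∣ ≃ 1ℝ

≃1⇒unit : ∀ {x} → x ≃ 1ℝ → Unit x
≃1⇒unit {x} h ε 0<ε with h ε 0<ε
... | N , close = N , λ n N≤n → ℚ.≤-<-trans (∣∣p∣-∣q∣∣≤∣p-q∣ (seq x n) 1ℚ) (close n N≤n)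

unit-* : ∀ {x y z} → Unit x → Unit y → z ≃ x * y → Unit z
unit-* {x} {y} {z} ux uy z≃xy = ≃-trans {∣ z ∣} {∣ x * y ∣} {1ℝ} abs-cong unit-product
  where
  abs-cong : ∣ z ∣ ≃ ∣ x * y ∣
  abs-cong ε 0<ε with z≃xy ε 0<ε
  ... | N , close = N , λ n N≤n → ℚ.≤-<-trans (∣∣p∣-∣q∣∣≤∣p-q∣ (seq z n) (seq x n ℚ.* seq y n)) (close n N≤n)

  -- pq - 1 = (p - 1) q + (q - 1) with |q| ≤ 2, whence the tolerances ε/4 and ε/2.
  product-bound : ∀ p q {ε} → 0ℚ ℚ.< ε → ℚ.∣ q ℚ.- 1ℚ ∣ ℚ.< 1ℚ → ℚ.∣ p ℚ.- 1ℚ ∣ ℚ.< ε ℚ.* ½ ℚ.* ½ →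
    ℚ.∣ q ℚ.- 1ℚ ∣ ℚ.< ε ℚ.* ½ → ℚ.∣ p ℚ.* q ℚ.- 1ℚ ∣ ℚ.< ε
  product-bound p q {ε} 0<ε q<2 hp hq = ℚ.≤-<-trans
    (subst (λ t → ℚ.∣ t ∣ ℚ.≤ ℚ.∣ (p ℚ.- 1ℚ) ℚ.* q ∣ ℚ.+ ℚ.∣ q ℚ.- 1ℚ ∣)
      (solve 2 (λ p q → (p :- con 1ℚ) :* q :+ (q :- con 1ℚ) := p :* q :- con 1ℚ) refl p q)
      (ℚ.∣p+q∣≤∣p∣+∣q∣ ((p ℚ.- 1ℚ) ℚ.* q) (q ℚ.- 1ℚ)))
    (subst (ℚ.∣ (p ℚ.- 1ℚ) ℚ.* q ∣ ℚ.+ ℚ.∣ q ℚ.- 1ℚ ∣ ℚ.<_) (half+half ε) (ℚ.+-mono-≤-< first hq))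
    where
    ∣q∣≤2 : ℚ.∣ q ∣ ℚ.≤ 1ℚ ℚ.+ 1ℚ
    ∣q∣≤2 = ℚ.≤-trans (subst (λ t → ℚ.∣ t ∣ ℚ.≤ ℚ.∣ q ℚ.- 1ℚ ∣ ℚ.+ 1ℚ)
      (solve 1 (λ q → (q :- con 1ℚ) :+ con 1ℚ := q) refl q) (ℚ.∣p+q∣≤∣p∣+∣q∣ (q ℚ.- 1ℚ) 1ℚ))
      (ℚ.+-monoˡ-≤ 1ℚ (ℚ.<⇒≤ q<2))
    first : ℚ.∣ (p ℚ.- 1ℚ) ℚ.* q ∣ ℚ.≤ ε ℚ.* ½
    first = ℚ.≤-trans (ℚ.≤-reflexive (ℚ.∣p*q∣≡∣p∣*∣q∣ (p ℚ.- 1ℚ) q))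
      (ℚ.≤-trans (*-mono (ℚ.0≤∣p∣ (p ℚ.- 1ℚ)) (0≤⌜⌝ 2) (ℚ.<⇒≤ hp) ∣q∣≤2)
        (ℚ.≤-reflexive (solve 1 (λ e → e :* con ½ :* con ½ :* (con 1ℚ :+ con 1ℚ) := e :* con ½) refl ε)))

  unit-product : ∣ x * y ∣ ≃ 1ℝ
  unit-product ε 0<ε =
    let
      (K , hx) = ux (ε ℚ.* ½ ℚ.* ½) (half-pos (half-pos 0<ε))
      (M , hy) = uy (ε ℚ.* ½) (half-pos 0<ε)
      (N , h1) = uy 1ℚ (ℚ.positive⁻¹ 1ℚ)
    in K ℕ.⊔ (M ℕ.⊔ N) , λ n le → let le′ = ≤⊔ʳ K (M ℕ.⊔ N) le in
      subst (λ t → ℚ.∣ t ℚ.- 1ℚ ∣ ℚ.< ε) (sym (ℚ.∣p*q∣≡∣p∣*∣q∣ (seq x n) (seq y n)))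
        (product-bound ℚ.∣ seq x n ∣ ℚ.∣ seq y n ∣ 0<ε (h1 n (≤⊔ʳ M N le′)) (hx n (≤⊔ˡ K (M ℕ.⊔ N) le)) (hy n (≤⊔ˡ M N le′)))

-- Past K the terms differ from x_K by less than 1/2, while |x_K| > 1/2. So the sign of the rational
-- x_K is that of all later terms, and |x_n| → 1 fixes the limit.
unit-sign : ∀ {x} → Unit x → x ≃ 1ℝ ⊎ x ≃ - 1ℝ
unit-sign {x} ux with ux ½ (ℚ.positive⁻¹ ½) | cauchy x ½ (ℚ.positive⁻¹ ½)
... | M , near | N , cau = by-sign (ℚ.≤-total 0ℚ (seq x K))
  where
  K = M ℕ.⊔ N
  bounds : ∀ p q {r} → ℚ.∣ p ℚ.- q ∣ ℚ.< r → p ℚ.< q ℚ.+ r × q ℚ.< p ℚ.+ r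
  bounds p q {r} h =
    subst (ℚ._< q ℚ.+ r) (solve 2 (λ p q → q :+ (p :- q) := p) refl p q)
      (ℚ.+-monoʳ-< q (ℚ.≤-<-trans (p≤∣p∣ (p ℚ.- q)) h)) ,
    subst (ℚ._< p ℚ.+ r) (solve 2 (λ p q → p :+ (:- (p :- q)) := q) refl p q)
      (ℚ.+-monoʳ-< p (ℚ.≤-<-trans (-p≤∣p∣ (p ℚ.- q)) h))
  ½<∣xK∣ : ½ ℚ.< ℚ.∣ seq x K ∣
  ½<∣xK∣ = subst₂ ℚ._<_ refl (solve 1 (λ t → t :+ con ½ :- con ½ := t) refl ℚ.∣ seq x K ∣)
    (ℚ.+-monoˡ-< (ℚ.- ½) (proj₂ (bounds ℚ.∣ seq x K ∣ 1ℚ (near K (ℕ.m≤m⊔n M N)))))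
  by-sign : 0ℚ ℚ.≤ seq x K ⊎ seq x K ℚ.≤ 0ℚ → x ≃ 1ℝ ⊎ x ≃ - 1ℝ
  by-sign (inj₁ 0≤xK) = inj₁ λ ε 0<ε → let (N₁ , h) = ux ε 0<ε in K ℕ.⊔ N₁ , λ n le →
    subst (λ t → ℚ.∣ t ℚ.- 1ℚ ∣ ℚ.< ε) (ℚ.0≤p⇒∣p∣≡p (nonneg n (≤⊔ˡ K N₁ le))) (h n (≤⊔ʳ K N₁ le))
    where
    nonneg : ∀ n → K ℕ.≤ n → 0ℚ ℚ.≤ seq x n
    nonneg n K≤n = ℚ.<⇒≤ (subst₂ ℚ._<_ (ℚ.+-inverseʳ ½) (solve 1 (λ t → t :+ con ½ :- con ½ := t) refl (seq x n))
      (ℚ.+-monoˡ-< (ℚ.- ½) (ℚ.<-trans (subst (½ ℚ.<_) (ℚ.0≤p⇒∣p∣≡p 0≤xK) ½<∣xK∣)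
        (proj₁ (bounds (seq x K) (seq x n) (cau K n (ℕ.m≤n⊔m M N) (≤⊔ʳ M N K≤n)))))))
  by-sign (inj₂ xK≤0) = inj₂ λ ε 0<ε → let (N₁ , h) = ux ε 0<ε in K ℕ.⊔ N₁ , λ n le →
    subst (ℚ._< ε) (trans (cong (λ t → ℚ.∣ t ℚ.- 1ℚ ∣) (∣∣-neg (nonpos n (≤⊔ˡ K N₁ le))))
        (trans (∣-∣-sym (ℚ.- seq x n) 1ℚ) (cong ℚ.∣_∣ (solve 1 (λ t → con 1ℚ :- (:- t) := t :- (:- con 1ℚ)) refl (seq x n)))))
      (h n (≤⊔ʳ K N₁ le))
    where
    ∣∣-neg : ∀ {p} → p ℚ.≤ 0ℚ → ℚ.∣ p ∣ ≡ ℚ.- p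
    ∣∣-neg {p} p≤0 = trans (sym (ℚ.∣-p∣≡∣p∣ p)) (ℚ.0≤p⇒∣p∣≡p (ℚ.neg-antimono-≤ p≤0))
    nonpos : ∀ n → K ℕ.≤ n → seq x n ℚ.≤ 0ℚ
    nonpos n K≤n = ℚ.<⇒≤ (ℚ.<-trans (proj₁ (bounds (seq x n) (seq x K) (cau n K (≤⊔ʳ M N K≤n) (ℕ.m≤n⊔m M N))))
      (subst (seq x K ℚ.+ ½ ℚ.<_) (ℚ.+-inverseʳ (seq x K)) (ℚ.+-monoʳ-< (seq x K) (subst (½ ℚ.<_) (∣∣-neg xK≤0) ½<∣xK∣))))

unit-ratio : ∀ {x y} → Unit x → Unit y → x ≃ 1ℝ * y ⊎ x ≃ - 1ℝ * y
unit-ratio {x} {y} ux uy with unit-sign {x} ux | unit-sign {y} uy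
... | inj₁ hx | inj₁ hy = inj₁ (≃-trans {x} {1ℝ} {1ℝ * y} hx λ ε 0<ε → let (N , h) = hy ε 0<ε in N , λ n le →
        subst (ℚ._< ε) (trans (∣-∣-sym (seq y n) 1ℚ) (cong (λ t → ℚ.∣ 1ℚ ℚ.- t ∣) (sym (ℚ.*-identityˡ (seq y n))))) (h n le))
... | inj₂ hx | inj₂ hy = inj₁ (≃-trans {x} { - 1ℝ} {1ℝ * y} hx λ ε 0<ε → let (N , h) = hy ε 0<ε in N , λ n le →
        subst (ℚ._< ε) (trans (∣-∣-sym (seq y n) (ℚ.- 1ℚ)) (cong (λ t → ℚ.∣ ℚ.- 1ℚ ℚ.- t ∣) (sym (ℚ.*-identityˡ (seq y n))))) (h n le))
... | inj₁ hx | inj₂ hy = inj₂ (≃-trans {x} {1ℝ} { - 1ℝ * y} hx λ ε 0<ε → let (N , h) = hy ε 0<ε in N , λ n le →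
        subst (ℚ._< ε) (cong ℚ.∣_∣ (solve 1 (λ t → t :- (:- con 1ℚ) := con 1ℚ :- (:- con 1ℚ) :* t) refl (seq y n))) (h n le))
... | inj₂ hx | inj₁ hy = inj₂ (≃-trans {x} { - 1ℝ} { - 1ℝ * y} hx λ ε 0<ε → let (N , h) = hy ε 0<ε in N , λ n le →
        subst (ℚ._< ε) (cong ℚ.∣_∣ (solve 1 (λ t → t :- con 1ℚ := (:- con 1ℚ) :- (:- con 1ℚ) :* t) refl (seq y n))) (h n le))

-- The exponential of a Cauchy sequence

eventually-bounded : (y : ℝ) → ∃ λ B → ∃ λ N → ∀ n → N ℕ.≤ n → ℚ.∣ seq y n ∣ ℚ.≤ ⌜ B ⌝
eventually-bounded y with cauchy y 1ℚ (ℚ.positive⁻¹ 1ℚ)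
... | N , h with archimedean (1ℚ ℚ.+ ℚ.∣ seq y N ∣)
...   | B , 1+∣yN∣<B = B , N , λ n N≤n → ℚ.≤-trans
        (subst (λ t → ℚ.∣ t ∣ ℚ.≤ ℚ.∣ seq y n ℚ.- seq y N ∣ ℚ.+ ℚ.∣ seq y N ∣)
          (solve 2 (λ p q → (p :- q) :+ q := p) refl (seq y n) (seq y N)) (ℚ.∣p+q∣≤∣p∣+∣q∣ (seq y n ℚ.- seq y N) (seq y N)))
        (ℚ.≤-trans (ℚ.+-monoˡ-≤ ℚ.∣ seq y N ∣ (ℚ.<⇒≤ (h n N N≤n ℕ.≤-refl))) (ℚ.<⇒≤ 1+∣yN∣<B))

-- A concrete representative of `exp`, whose definition as a chosen limit reveals no sequence: the
-- diagonal of truncations of length n at the n-th approximation.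
Exp : ℝ → ℝ
Exp y = mkℝ (λ n → expΣ n (seq y n)) is-cauchy
  where
  B = proj₁ (eventually-bounded y)
  N₁ = proj₁ (proj₂ (eventually-bounded y))
  bounded = proj₂ (proj₂ (eventually-bounded y))
  is-cauchy : IsCauchy (λ n → expΣ n (seq y n))
  is-cauchy ε 0<ε = N , λ m n lm ln →
    proj₂ (proj₂ (proj₂ continuous)) (≤⊔ˡ N₂ N₃ (≤⊔ʳ N₁ (N₂ ℕ.⊔ N₃) lm)) (≤⊔ˡ N₂ N₃ (≤⊔ʳ N₁ (N₂ ℕ.⊔ N₃) ln))
      (bounded m (≤⊔ˡ N₁ (N₂ ℕ.⊔ N₃) lm)) (bounded n (≤⊔ˡ N₁ (N₂ ℕ.⊔ N₃) ln))
      (proj₂ cau m n (≤⊔ʳ N₂ N₃ (≤⊔ʳ N₁ (N₂ ℕ.⊔ N₃) lm)) (≤⊔ʳ N₂ N₃ (≤⊔ʳ N₁ (N₂ ℕ.⊔ N₃) ln)))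
    where
    continuous = expΣ-continuous B 0<ε
    N₂ = proj₁ continuous
    cau = cauchy y (proj₁ (proj₂ continuous)) (proj₁ (proj₂ (proj₂ continuous)))
    N₃ = proj₁ cau
    N = N₁ ℕ.⊔ (N₂ ℕ.⊔ N₃)

limit-unique : ∀ {s ℓ ℓ′} → s ⟶ ℓ → s ⟶ ℓ′ → ℓ ≃ ℓ′
limit-unique {s} {ℓ} {ℓ′} h h′ ε 0<ε =
  let
    ε/2>0 : 0ℝ < fromℚ (ε ℚ.* ½)
    ε/2>0 = ε ℚ.* ½ , half-pos 0<ε , 0 , λ _ _ → ℚ.≤-reflexive (ℚ.+-identityˡ (ε ℚ.* ½))
    (N , c) = h (fromℚ (ε ℚ.* ½)) ε/2>0
    (N′ , c′) = h′ (fromℚ (ε ℚ.* ½)) ε/2>0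
    n = N ℕ.⊔ N′
    (δ , 0<δ , M , close) = c n (ℕ.m≤m⊔n N N′)
    (δ′ , 0<δ′ , M′ , close′) = c′ n (ℕ.m≤n⊔m N N′)
  in M ℕ.⊔ M′ , λ i le → ℚ.≤-<-trans (∣-∣-triangle (seq ℓ i) (seq (s n) i) (seq ℓ′ i))
       (half-bounds
         (subst (ℚ._< ε ℚ.* ½) (∣-∣-sym (seq (s n) i) (seq ℓ i)) (strict 0<δ (close i (≤⊔ˡ M M′ le))))
         (strict 0<δ′ (close′ i (≤⊔ʳ M M′ le))))
  where
  strict : ∀ {p δ q} → 0ℚ ℚ.< δ → p ℚ.+ δ ℚ.≤ q → p ℚ.< q
  strict {p} {δ} 0<δ le = ℚ.<-≤-trans (subst (ℚ._< p ℚ.+ δ) (ℚ.+-identityʳ p) (ℚ.+-monoʳ-< p 0<δ)) le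

-- The gap of `x < w` pays for the distance between x and y; a strict inequality of terms remains,
-- enough to compare with rationals.
<-resp-≃ : ∀ {x y w} → x ≃ y → x < w → ∃ λ N → ∀ n → N ℕ.≤ n → seq y n ℚ.< seq w n
<-resp-≃ {x} {y} {w} x≃y (ε , 0<ε , N , h) with x≃y ε 0<ε
... | M , close = M ℕ.⊔ N , λ n le → ℚ.<-≤-trans
      (subst (ℚ._< seq x n ℚ.+ ε) (solve 2 (λ x y → x :+ (:- (x :- y)) := y) refl (seq x n) (seq y n))
        (ℚ.+-monoʳ-< (seq x n) (ℚ.≤-<-trans (-p≤∣p∣ (seq x n ℚ.- seq y n)) (close n (≤⊔ˡ M N le)))))
      (h n (≤⊔ʳ M N le))

1/n≡inv : ∀ n .{{_ : NonZero n}} → ℤ.+ 1 ℚ./ n ≡ inv n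
1/n≡inv (suc n) = refl

-- Logarithm, reciprocal and floor

module Elementary (em : ExcludedMiddle 0ℓ) where
  open Classical em

  -- The only access to the limit, the logarithm, the reciprocal and the floor: each use needs a
  -- witness of existence first.
  the-satisfies : ∀ {A : Set} (P : A → Set) {d : A} → ∃ P → P (the d P)
  the-satisfies {A} P h with em {Σ A P}
  ... | yes (_ , p) = p
  ... | no ¬h       = contradiction h ¬h

  seq-^ : ∀ y k i → seq (y ^ k) i ≡ pow (seq y i) k
  seq-^ y zero    i = refl
  seq-^ y (suc k) i = cong (seq y i ℚ.*_) (seq-^ y k i)

  seq-expPartial : ∀ y n i → seq (expPartial y n) i ≡ expΣ n (seq y i)
  seq-expPartial y zero    i = refl
  seq-expPartial y (suc n) i = cong₂ ℚ._+_ (seq-expPartial y n i)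
    (cong₂ ℚ._*_ (seq-^ y n i) (1/n≡inv (n !) {{n ℕ.!≢0}}))

  expPartial⟶Exp : ∀ y → expPartial y ⟶ Exp y
  expPartial⟶Exp y ε (ε₀ , 0<ε₀ , N₀ , h) =
    let
      (B , N₁ , bounded) = eventually-bounded y
      open Bounded B
      (N₂ , 2B≤N₂ , τ<) = τ→0 (half-pos 0<ε₀)
    -- For i ≥ n both terms are truncations at the same rational y_i, so `expΣ-Cauchy` applies; half
    -- of ε₀ is kept as the gap that `_<_` on reals requires.
    in N₂ , λ n N₂≤n → ε₀ ℚ.* ½ , half-pos 0<ε₀ , N₀ ℕ.⊔ (N₁ ℕ.⊔ n) , λ i le →
      let
        le′ = ≤⊔ʳ N₀ (N₁ ℕ.⊔ n) le
        open ℚ.≤-Reasoning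
      in begin
        ℚ.∣ seq (expPartial y n) i ℚ.- expΣ i (seq y i) ∣ ℚ.+ ε₀ ℚ.* ½
          ≡⟨ cong (λ t → t ℚ.+ ε₀ ℚ.* ½) (trans (cong (λ t → ℚ.∣ t ℚ.- expΣ i (seq y i) ∣) (seq-expPartial y n i)) (∣-∣-sym (expΣ n (seq y i)) (expΣ i (seq y i)))) ⟩
        ℚ.∣ expΣ i (seq y i) ℚ.- expΣ n (seq y i) ∣ ℚ.+ ε₀ ℚ.* ½
          ≤⟨ ℚ.+-monoˡ-≤ (ε₀ ℚ.* ½) (ℚ.≤-trans (expΣ-Cauchy (bounded i (≤⊔ˡ N₁ n le′)) (ℕ.≤-trans 2B≤N₂ N₂≤n) (≤⊔ʳ N₁ n le′)) (ℚ.<⇒≤ (τ< n N₂≤n))) ⟩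
        ε₀ ℚ.* ½ ℚ.+ ε₀ ℚ.* ½
          ≡⟨ trans (half+half ε₀) (sym (ℚ.+-identityˡ ε₀)) ⟩
        0ℚ ℚ.+ ε₀
          ≤⟨ h i (≤⊔ˡ N₀ (N₁ ℕ.⊔ n) le) ⟩
        seq ε i ∎

  exp≃Exp : ∀ y → exp y ≃ Exp y
  exp≃Exp y = limit-unique {expPartial y} {exp y} {Exp y} (the-satisfies (expPartial y ⟶_) (Exp y , expPartial⟶Exp y)) (expPartial⟶Exp y)

  Exp-injective : ∀ {y} m .{{_ : NonZero m}} → Exp y ≃ Exp (fromℕ m) → y ≃ fromℕ m
  Exp-injective {y} m h ε 0<ε =
    let
      (B , N₁ , bounded) = eventually-bounded y
      (N₂ , separated) = expΣ-injective B ⌜ m ⌝ 0<δ δ≤m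
      (N₃ , close) = h (δ ℚ.* ½) (half-pos 0<δ)
      (N₄ , cau) = cauchy y δ 0<δ
    in (N₁ ℕ.⊔ N₂) ℕ.⊔ (N₃ ℕ.⊔ N₄) , λ n le →
      let
        le₁ = ≤⊔ˡ (N₁ ℕ.⊔ N₂) (N₃ ℕ.⊔ N₄) le
        le₂ = ≤⊔ʳ (N₁ ℕ.⊔ N₂) (N₃ ℕ.⊔ N₄) le
        n≤2n = ℕ.m≤m+n n n
        2n = n ℕ.+ n
      -- `expΣ-injective` speaks of even lengths, so y is compared with m at index 2n; the Cauchy
      -- property leads back to n.
      in ℚ.<-≤-trans (ℚ.≤-<-trans (∣-∣-triangle (seq y n) (seq y 2n) ⌜ m ⌝)
        (half-bounds {ε = ε ℚ.⊓ 1ℚ} (cau n 2n (≤⊔ʳ N₃ N₄ le₂) (ℕ.≤-trans (≤⊔ʳ N₃ N₄ le₂) n≤2n))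
          (separated n (≤⊔ʳ N₁ N₂ le₁) (seq y 2n) (bounded 2n (ℕ.≤-trans (≤⊔ˡ N₁ N₂ le₁) n≤2n))
            (close 2n (ℕ.≤-trans (≤⊔ˡ N₃ N₄ le₂) n≤2n))))) (ℚ.p⊓q≤p ε 1ℚ)
    where
    -- The cap at 1 ensures δ ≤ m, as m ≥ 1; the half leaves room for the passage from 2n to n.
    δ = (ε ℚ.⊓ 1ℚ) ℚ.* ½
    0<min : 0ℚ ℚ.< ε ℚ.⊓ 1ℚ
    0<min with ℚ.⊓-sel ε 1ℚ
    ... | inj₁ e = subst (0ℚ ℚ.<_) (sym e) 0<ε
    ... | inj₂ e = subst (0ℚ ℚ.<_) (sym e) (ℚ.positive⁻¹ 1ℚ)
    0<δ = half-pos 0<min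
    δ≤m : δ ℚ.≤ ⌜ m ⌝
    δ≤m = ℚ.≤-trans (half-≤ 0<min) (ℚ.≤-trans (ℚ.p⊓q≤q ε 1ℚ) (⌜⌝-mono (ℕ.>-nonZero⁻¹ m)))

  log-exp : ∀ m .{{_ : NonZero m}} → log (exp (fromℕ m)) ≃ fromℕ m
  log-exp m = Exp-injective {y} m (≃-trans {Exp y} {x} {Exp (fromℕ m)}
      (≃-trans {Exp y} {exp y} {x} (≃-sym {exp y} {Exp y} (exp≃Exp y)) (the-satisfies (λ z → exp z ≃ x) (fromℕ m , λ ε 0<ε → 0 , λ n _ →
        subst (λ t → ℚ.∣ t ∣ ℚ.< ε) (sym (ℚ.+-inverseʳ (seq x n))) 0<ε)))
      (exp≃Exp (fromℕ m)))
    where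
    x = exp (fromℕ m)
    y = log x

  -- Eventually y is at most m + 1 and its product with the reciprocal exceeds 1/2. The constant
  -- factor lost does not affect positivity of the limsup.
  ⁻¹-lower : ∀ {y} m .{{_ : NonZero m}} → y ≃ fromℕ m →
             ∃ λ N → ∀ n → N ℕ.≤ n → inv (2 ℕ.* suc m) ℚ.≤ seq (y ⁻¹) n
  ⁻¹-lower {y} m y≃m =
    let
      (M , near) = y≃m 1ℚ (ℚ.positive⁻¹ 1ℚ)
      (N , unit) = inverse ½ (ℚ.positive⁻¹ ½)
    in M ℕ.⊔ N , λ n le → bound (seq y n) (seq (y ⁻¹) n) (near n (≤⊔ˡ M N le)) (unit n (≤⊔ʳ M N le))
    where
    -- The chosen reciprocal has its property once some inverse is exhibited; 1/m is one.
    inv-m : y * fromℚ (inv m) ≃ 1ℝ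
    inv-m ε 0<ε with y≃m ε 0<ε
    ... | N , close = N , λ n le → ℚ.≤-<-trans (begin
            ℚ.∣ seq y n ℚ.* inv m ℚ.- 1ℚ ∣
              ≡⟨ cong (λ t → ℚ.∣ seq y n ℚ.* inv m ℚ.- t ∣) (trans (sym (inv-* m)) (ℚ.*-comm (inv m) ⌜ m ⌝)) ⟩
            ℚ.∣ seq y n ℚ.* inv m ℚ.- ⌜ m ⌝ ℚ.* inv m ∣
              ≡⟨ cong ℚ.∣_∣ (solve 3 (λ y m i → y :* i :- m :* i := (y :- m) :* i) refl (seq y n) ⌜ m ⌝ (inv m)) ⟩
            ℚ.∣ (seq y n ℚ.- ⌜ m ⌝) ℚ.* inv m ∣
              ≡⟨ trans (ℚ.∣p*q∣≡∣p∣*∣q∣ (seq y n ℚ.- ⌜ m ⌝) (inv m)) (cong (ℚ.∣ seq y n ℚ.- ⌜ m ⌝ ∣ ℚ.*_) (ℚ.0≤p⇒∣p∣≡p (0≤inv m))) ⟩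
            ℚ.∣ seq y n ℚ.- ⌜ m ⌝ ∣ ℚ.* inv m
              ≤⟨ *-monoʳ ℚ.∣ seq y n ℚ.- ⌜ m ⌝ ∣ (ℚ.0≤∣p∣ _) (inv-antimono {1} {m} (ℕ.>-nonZero⁻¹ m)) ⟩
            ℚ.∣ seq y n ℚ.- ⌜ m ⌝ ∣ ℚ.* 1ℚ
              ≡⟨ ℚ.*-identityʳ _ ⟩
            ℚ.∣ seq y n ℚ.- ⌜ m ⌝ ∣ ∎) (close n le)
      where open ℚ.≤-Reasoning
    inverse : y * y ⁻¹ ≃ 1ℝ
    inverse = the-satisfies (λ z → y * z ≃ 1ℝ) (fromℚ (inv m) , inv-m)
    bound : ∀ p z → ℚ.∣ p ℚ.- ⌜ m ⌝ ∣ ℚ.< 1ℚ → ℚ.∣ p ℚ.* z ℚ.- 1ℚ ∣ ℚ.< ½ → inv (2 ℕ.* suc m) ℚ.≤ z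
    bound p z near unit = ℚ.≮⇒≥ λ z<i → ℚ.<-irrefl refl (ℚ.<-≤-trans ½<pz (begin
        p ℚ.* z                                  ≤⟨ *-monoʳ p 0≤p (ℚ.<⇒≤ z<i) ⟩
        p ℚ.* inv (2 ℕ.* suc m)                  ≤⟨ *-monoˡ (inv (2 ℕ.* suc m)) (0≤inv (2 ℕ.* suc m)) p≤1+m ⟩
        ⌜ suc m ⌝ ℚ.* inv (2 ℕ.* suc m)          ≡⟨ cong (⌜ suc m ⌝ ℚ.*_) (inv-*-homo 2 (suc m)) ⟩
        ⌜ suc m ⌝ ℚ.* (½ ℚ.* inv (suc m))        ≡⟨ solve 3 (λ a h i → a :* (h :* i) := h :* (i :* a)) refl ⌜ suc m ⌝ ½ (inv (suc m)) ⟩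
        ½ ℚ.* (inv (suc m) ℚ.* ⌜ suc m ⌝)        ≡⟨ trans (cong (½ ℚ.*_) (inv-* (suc m))) (ℚ.*-identityʳ ½) ⟩
        ½                                        ∎))
      where
      open ℚ.≤-Reasoning
      p≤1+m : p ℚ.≤ ⌜ suc m ⌝
      p≤1+m = subst₂ ℚ._≤_ (solve 2 (λ p m → (p :- m) :+ m := p) refl p ⌜ m ⌝) (sym (⌜+⌝ 1 m))
        (ℚ.+-monoˡ-≤ ⌜ m ⌝ (ℚ.<⇒≤ (ℚ.≤-<-trans (p≤∣p∣ (p ℚ.- ⌜ m ⌝)) near)))
      0≤p : 0ℚ ℚ.≤ p
      0≤p = ≤-by-difference ((1ℚ ℚ.+ (p ℚ.- ⌜ m ⌝)) ℚ.+ (⌜ m ⌝ ℚ.- 1ℚ))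
        (+-nonneg (subst₂ ℚ._≤_ (ℚ.+-inverseˡ (p ℚ.- ⌜ m ⌝)) refl (ℚ.+-monoˡ-≤ (p ℚ.- ⌜ m ⌝)
            (ℚ.<⇒≤ (ℚ.≤-<-trans (-p≤∣p∣ (p ℚ.- ⌜ m ⌝)) near)))) (p≤q⇒0≤q-p (⌜⌝-mono (ℕ.>-nonZero⁻¹ m))))
        (solve 2 (λ p m → p := con 0ℚ :+ ((con 1ℚ :+ (p :- m)) :+ (m :- con 1ℚ))) refl p ⌜ m ⌝)
      ½<pz : ½ ℚ.< p ℚ.* z
      ½<pz = subst₂ ℚ._<_ (solve 1 (λ t → (con 1ℚ :- t :+ (t :- con ½)) := con ½) refl (p ℚ.* z))
        (solve 1 (λ t → con ½ :+ (t :- con ½) := t) refl (p ℚ.* z))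
        (ℚ.+-monoˡ-< (p ℚ.* z ℚ.- ½) (subst (ℚ._< ½) (solve 1 (λ t → :- (t :- con 1ℚ) := con 1ℚ :- t) refl (p ℚ.* z))
          (ℚ.≤-<-trans (-p≤∣p∣ (p ℚ.* z ℚ.- 1ℚ)) unit)))

  -- Descent from an upper bound B + 1 by excluded middle; `0ℝ ≤ x` rules out reaching 0.
  floor : ∀ {x} → 0ℝ ≤ x → fromℕ ⌊ x ⌋ ≤ x × x < fromℕ (suc ⌊ x ⌋)
  floor {x} 0≤x = the-satisfies (λ n → fromℕ n ≤ x × x < fromℕ (suc n)) (search (suc B) (1ℚ , ℚ.positive⁻¹ 1ℚ , N , λ n N≤n →
      ℚ.≤-trans (ℚ.≤-reflexive (ℚ.+-comm (seq x n) 1ℚ)) (ℚ.≤-trans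
        (ℚ.+-monoʳ-≤ 1ℚ (ℚ.≤-trans (p≤∣p∣ (seq x n)) (bounded n N≤n))) (ℚ.≤-reflexive (sym (⌜+⌝ 1 B))))))
    where
    B = proj₁ (eventually-bounded x)
    N = proj₁ (proj₂ (eventually-bounded x))
    bounded = proj₂ (proj₂ (eventually-bounded x))
    search : ∀ k → x < fromℕ k → ∃ λ n → fromℕ n ≤ x × x < fromℕ (suc n)
    search zero    x<0   = contradiction x<0 0≤x
    search (suc k) x<k+1 = decide em
      where
      decide : Dec (x < fromℕ k) → ∃ λ n → fromℕ n ≤ x × x < fromℕ (suc n)
      decide (yes x<k) = search k x<k
      decide (no k≤x)  = k , k≤x , x<k+1

  module _ (j : ℕ) where
    private
      m : ℕ
      m = j ℕ.+ j

      x : ℝ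
      x = exp (fromℕ m)

      -- The one fact on the size of e^(2j): it yields nonnegativity, the bound on the floor and
      -- that these points exceed any given X.
      above : ∀ {w} → x < w → ∃ λ N → ∀ n → N ℕ.≤ n → ⌜ 2 ℕ.^ j ⌝ ℚ.< seq w n
      above {w} x<w = N ℕ.⊔ suc j , λ n le → ℚ.≤-<-trans (2^≤expΣ j (≤⊔ʳ N (suc j) le)) (proj₂ eventually n (≤⊔ˡ N (suc j) le))
        where
        eventually = <-resp-≃ {x} {Exp (fromℕ m)} {w} (exp≃Exp (fromℕ m)) x<w
        N = proj₁ eventually

      0≤x : 0ℝ ≤ x
      0≤x x<0 = ℚ.<-irrefl refl (ℚ.≤-<-trans (0≤⌜⌝ (2 ℕ.^ j)) (proj₂ (above {0ℝ} x<0) (proj₁ (above {0ℝ} x<0)) ℕ.≤-refl))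

    2^≤floor-exp : 2 ℕ.^ j ℕ.≤ ⌊ exp (fromℕ (j ℕ.+ j)) ⌋
    2^≤floor-exp = ℕ.≤-pred (⌜⌝-cancel-< (proj₂ eventually (proj₁ eventually) ℕ.≤-refl))
      where eventually = above {fromℕ (suc ⌊ x ⌋)} (proj₂ (floor {x} 0≤x))

    ≤exp : ∀ {X} B N → (∀ n → N ℕ.≤ n → ℚ.∣ seq X n ∣ ℚ.≤ ⌜ B ⌝) → B ℕ.≤ j → X ≤ exp (fromℕ (j ℕ.+ j))
    ≤exp {X} B N bounded B≤j x<X = ℕ.<⇒≱ (⌜⌝-cancel-< (ℚ.<-≤-trans (proj₂ (above {X} x<X) (M ℕ.⊔ N) (ℕ.m≤m⊔n M N))
          (ℚ.≤-trans (p≤∣p∣ _) (bounded (M ℕ.⊔ N) (ℕ.m≤n⊔m M N))))) (ℕ.≤-trans B≤j (n≤2^n j))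
      where M = proj₁ (above {X} x<X)

  seq-𝟏 : ∀ P i → seq (𝟏 P) i ≡ 𝟙 (em {P})
  seq-𝟏 P i with em {P}
  ... | yes _ = refl
  ... | no _  = refl

-- Values at good numbers, and the choice of the sign

seq-∑₁ : ∀ N a α i → (∀ n → seq (a (suc n)) i ≡ α (suc n)) → seq (∑₁ N a) i ≡ ∑ N α
seq-∑₁ zero    a α i h = refl
seq-∑₁ (suc N) a α i h = cong₂ ℚ._+_ (seq-∑₁ N a α i h) (h N)

prime-factor : ∀ n → 1 ℕ.< n → ∃ λ p → Prime p × p ∣ n
prime-factor 1 (ℕ.s≤s ())
prime-factor n@(2+ _) _ with factorise n
... | record { factors = [] ; isFactorisation = () }
... | record { factors = p ∷ ps ; isFactorisation = e ; factorsPrime = pp ∷ _ } =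
      p , pp , subst (p ∣_) (sym e) (m∣m*n _)

𝟙-⇔ : ∀ {P Q : Set} (d : Dec P) (e : Dec Q) → (P → Q) → (Q → P) → 𝟙 d ≡ 𝟙 e
𝟙-⇔ (yes p) e f g = sym (𝟙-yes e (f p))
𝟙-⇔ (no ¬p) e f g = sym (𝟙-no e (λ q → ¬p (g q)))

-- A dependent pair, because the primality proof supplies the positivity that `f` demands of its
-- argument.
Bad : Arith → ℕ → Set
Bad f p = Σ (Prime p) λ pp → ¬ Unit (f p {{prime⇒nonZero pp}})

module MatchingSign (em : ExcludedMiddle 0ℓ) (f : Arith) (f-mult : Multiplicative f) where
  open Classical em
  open Elementary em
  open Sieve em (Bad f) proj₁ using (Good)

  -- Strong induction on n = m p with p prime. As p² does not divide n, p does not divide m, so f(n)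
  -- = f(m) f(p); goodness passes to the divisor m.
  good⇒unit : ∀ n .{{_ : NonZero n}} → Good n → Unit (f n)
  good⇒unit n {{n≢0}} = <-rec (λ n → .{{_ : NonZero n}} → Good n → Unit (f n)) step n {{n≢0}}
    where
    step : ∀ n → (∀ {m} → m ℕ.< n → .{{_ : NonZero m}} → Good m → Unit (f m)) → .{{_ : NonZero n}} → Good n → Unit (f n)
    step 1 IH good = ≃1⇒unit {f 1} (proj₁ f-mult)
    step n@(2+ _) IH good with prime-factor n (ℕ.s≤s (ℕ.s≤s ℕ.z≤n))
    ... | p , pp , divides m n≡mp = unit-at n≡mp
      where
      mp≢0 : NonZero (m ℕ.* p)
      mp≢0 = subst NonZero n≡mp _
      instance
        m≢0 : NonZero m
        m≢0 = ℕ.m*n≢0⇒m≢0 m {p} {{mp≢0}}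
        p≢0 : NonZero p
        p≢0 = prime⇒nonZero pp
      p∣n : p ∣ n
      p∣n = subst (p ∣_) (sym n≡mp) (n∣m*n m)
      m∣n : m ∣ n
      m∣n = subst (m ∣_) (sym n≡mp) (m∣m*n p)
      p∤m : ¬ (p ∣ m)
      p∤m p∣m = proj₂ (good p pp p∣n) (subst (p ℕ.* p ∣_) (sym n≡mp) (*-monoˡ-∣ p p∣m))
      m<n : m ℕ.< n
      m<n = subst (m ℕ.<_) (sym n≡mp) (ℕ.m<m*n m p (ℕ.nonTrivial⇒n>1 p {{prime⇒nonTrivial pp}}))
      unit-p : Unit (f p)
      unit-p with em {Unit (f p)}
      ... | yes u = u
      ... | no ¬u = contradiction (pp , ¬u) (proj₁ (good p pp p∣n))
      unit-m : Unit (f m)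
      unit-m = IH m<n (λ r pr r∣m → proj₁ (good r pr (∣-trans r∣m m∣n)) , λ r²∣m → proj₂ (good r pr (∣-trans r∣m m∣n)) (∣-trans r²∣m m∣n))
      -- Generalised over n, so that the equation n = m p can be matched with `refl`.
      unit-at : ∀ {n} → n ≡ m ℕ.* p → .{{_ : NonZero n}} → Unit (f n)
      unit-at refl = unit-* {f m} {f p} {f (m ℕ.* p) {{mp≢0}}} unit-m unit-p
        (proj₂ f-mult m p (coprime⇒gcd≡1 (Coprimality.sym (∤⇒coprime pp p∤m))))

  χ : ℝ → ℕ → ℚ
  χ u zero    = 0ℚ
  χ u (suc n) = 𝟙 (em {f (suc n) ≃ u * f (2 +ℕ suc n)})

  0≤χ : ∀ u n → 0ℚ ℚ.≤ χ u n
  0≤χ u zero    = ℚ.≤-refl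
  0≤χ u (suc n) = 0≤𝟙 em

  matches : ℝ → ℕ → ℚ
  matches u N = ∑ N (λ n → χ u n ℚ.* inv n)

  1≤χ+χ : ∀ n .{{_ : NonZero n}} → Good n → Good (2 +ℕ n) → 1ℚ ℚ.≤ χ 1ℝ n ℚ.+ χ (- 1ℝ) n
  1≤χ+χ (suc n) g g′ = by-ratio (unit-ratio {f (suc n)} {f (2 +ℕ suc n)} (good⇒unit (suc n) g) (good⇒unit (2 +ℕ suc n) g′))
    where
    by-ratio : f (suc n) ≃ 1ℝ * f (2 +ℕ suc n) ⊎ f (suc n) ≃ - 1ℝ * f (2 +ℕ suc n) →
               1ℚ ℚ.≤ χ 1ℝ (suc n) ℚ.+ χ (- 1ℝ) (suc n)
    by-ratio (inj₁ h) = ≤-by-difference (χ (- 1ℝ) (suc n)) (0≤χ (- 1ℝ) (suc n)) (cong (ℚ._+ χ (- 1ℝ) (suc n)) (𝟙-yes em h))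
    by-ratio (inj₂ h) = ≤-by-difference (χ 1ℝ (suc n)) (0≤χ 1ℝ (suc n))
      (trans (cong (λ t → χ 1ℝ (suc n) ℚ.+ t) (𝟙-yes em h)) (ℚ.+-comm (χ 1ℝ (suc n)) 1ℚ))

  module Pigeonhole {c : ℚ} (0<c : 0ℚ ℚ.< c) {j₀ : ℕ}
    (dense : ∀ j → j₀ ℕ.≤ j → ⌜ j ⌝ ℚ.* c ℚ.≤ ∑ (2 ℕ.^ j) (λ n → (χ 1ℝ n ℚ.+ χ (- 1ℝ) n) ℚ.* inv n)) where

    Many : ℝ → ℕ → Set
    Many u j = ⌜ j ⌝ ℚ.* c ℚ.* ½ ℚ.≤ matches u (2 ℕ.^ j)

    many : ∀ j → j₀ ℕ.≤ j → ¬ Many 1ℝ j → Many (- 1ℝ) j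
    many j j₀≤j few = ℚ.≮⇒≥ λ few′ → ℚ.<-irrefl refl (ℚ.<-≤-trans (half-bounds {ε = ⌜ j ⌝ ℚ.* c} (ℚ.≰⇒> few) few′)
      (ℚ.≤-trans (dense j j₀≤j) (ℚ.≤-reflexive (trans
        (∑-cong (2 ℕ.^ j) (λ n _ → ℚ.*-distribʳ-+ (inv n) (χ 1ℝ n) (χ (- 1ℝ) n)))
        (∑-+ (2 ℕ.^ j) (λ n → χ 1ℝ n ℚ.* inv n) (λ n → χ (- 1ℝ) n ℚ.* inv n))))))

    Frequent : ℝ → Set
    Frequent u = ∀ J → ∃ λ j → J ℕ.≤ j × Many u j

    -- For each large j one of the signs takes half of j c, but which one may depend on j. A limsup
    -- needs only infinitely many j, so a sign that recurs is enough.
    frequent : Frequent 1ℝ ⊎ Frequent (- 1ℝ)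
    frequent = by-cases em
      where
      decide : ¬ (∃ λ J → ∀ j → J ℕ.≤ j → ¬ Many 1ℝ j) → ∀ J → Dec (∃ λ j → J ℕ.≤ j × Many 1ℝ j) → ∃ λ j → J ℕ.≤ j × Many 1ℝ j
      decide ¬few J (yes h) = h
      decide ¬few J (no ¬h) = contradiction (J , λ j J≤j m → ¬h (j , J≤j , m)) ¬few

      by-cases : Dec (∃ λ J → ∀ j → J ℕ.≤ j → ¬ Many 1ℝ j) → Frequent 1ℝ ⊎ Frequent (- 1ℝ)
      by-cases (yes (J₀ , few)) = inj₂ λ J → J ℕ.⊔ (J₀ ℕ.⊔ j₀) , ℕ.m≤m⊔n J _ ,
        (let le = ℕ.m≤n⊔m J (J₀ ℕ.⊔ j₀) in many _ (≤⊔ʳ J₀ j₀ le) (few _ (≤⊔ˡ J₀ j₀ le)))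
      by-cases (no ¬few) = inj₁ λ J → decide ¬few J em

    -- log x = 2j gives 1/log x at least 1/(4j + 2) ≥ 1/(6j), and the sum is at least j c/2; their
    -- product is c/12.
    r : ℚ
    r = inv 6 ℚ.* c ℚ.* ½

    0<r : 0ℚ ℚ.< r
    0<r = half-pos (*-pos (0<inv 6) 0<c)

    large : ∀ u j .{{_ : NonZero j}} → Many u j → let x = exp (fromℕ (j ℕ.+ j)) in
            ∃ λ N → ∀ i → N ℕ.≤ i → r ℚ.≤ seq (log x ⁻¹) i ℚ.* matches u ⌊ x ⌋
    large u j many-j = proj₁ eventually , λ i le → begin
        inv 6 ℚ.* c ℚ.* ½
          ≡⟨ cong (λ t → t ℚ.* c ℚ.* ½) inv6≡ ⟩
        inv (6 ℕ.* j) ℚ.* ⌜ j ⌝ ℚ.* c ℚ.* ½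
          ≡⟨ solve 4 (λ i j c h → i :* j :* c :* h := i :* (j :* c :* h)) refl (inv (6 ℕ.* j)) ⌜ j ⌝ c ½ ⟩
        inv (6 ℕ.* j) ℚ.* (⌜ j ⌝ ℚ.* c ℚ.* ½)
          ≤⟨ *-mono (0≤inv (6 ℕ.* j)) 0≤matches (ℚ.≤-trans (inv-antimono 4j+2≤6j) (proj₂ eventually i le))
               (ℚ.≤-trans many-j (∑-extend (λ n → χ u n ℚ.* inv n) (λ n → *-nonneg (0≤χ u n) (0≤inv n)) (2^≤floor-exp j))) ⟩
        seq (log x ⁻¹) i ℚ.* matches u ⌊ x ⌋ ∎
      where
      open ℚ.≤-Reasoning
      x = exp (fromℕ (j ℕ.+ j))
      instance
        _ = +-nonZeroʳ j j
        _ = ℕ.m*n≢0 6 j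
      eventually = ⁻¹-lower {log x} (j ℕ.+ j) (log-exp (j ℕ.+ j))
      0≤matches : 0ℚ ℚ.≤ matches u ⌊ x ⌋
      0≤matches = ∑-nonneg ⌊ x ⌋ (λ n → *-nonneg (0≤χ u n) (0≤inv n))
      inv6≡ : inv 6 ≡ inv (6 ℕ.* j) ℚ.* ⌜ j ⌝
      inv6≡ = sym (trans (cong (ℚ._* ⌜ j ⌝) (inv-*-homo 6 j)) (trans (ℚ.*-assoc (inv 6) (inv j) ⌜ j ⌝)
        (trans (cong (inv 6 ℚ.*_) (inv-* j)) (ℚ.*-identityʳ (inv 6)))))
      4j+2≤6j : 2 ℕ.* suc (j ℕ.+ j) ℕ.≤ 6 ℕ.* j
      4j+2≤6j = ℕ.≤-trans (ℕ.*-monoʳ-≤ 2 (ℕ.≤-trans (ℕ.+-monoˡ-≤ (j ℕ.+ j) (ℕ.>-nonZero⁻¹ j))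
        (ℕ.≤-reflexive (cong (λ t → j ℕ.+ (j ℕ.+ t)) (sym (ℕ.+-identityʳ j))))))
        (ℕ.≤-reflexive (sym (ℕ.*-assoc 2 3 j)))

    frequent⇒unbounded : ∀ u → Frequent u → ∀ X → ∃ λ x → X ≤ x ×
      ∃ λ N → ∀ i → N ℕ.≤ i → r ℚ.≤ seq (log x ⁻¹) i ℚ.* matches u ⌊ x ⌋
    frequent⇒unbounded u freq X =
      let
        (B , N , bounded) = eventually-bounded X
        (j , B<j , many-j) = freq (suc B)
      in exp (fromℕ (j ℕ.+ j)) , ≤exp j {X} B N bounded (ℕ.<⇒≤ B<j) ,
         large u j {{ℕ.>-nonZero (ℕ.<-≤-trans ℕ.z<s B<j)}} many-j

  matching-sign : ∀ {q} → (∀ N → ∑ N (λ p → 𝟙 (em {Bad f p}) ℚ.* inv p) ℚ.≤ q) →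
    ∃ λ u → (u ≃ - 1ℝ ⊎ u ≃ 1ℝ) × ∃ λ r → 0ℚ ℚ.< r × ∀ X → ∃ λ x → X ≤ x ×
      ∃ λ N → ∀ i → N ℕ.≤ i → r ℚ.≤ seq (log x ⁻¹) i ℚ.* matches u ⌊ x ⌋
  matching-sign bounded = from-density (density em (Bad f) proj₁ bounded (λ n → χ 1ℝ n ℚ.+ χ (- 1ℝ) n)
      (λ n → +-nonneg (0≤χ 1ℝ n) (0≤χ (- 1ℝ) n)) 1≤χ+χ)
    where
    ≃-refl : ∀ q → fromℚ q ≃ fromℚ q
    ≃-refl q ε 0<ε = 0 , λ _ _ → subst (λ t → ℚ.∣ t ∣ ℚ.< ε) (sym (ℚ.+-inverseʳ q)) 0<ε
    from-density : (∃ λ c → 0ℚ ℚ.< c × ∃ λ j₀ → ∀ j → j₀ ℕ.≤ j →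
        ⌜ j ⌝ ℚ.* c ℚ.≤ ∑ (2 ℕ.^ j) (λ n → (χ 1ℝ n ℚ.+ χ (- 1ℝ) n) ℚ.* inv n)) →
      ∃ λ u → (u ≃ - 1ℝ ⊎ u ≃ 1ℝ) × ∃ λ r → 0ℚ ℚ.< r × ∀ X → ∃ λ x → X ≤ x ×
        ∃ λ N → ∀ i → N ℕ.≤ i → r ℚ.≤ seq (log x ⁻¹) i ℚ.* matches u ⌊ x ⌋
    from-density (c , 0<c , j₀ , dense) = conclude frequent
      where
      open Pigeonhole 0<c dense
      conclude : Frequent 1ℝ ⊎ Frequent (- 1ℝ) →
        ∃ λ u → (u ≃ - 1ℝ ⊎ u ≃ 1ℝ) × ∃ λ r → 0ℚ ℚ.< r × ∀ X → ∃ λ x → X ≤ x ×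
          ∃ λ N → ∀ i → N ℕ.≤ i → r ℚ.≤ seq (log x ⁻¹) i ℚ.* matches u ⌊ x ⌋
      conclude (inj₁ freq) = 1ℝ , inj₂ (≃-refl 1ℚ) , r , 0<r , frequent⇒unbounded 1ℝ freq
      conclude (inj₂ freq) = - 1ℝ , inj₁ (≃-refl (ℚ.- 1ℚ)) , r , 0<r , frequent⇒unbounded (- 1ℝ) freq

proposition1p5 : (em : ExcludedMiddle 0ℓ) →
    let open Classical em in
    (f : Arith) →
    (∀ n .{{_ : NonZero n}} → ¬ (f n ≃ 0ℝ)) →
    Multiplicative f →
    ∑∞ (λ p → 𝟏 (Prime p × ¬ (∣ f p ∣ ≃ 1ℝ)) * 1/ℕ p) <̄ +∞ →
    ∃ λ u → (u ≃ - 1ℝ ⊎ u ≃ 1ℝ) ×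
    ι 0ℝ <̄ limsup (λ x → log x ⁻¹ * ∑≤ x (λ n → 𝟏 (f n ≃ u * f (2 +ℕ n)) * 1/ℕ n))
proposition1p5 em f _ f-mult (q , ¬q<S , _) =
  let (u , sign , r , 0<r , unbounded) = matching-sign bounded in
  -- The rational 0 separates the two cuts. Membership in the infimum asks for a rational above 0
  -- that is below every supremum: r/2 is taken, and the other r/2 is the gap in `_<_`.
  u , sign , 0ℚ , ¬0<0 , r ℚ.* ½ , half-pos 0<r , λ X →
  let (x , X≤x , N , large) = unbounded X in
  (x , X≤x) , r ℚ.* ½ , half-pos 0<r , N , λ i N≤i →
  ℚ.≤-trans (ℚ.≤-reflexive (half+half r)) (ℚ.≤-trans (large i N≤i) (ℚ.≤-reflexive
    (cong (λ t → seq (log x ⁻¹) i ℚ.* t) (sym (seq-∑₁ ⌊ x ⌋ _ (λ n → χ u n ℚ.* inv n) i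
      (λ n → cong (ℚ._* inv (suc n)) (seq-𝟏 (f (suc n) ≃ u * f (2 +ℕ suc n)) i)))))))
  where
  open Classical em
  open Elementary em
  open MatchingSign em f f-mult
  -- A partial sum is a constant sequence S, so q < S would put q below the supremum, with gap S -
  -- q.
  bounded : ∀ N → ∑ N (λ p → 𝟙 (em {Bad f p}) ℚ.* inv p) ℚ.≤ q
  bounded N = ℚ.≮⇒≥ λ q<S → ¬q<S (N , S ℚ.- q ,
      subst (ℚ._< S ℚ.- q) (ℚ.+-inverseʳ q) (ℚ.+-monoˡ-< (ℚ.- q) q<S) , 0 , λ i _ →
      ℚ.≤-reflexive (trans (solve 2 (λ q s → q :+ (s :- q) := s) refl q S) (sym (seq-∑₁ N _ (λ p → 𝟙 (em {Bad f p}) ℚ.* inv p) i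
        (λ p → cong (ℚ._* inv (suc p)) (trans (seq-𝟏 (Prime (suc p) × ¬ Unit (f (suc p))) i)
          (𝟙-⇔ em em (λ (pp , ¬u) → pp , ¬u) (λ (pp , ¬u) → pp , ¬u))))))))
    where S = ∑ N (λ p → 𝟙 (em {Bad f p}) ℚ.* inv p)
  ¬0<0 : ¬ (fromℚ 0ℚ < 0ℝ)
  ¬0<0 (ε , 0<ε , N , h) = ℚ.<-irrefl refl (ℚ.<-≤-trans 0<ε
    (ℚ.≤-trans (ℚ.≤-reflexive (sym (ℚ.+-identityˡ ε))) (h N ℕ.≤-refl)))
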